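{- For every $J\subseteq[n-2]$, the vertically rotated inverse descent class $C_nD_{n-1,J}^{ -1}\subseteq\mathfrak S_n$ is cyclic Schur-positive.
   Context: $D_{n-1,J}=\{\pi\in\mathfrak S_{n-1}:\operatorname{Des}(\pi)=J\}$ with $\operatorname{Des}(\pi)=\{i:\pi(i)>\pi(i+1)\}$; $D_{n-1,J}^{ -1}=\{\pi^{ -1}:\pi\in D_{n-1,J}\}$; $\mathfrak S_{n-1}$ is identified with permutations of $\mathfrak S_n$ fixing $n$. Permutations are multiplied as functions; $c_n=(1,2,\dots,n)=23\cdots n1$, $C_n=\langle c_n\rangle$, $XY=\{xy:x\in X, y\in Y\}$. For $\pi\in\mathfrak S_n$, $\operatorname{cDes}(\pi)=\{i\in[n]:\pi(i)>\pi(i+1)\}$ with $\pi(n+1):=\pi(1)$; $\mathbf x^S=\prod_{i\in S}x_i$. For a skew shape $\lambda/\mu$ with $n$ cells, $\operatorname{SYT}(\lambda/\mu)$ is its set of standard Young tableaux, $\operatorname{Des}(T)=\{i\in[n-1]: i+1$ is in a lower row than $i\}$. A cyclic descent extension on $\operatorname{SYT}(\lambda/\mu)$ is a pair $(\operatorname{cDes},\psi)$, $\operatorname{cDes}:\operatorname{SYT}(\lambda/\mu)\to 2^{[n]}$, $\psi$ a bijection, with $\operatorname{cDes}(T)\cap[n-1]=\operatorname{Des}(T)$, $\operatorname{cDes}(\psi T)=1+\operatorname{cDes}(T)$ (elementwise mod $n$) and $\emptyset\subsetneq\operatorname{cDes}(T)\subsetneq[n]$; it exists iff $\lambda/\mu$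 is not a connected ribbon (connected skew shape with no $2\times2$ square), and then $\sum_T\mathbf x^{\operatorname{cDes}(T)}$ is independent of the choice. $A\subseteq\mathfrak S_n$ is cyclic Schur-positive if there are nonnegative integers $m_{\lambda/\mu}$, indexed by skew shapes with $n$ cells that are not connected ribbons, with $\sum_{\pi\in A}\mathbf x^{\operatorname{cDes}(\pi)}=\sum_{\lambda/\mu}m_{\lambda/\mu}\sum_{T\in\operatorname{SYT}(\lambda/\mu)}\mathbf x^{\operatorname{cDes}(T)}$. -}

module Defs where

open import Data.Bool using (Bool; true; false; T)
open import Data.Nat using (ℕ; zero; suc; _+_; _≤_; _<_; _<ᵇ_; _≤?_; _<?_)
open import Data.Nat.Properties using () renaming (_≟_ to _≟ℕ_)
open import Data.Fin using (Fin; zero; suc; toℕ; fromℕ; fromℕ<; inject₁)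
open import Data.Fin.Properties using (all?; any?; toℕ<n; toℕ-fromℕ<) renaming (_≟_ to _≟F_)
open import Data.Fin.Subset using (Subset; ⊥; ⊤)
open import Data.List using (List; length)
open import Data.Nat.ListAction using (sum)
open import Data.Vec using (Vec; []; _∷_; lookup; tabulate; map; _∷ʳ_)
open import Data.Vec.Properties using (≡-dec)
open import Data.Product using (Σ; ∃; _×_; _,_; proj₁; proj₂)
open import Data.Product.Properties using () renaming (≡-dec to ×-≡-dec)
open import Data.Sum using (_⊎_)
open import Function.Bundles using (_↔_; Inverse)
open import Relation.Binary.PropositionalEquality using (_≡_; _≢_; subst)
open import Relation.Nullary using (Dec; yes; no; ¬_)
open import Relation.Nullary.Decidable using (True; map′; _×-dec_; _→-dec_)
import Data.Bool.Properties as BoolP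
import Data.List as L

any-vec? : ∀ {n} k {P : Vec (Fin n) k → Set} → (∀ v → Dec (P v)) → Dec (∃ P)
any-vec? zero P? with P? []
... | yes p = yes ([] , p)
... | no ¬p = no λ { ([] , p) → ¬p p }
any-vec? (suc k) {P} P? =
  map′ (λ { (x , v , p) → (x ∷ v) , p })
       (λ { ((x ∷ v) , p) → x , v , p })
       (any? λ x → any-vec? k (λ v → P? (x ∷ v)))

all-below? : ∀ b {P : ℕ → Set} → (∀ i → Dec (P i)) → Dec (∀ i → i < b → P i)
all-below? b {P} P? =
  map′ (λ h i i<b → subst P (toℕ-fromℕ< i<b) (h (fromℕ< i<b)))
       (λ h f → h (toℕ f) (toℕ<n f))
       (all? λ f → P? (toℕ f))

-- Cyclic successor on Fin (suc p):  i ↦ i+1, last ↦ 0.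
-- In 0-based indexing this is the long cycle c_n = (1,2,…,n).

rot : ∀ {p} → Fin (suc p) → Fin (suc p)
rot {zero} zero = zero
rot {suc p} zero = suc zero
rot {suc p} (suc i) with rot {p} i
... | zero = zero
... | suc j = suc (suc j)

rotPow : ∀ {p} → ℕ → Fin (suc p) → Fin (suc p)
rotPow zero i = i
rotPow (suc k) i = rot (rotPow k i)

-- Permutations of [n] in one-line notation (0-based): π i = lookup π i.

IsPerm : ∀ {n} → Vec (Fin n) n → Set
IsPerm {n} π = ∀ (i j : Fin n) → lookup π i ≡ lookup π j → i ≡ j

isPerm? : ∀ {n} (π : Vec (Fin n) n) → Dec (IsPerm π)
isPerm? π = all? λ i → all? λ j → (lookup π i ≟F lookup π j) →-dec (i ≟F j)

-- Descent set of a permutation in S_{k+1}, as a subset of [k]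
-- (index i ↔ position i+1):  π(i) > π(i+1).
des : ∀ {k} → Vec (Fin (suc k)) (suc k) → Subset k
des σ = tabulate λ i → toℕ (lookup σ (suc i)) <ᵇ toℕ (lookup σ (inject₁ i))

cDesPerm : ∀ {p} → Vec (Fin (suc p)) (suc p) → Subset (suc p)
cDesPerm π = tabulate λ i → toℕ (lookup π (rot i)) <ᵇ toℕ (lookup π i)

embed : ∀ {m} → Vec (Fin (suc m)) (suc m) → Vec (Fin (suc (suc m))) (suc (suc m))
embed {m} σ = map inject₁ σ ∷ʳ fromℕ (suc m)

-- σ ∈ D_{n-1,J}, n = m+2, J ⊆ [n-2] = [m]
InD : ∀ m → Subset m → Vec (Fin (suc m)) (suc m) → Set
InD m J σ = IsPerm σ × des σ ≡ J

InDinv : ∀ m → Subset m → Vec (Fin (suc (suc m))) (suc (suc m)) → Set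
InDinv m J τ = ∃ λ σ → InD m J σ × (∀ i → lookup τ (lookup (embed σ) i) ≡ i)

InCD : ∀ m → Subset m → Vec (Fin (suc (suc m))) (suc (suc m)) → Set
InCD m J π = IsPerm π × ∃ λ (k : Fin (suc (suc m))) → ∃ λ τ →
  InDinv m J τ × (∀ i → lookup π i ≡ rotPow (toℕ k) (lookup τ i))

inCD? : ∀ m J π → Dec (InCD m J π)
inCD? m J π =
  isPerm? π ×-dec
  (any? λ k → any-vec? (suc (suc m)) λ τ →
     (any-vec? (suc m) (λ σ →
        (isPerm? σ ×-dec ≡-dec BoolP._≟_ (des σ) J) ×-dec
        all? (λ i → lookup τ (lookup (embed σ) i) ≟F i)))
     ×-dec all? (λ i → lookup π i ≟F rotPow (toℕ k) (lookup τ i)))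

-- The set C_n D_{n-1,J}^{-1} as a type (membership is proof-irrelevant).
CD : ∀ m → Subset m → Set
CD m J = Σ (Vec (Fin (suc (suc m))) (suc (suc m))) λ π → True (inCD? m J π)

-- Skew shapes λ/μ (English notation; rows 0,1,2,… from top to bottom)

-- i-th part of a partition given as a list (0 beyond its length)
part : List ℕ → ℕ → ℕ
part L.[] i = 0
part (x L.∷ xs) zero = x
part (x L.∷ xs) (suc i) = part xs i

record SkewShape (n : ℕ) : Set where
  field
    outer inner : List ℕ
    outer-dec : ∀ i → part outer (suc i) ≤ part outer i
    inner-dec : ∀ i → part inner (suc i) ≤ part inner i
    inner⊆outer : ∀ i → part inner i ≤ part outer i
    size : sum outer ≡ sum inner + n

open SkewShape public

IsCell : ∀ {n} → SkewShape n → ℕ × ℕ → Set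
IsCell sh (i , j) = i < length (outer sh) × part (inner sh) i ≤ j × j < part (outer sh) i

Adjacent : ℕ × ℕ → ℕ × ℕ → Set
Adjacent (i , j) (i' , j') =
  (i ≡ i' × (suc j ≡ j' ⊎ suc j' ≡ j)) ⊎ (j ≡ j' × (suc i ≡ i' ⊎ suc i' ≡ i))

data Reach {n} (sh : SkewShape n) : ℕ × ℕ → ℕ × ℕ → Set where
  here : ∀ {c} → IsCell sh c → Reach sh c c
  step : ∀ {c c' d} → IsCell sh c → Adjacent c c' → Reach sh c' d → Reach sh c d

Connected : ∀ {n} → SkewShape n → Set
Connected sh = ∀ c d → IsCell sh c → IsCell sh d → Reach sh c d

No2x2 : ∀ {n} → SkewShape n → Set
No2x2 sh = ¬ (∃ λ i → ∃ λ j → IsCell sh (i , j) × IsCell sh (i , suc j)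
                              × IsCell sh (suc i , j) × IsCell sh (suc i , suc j))

ConnectedRibbon : ∀ {n} → SkewShape n → Set
ConnectedRibbon sh = Connected sh × No2x2 sh

-- Standard Young tableaux.  A tableau is recorded by its inverse:
-- T k = the cell containing the entry k+1.  The filling is a bijection
-- cells ↔ [n], increasing along rows and down columns.

record IsSYT {n} (sh : SkewShape n) (T : Vec (ℕ × ℕ) n) : Set where
  field
    cells : ∀ k → IsCell sh (lookup T k)
    inj : ∀ k k' → lookup T k ≡ lookup T k' → k ≡ k'
    surj : ∀ i j → IsCell sh (i , j) → ∃ λ k → lookup T k ≡ (i , j)
    rows : ∀ k k' → proj₁ (lookup T k) ≡ proj₁ (lookup T k') →
           proj₂ (lookup T k) < proj₂ (lookup T k') → toℕ k < toℕ k'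
    cols : ∀ k k' → proj₂ (lookup T k) ≡ proj₂ (lookup T k') →
           proj₁ (lookup T k) < proj₁ (lookup T k') → toℕ k < toℕ k'

private
  ≡-pair? : (a b : ℕ × ℕ) → Dec (a ≡ b)
  ≡-pair? = ×-≡-dec _≟ℕ_ _≟ℕ_

  isCell? : ∀ {n} (sh : SkewShape n) c → Dec (IsCell sh c)
  isCell? sh (i , j) = (i <? length (outer sh)) ×-dec (part (inner sh) i ≤? j)
                       ×-dec (j <? part (outer sh) i)

  surj? : ∀ {n} (sh : SkewShape n) (T : Vec (ℕ × ℕ) n) →
          Dec (∀ i j → IsCell sh (i , j) → ∃ λ k → lookup T k ≡ (i , j))
  surj? sh T =
    map′ (λ h i j (a , b , c) → h i a j c b)
         (λ h i a j c b → h i j (a , b , c))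
         (all-below? (length (outer sh)) λ i → all-below? (part (outer sh) i) λ j →
            (part (inner sh) i ≤? j) →-dec any? (λ k → ≡-pair? (lookup T k) (i , j)))

isSYT? : ∀ {n} (sh : SkewShape n) (T : Vec (ℕ × ℕ) n) → Dec (IsSYT sh T)
isSYT? {n} sh T =
  map′ {A = _ × _ × _ × _ × _} (λ (a , b , c , d , e) → record { cells = a ; inj = b ; surj = c ; rows = d ; cols = e })
       (λ t → IsSYT.cells t , IsSYT.inj t , IsSYT.surj t , IsSYT.rows t , IsSYT.cols t)
       ((all? {n = n} λ k → isCell? sh (lookup T k))
        ×-dec (all? λ k → all? λ k' → ≡-pair? (lookup T k) (lookup T k') →-dec (k ≟F k'))
        ×-dec surj? sh T
        ×-dec (all? λ k → all? λ k' →
                 (proj₁ (lookup T k) ≟ℕ proj₁ (lookup T k')) →-dec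
                 (proj₂ (lookup T k) <? proj₂ (lookup T k')) →-dec (toℕ k <? toℕ k'))
        ×-dec (all? λ k → all? λ k' →
                 (proj₂ (lookup T k) ≟ℕ proj₂ (lookup T k')) →-dec
                 (proj₁ (lookup T k) <? proj₁ (lookup T k')) →-dec (toℕ k <? toℕ k')))

-- SYT(λ/μ) as a type (membership is proof-irrelevant)
SYT : ∀ {n} → SkewShape n → Set
SYT {n} sh = Σ (Vec (ℕ × ℕ) n) λ T → True (isSYT? sh T)

-- Des(T) ⊆ [n-1]: i+1 lies in a lower row than i (index i-1 ↔ position i)
DesT : ∀ {p} → Vec (ℕ × ℕ) (suc p) → Subset p
DesT T = tabulate λ i → proj₁ (lookup T (inject₁ i)) <ᵇ proj₁ (lookup T (suc i))

record CyclicDescentExtension {p} (sh : SkewShape (suc p)) : Set where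
  field
    cDes : SYT sh → Subset (suc p)
    ψ : SYT sh ↔ SYT sh
    extends : ∀ T (i : Fin p) → lookup (cDes T) (inject₁ i) ≡ lookup (DesT (proj₁ T)) i
    equivariant : ∀ T (i : Fin (suc p)) →
                  lookup (cDes (Inverse.to ψ T)) (rot i) ≡ lookup (cDes T) i
    nonEmpty : ∀ T → cDes T ≢ ⊥
    nonFull : ∀ T → cDes T ≢ ⊤

-- Cyclic Schur-positivity of A ⊆ S_n (A given as a type of permutations
-- with proof-irrelevant membership, via an embedding into one-line notation).
-- Σ_{π∈A} x^{cDes π} = Σ_k Σ_{T ∈ SYT(sh k)} x^{cDes_k T}, for a finite family
-- sh 0, …, sh (r-1) of non-ribbon skew shapes (listed with multiplicity),
-- expressed as a cDes-preserving bijection (coefficients of the squarefree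
-- monomials x^S are cardinalities of the fibres).

CyclicSchurPositive : ∀ p (A : Set) → (A → Vec (Fin (suc p)) (suc p)) → Set
CyclicSchurPositive p A perm =
  Σ ℕ λ r →
  Σ (Fin r → SkewShape (suc p)) λ sh →
  ((k : Fin r) → ¬ ConnectedRibbon (sh k)) ×
  Σ ((k : Fin r) → CyclicDescentExtension (sh k)) λ ext →
  Σ (A ↔ Σ (Fin r) (λ k → SYT (sh k))) λ Φ →
    ∀ a → cDesPerm (perm a) ≡
          CyclicDescentExtension.cDes (ext (proj₁ (Inverse.to Φ a))) (proj₂ (Inverse.to Φ a))

{-# OPTIONS --safe #-}
module Submission where

-- A single shape suffices: the ribbon with n - 1 cells and descent set J together with a detached
-- cell.  Rotate the positions of π ∈ C_n D⁻¹ so that the value n stands last: this turns π into its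
-- centre k = π⁻¹(n) and a permutation ζ fixing n.  Then cDes π is cDes ζ shifted according to k,
-- while membership in C_n D⁻¹ says that the cyclic permutation matrix of ζ, recentred at another of
-- its points, has inverse descent set J.  For a tableau, k is the entry of the detached cell, and
-- the ribbon is read as a word in the remaining entries.  Both sides turn out to be equidistributed
-- with the pairs (k , ζ) such that ζ itself has inverse descent set J, and on these pairs
-- k ↦ k + 1 is a cyclic rotation of cDes.
--
-- By Möbius inversion it is enough to compare permutations that increase on the arcs cut out by a
-- set S and whose inverse decreases on the blocks cut out by a set J.  Such permutations are the
-- 0-1 matrices with prescribed row and column sums (arc by block, since an arc and a block share at
-- most one point), and recentring merely rotates the orders in which such a matrix is read.

open import Defs
open import Data.Bool using (Bool; true; false; T; not; _∧_; _∨_; if_then_else_)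
import Data.Bool.Properties as Boolₚ
open import Data.Empty using (⊥; ⊥-elim)
open import Data.Fin using (Fin; zero; suc; toℕ; fromℕ; fromℕ<; inject₁; lower₁; punchOut)
open import Data.Fin.Properties using (any?; toℕ-injective; toℕ<n; toℕ≤pred[n]; toℕ-fromℕ; toℕ-fromℕ<; toℕ-inject₁; fromℕ≢inject₁; inject₁-injective; inject₁-lower₁; punchOut-injective; injective⇒≤; injective⇒existsPivot) renaming (_≟_ to _≟F_)
open import Data.Fin.Relation.Unary.Top using (‵fromℕ; ‵inject₁) renaming (view to topView)
open import Data.Fin.Subset using (Subset)
open import Data.List as List using (List; []; _∷_; length; filter; map; allFin; applyDownFrom; cartesianProductWith)
open import Data.List.Membership.Propositional using (_∈_)
open import Data.List.Membership.Propositional.Properties using (∈-lookup; ∈-filter⁺; ∈-filter⁻; ∈-map⁺; ∈-map⁻; ∈-allFin; ∈-cartesianProductWith⁺)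
open import Data.List.Properties using (length-applyDownFrom)
import Data.List.Relation.Binary.Permutation.Setoid as PermS
import Data.List.Relation.Binary.Permutation.Setoid.Properties as PermSₚ
import Data.List.Relation.Unary.All as All
open import Data.List.Relation.Unary.Any as Any using (here)
open import Data.List.Relation.Unary.Any.Properties using (lookup-index)
open import Data.List.Relation.Unary.Unique.Propositional using (Unique; []; _∷_)
import Data.List.Relation.Unary.Unique.Propositional.Properties as Uniqueₚ
open import Data.Nat using (ℕ; zero; suc; _+_; _*_; _∸_; _≤_; _<_; z≤n; s≤s; s≤s⁻¹; _<ᵇ_; _≤?_; _<?_)
open import Data.Nat.ListAction using (sum)
import Data.Nat.Properties as ℕₚ
open import Data.Nat.Solver using (module +-*-Solver)
open import Data.Product using (Σ; ∃; ∃₂; _×_; _,_; proj₁; proj₂)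
open import Data.Product.Properties using () renaming (≡-dec to ×-≡-dec)
open import Data.Sum as Sum using (_⊎_; inj₁; inj₂)
open import Data.Vec as Vec using (Vec; []; _∷_; lookup; tabulate; take; drop; _∷ʳ_) renaming (_++_ to _++ᵛ_)
import Data.Vec.Properties as Vecₚ
open import Function using (_∘_)
open import Function.Bundles using (_↔_; Inverse; mk↔ₛ′)
open import Function.Construct.Composition using (_↔-∘_)
open import Function.Construct.Symmetry using (↔-sym)
open import Relation.Binary.Bundles using (Setoid)
import Relation.Binary.Construct.On as On
open import Relation.Binary.Definitions using (tri<; tri≈; tri>)
open import Relation.Binary.PropositionalEquality using (_≡_; _≢_; refl; sym; trans; cong; cong₂; subst; subst₂; setoid)
open import Relation.Nullary using (Dec; yes; no; ¬_; contradiction)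
open import Relation.Nullary.Decidable using (True; toWitness; fromWitness; _×-dec_)

-- Ranks

-- The obstacle is that a matrix read around a centre has to be restored from its labels alone. In
-- the frame centred at `l` the block reserved for the last row is occupied by `l`, in the standard
-- frame by `last`; hence these two points exchange block labels (`swapLast`). After the exchange
-- the label of `l` marks where the other frame is cut, and monotonicity on arcs and blocks forces
-- every other point to lie above or below `l` exactly as its pair of labels compares with that of
-- `l`, blocks first and arcs on a tie. So the orders of rows and columns in both frames are
-- functions of the labels. It remains to recognise the centre after straightening: the points of
-- its arc on its two sides change places, so it moves to `mirror l`, a column that depends only on
-- `S` and `l` and not on the matrix.

Inj : ∀ {n} {B : Set} → (Fin n → B) → Set
Inj f = ∀ a b → f a ≡ f b → a ≡ b

Inj-∘ : ∀ {k n} {B : Set} {f : Fin n → B} {g : Fin k → Fin n} → Inj f → Inj g → Inj (f ∘ g)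
Inj-∘ {g = g} fi gi a b eq = gi a b (fi (g a) (g b) eq)

Inj⇒surj : ∀ {n} {f : Fin n → Fin n} → Inj f → ∀ y → ∃ λ x → f x ≡ y
Inj⇒surj {suc n} {f} fi y with any? (λ x → f x ≟F y)
... | yes r = r
... | no ¬r = contradiction (injective⇒≤ {f = g} g-inj) ℕₚ.1+n≰n
  where
  y≢f : ∀ x → y ≢ f x
  y≢f x eq = ¬r (x , sym eq)
  g : Fin (suc n) → Fin n
  g x = punchOut (y≢f x)
  g-inj : ∀ {a b} → g a ≡ g b → a ≡ b
  g-inj {a} {b} eq = fi a b (punchOut-injective (y≢f a) (y≢f b) eq)

opaque
  -- Junk value y when y is not in the image of f.
  inv : ∀ {n} → (Fin n → Fin n) → Fin n → Fin n
  inv f y with any? (λ x → f x ≟F y)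
  ... | yes (x , _) = x
  ... | no _ = y

module _ {n} {f : Fin n → Fin n} (fi : Inj f) where

  opaque
    unfolding inv

    f∘inv : ∀ y → f (inv f y) ≡ y
    f∘inv y with any? (λ x → f x ≟F y)
    ... | yes (_ , eq) = eq
    ... | no ¬r = contradiction (Inj⇒surj fi y) ¬r

  inv∘f : ∀ x → inv f (f x) ≡ x
  inv∘f x = fi _ _ (f∘inv (f x))

  inv-inj : Inj (inv f)
  inv-inj a b eq = trans (sym (f∘inv a)) (trans (cong f eq) (f∘inv b))

  inv-unique : ∀ {x y} → f x ≡ y → inv f y ≡ x
  inv-unique {x} eq = trans (cong (inv f) (sym eq)) (inv∘f x)

inv-cong : ∀ {n} {f g : Fin n → Fin n} → Inj f → Inj g → (∀ x → f x ≡ g x) → ∀ y → inv f y ≡ inv g y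
inv-cong fi gi h y = inv-unique fi (trans (h _) (f∘inv gi y))

Mono : ∀ {n} → (Fin n → ℕ) → Set
Mono b = ∀ {p q} → toℕ p ≤ toℕ q → b p ≤ b q

-- Pigeonhole: an injection cannot send all positions up to `p` below `p`, so some `q` up to `p` has
-- `p ≤ θ q`, and then `b p ≤ b (θ q) ≤ b (θ p)`.
mono-rearrange-≥ : ∀ {n} {b : Fin n → ℕ} {θ : Fin n → Fin n} →
  Mono b → Inj θ → Mono (b ∘ θ) → ∀ p → b p ≤ b (θ p)
mono-rearrange-≥ mb θi mbθ p with injective⇒existsPivot (λ {a} {b} → θi a b) p
... | q , q≤p , p≤θq = ℕₚ.≤-trans (mb p≤θq) (mbθ q≤p)

-- A multiset has only one sorted arrangement. The missing inequality is the previous one for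
-- `inv θ` and the labelling `b ∘ θ`.
mono-rearrange : ∀ {n} {b : Fin n → ℕ} {θ : Fin n → Fin n} →
  Mono b → Inj θ → Mono (b ∘ θ) → ∀ p → b (θ p) ≡ b p
mono-rearrange {b = b} {θ} mb θi mbθ p = ℕₚ.≤-antisym
  (subst (b (θ p) ≤_) (cong b (f∘inv θi p))
    (mono-rearrange-≥ {b = b ∘ θ} {inv θ} mbθ (inv-inj θi)
      (λ {x} {y} le → ℕₚ.≤-trans (ℕₚ.≤-reflexive (cong b (f∘inv θi x)))
         (ℕₚ.≤-trans (mb le) (ℕₚ.≤-reflexive (cong b (sym (f∘inv θi y)))))) p))
  (mono-rearrange-≥ mb θi mbθ p)

-- Sorting points by label fills the blocks in order, so every point lands in the block of its own
-- label. The injection `g` certifies that `L` takes each value as often as `b` does.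
label-preserved : ∀ {n} {b L : Fin n → ℕ} {ρ g : Fin n → Fin n} → Mono b → Inj ρ → Inj g →
  (∀ x → L x ≡ b (g x)) → (∀ x y → L x < L y → toℕ (ρ x) < toℕ (ρ y)) →
  ∀ x → b (ρ x) ≡ L x
label-preserved {b = b} {L} {ρ} {g} mb ρi gi Lb h x =
  trans (sym (mono-rearrange {b = b} {θ} mb (Inj-∘ gi (inv-inj ρi)) mθ (ρ x)))
        (trans (cong (b ∘ g) (inv∘f ρi x)) (sym (Lb x)))
  where
  θ : _ → _
  θ = g ∘ inv ρ
  mθ : Mono (b ∘ θ)
  mθ {p} {q} p≤q = ℕₚ.≮⇒≥ λ lt → ℕₚ.≤⇒≯ p≤q
    (subst (λ z → toℕ z < toℕ p) (f∘inv ρi q)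
      (subst (λ z → toℕ (ρ (inv ρ q)) < toℕ z) (f∘inv ρi p)
        (h (inv ρ q) (inv ρ p) (subst (_< L (inv ρ p)) (sym (Lb _)) (subst (b (θ q) <_) (sym (Lb _)) lt)))))

same-order : ∀ {n} {f g : Fin n → Fin n} → Inj f → Inj g →
  (∀ x y → toℕ (f x) < toℕ (f y) → toℕ (g x) < toℕ (g y)) → ∀ x → g x ≡ f x
same-order fi gi h x = toℕ-injective (label-preserved (λ le → le) gi fi (λ _ → refl) h x)

count : ∀ {n} → (Fin n → Bool) → ℕ
count {zero} p = 0
count {suc n} p with p zero
... | true = suc (count (p ∘ suc))
... | false = count (p ∘ suc)

count-≤ : ∀ {n} {p q : Fin n → Bool} → (∀ y → T (p y) → T (q y)) → count p ≤ count q
count-≤ {zero} h = z≤n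
count-≤ {suc n} {p} {q} h with p zero | q zero | h zero
... | true | true | _ = s≤s (count-≤ (h ∘ suc))
... | true | false | e = ⊥-elim (e _)
... | false | true | _ = ℕₚ.m≤n⇒m≤1+n (count-≤ (h ∘ suc))
... | false | false | _ = count-≤ (h ∘ suc)

count-< : ∀ {n} {p q : Fin n → Bool} → (∀ y → T (p y) → T (q y)) →
  ∀ x → ¬ T (p x) → T (q x) → count p < count q
count-< {suc n} {p} {q} h zero np qx with p zero | q zero
... | true | _ = ⊥-elim (np _)
... | false | true = s≤s (count-≤ (h ∘ suc))
count-< {suc n} {p} {q} h (suc x) np qx with p zero | q zero | h zero
... | true | true | _ = s≤s (count-< (h ∘ suc) x np qx)
... | true | false | e = ⊥-elim (e _)
... | false | true | _ = ℕₚ.m≤n⇒m≤1+n (count-< (h ∘ suc) x np qx)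
... | false | false | _ = count-< (h ∘ suc) x np qx

count-true : ∀ n → count {n} (λ _ → true) ≡ n
count-true zero = refl
count-true (suc n) = cong suc (count-true n)

module _ {n} (κ : Fin n → ℕ) where

  rank# : Fin n → ℕ
  rank# x = count (λ y → κ y <ᵇ κ x)

  rank#-bound : ∀ x → rank# x < n
  rank#-bound x = subst (rank# x <_) (count-true n)
    (count-< (λ _ _ → _) x (λ t → ℕₚ.<-irrefl refl (ℕₚ.<ᵇ⇒< (κ x) _ t)) _)

  opaque
    rank : Fin n → Fin n
    rank x = fromℕ< (rank#-bound x)

    toℕ-rank : ∀ x → toℕ (rank x) ≡ rank# x
    toℕ-rank x = toℕ-fromℕ< (rank#-bound x)

  rank-mono : ∀ x y → κ x < κ y → toℕ (rank x) < toℕ (rank y)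
  rank-mono x y lt = subst₂ _<_ (sym (toℕ-rank x)) (sym (toℕ-rank y)) (count-<
    (λ z t → ℕₚ.<⇒<ᵇ (ℕₚ.<-trans (ℕₚ.<ᵇ⇒< (κ z) _ t) lt)) x
    (λ t → ℕₚ.<-irrefl refl (ℕₚ.<ᵇ⇒< (κ x) _ t)) (ℕₚ.<⇒<ᵇ lt))

  rank-reflects : ∀ x y → toℕ (rank x) < toℕ (rank y) → κ x < κ y
  rank-reflects x y lt with ℕₚ.<-cmp (κ x) (κ y)
  ... | tri< l _ _ = l
  ... | tri≈ _ e _ = contradiction
    (trans (toℕ-rank x) (trans (cong (λ c → count (λ z → κ z <ᵇ c)) e) (sym (toℕ-rank y)))) (ℕₚ.<⇒≢ lt)
  ... | tri> _ _ g = contradiction (rank-mono y x g) (ℕₚ.<-asym lt)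

  rank-inj : Inj κ → Inj rank
  rank-inj κi x y eq with ℕₚ.<-cmp (κ x) (κ y)
  ... | tri< l _ _ = contradiction (rank-mono x y l) (ℕₚ.<-irrefl (cong toℕ eq))
  ... | tri≈ _ e _ = κi x y e
  ... | tri> _ _ g = contradiction (rank-mono y x g) (ℕₚ.<-irrefl (cong toℕ (sym eq)))

-- Only the set of points below `x` matters, so keys that order the remaining points differently may
-- still place `x` alike. This locates the centre.
rank-≡ : ∀ {n} {κ κ' : Fin n → ℕ} x → (∀ y → κ y < κ x → κ' y < κ' x) → (∀ y → κ' y < κ' x → κ y < κ x) →
  rank κ x ≡ rank κ' x
rank-≡ {κ = κ} {κ'} x h h' = toℕ-injective (trans (toℕ-rank κ x) (trans
  (ℕₚ.≤-antisym (count-≤ (λ y t → ℕₚ.<⇒<ᵇ (h y (ℕₚ.<ᵇ⇒< (κ y) _ t))))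
                (count-≤ (λ y t → ℕₚ.<⇒<ᵇ (h' y (ℕₚ.<ᵇ⇒< (κ' y) _ t)))))
  (sym (toℕ-rank κ' x))))

rank-unique : ∀ {n} {κ : Fin n → ℕ} {f : Fin n → Fin n} → Inj κ → Inj f →
  (∀ x y → κ x < κ y → toℕ (f x) < toℕ (f y)) → ∀ x → rank κ x ≡ f x
rank-unique {κ = κ} κi fi h x =
  sym (same-order (rank-inj κ κi) fi (λ a b lt → h a b (rank-reflects κ a b lt)) x)

-- Möbius inversion for subset-valued statistics

Sub : ∀ {U : Set} {P : U → Set} → (∀ u → Dec (P u)) → Set
Sub {U} P? = Σ U λ u → True (P? u)

Sub-≡ : ∀ {U : Set} {P : U → Set} {P? : ∀ u → Dec (P u)} {x y : Sub P?} → proj₁ x ≡ proj₁ y → x ≡ y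
Sub-≡ {x = u , p} {.u , q} refl = cong (u ,_) (Boolₚ.T-irrelevant p q)

countᴸ : ∀ {X : Set} → (X → Bool) → List X → ℕ
countᴸ p [] = 0
countᴸ p (x ∷ xs) = if p x then suc (countᴸ p xs) else countᴸ p xs

countᴸ-filter : ∀ {X : Set} (p : X → Bool) xs → countᴸ p xs ≡ length (filter (λ x → Boolₚ._≟_ (p x) true) xs)
countᴸ-filter p [] = refl
countᴸ-filter p (x ∷ xs) with p x
... | true = cong suc (countᴸ-filter p xs)
... | false = countᴸ-filter p xs

lookup-unique : ∀ {X : Set} {xs : List X} → Unique xs → ∀ i j → List.lookup xs i ≡ List.lookup xs j → i ≡ j
lookup-unique (h ∷ u) zero zero eq = refl
lookup-unique (h ∷ u) zero (suc j) eq = ⊥-elim (All.lookup h (∈-lookup j) eq)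
lookup-unique (h ∷ u) (suc i) zero eq = ⊥-elim (All.lookup h (∈-lookup i) (sym eq))
lookup-unique (h ∷ u) (suc i) (suc j) eq = cong suc (lookup-unique u i j eq)

length-≤ : ∀ {X Y : Set} {xs : List X} {ys : List Y} (f : X → Y) (g : Y → X) → Unique xs →
  (∀ {x} → x ∈ xs → f x ∈ ys × g (f x) ≡ x) → length xs ≤ length ys
length-≤ {xs = xs} {ys} f g u h = injective⇒≤ {f = φ} φ-inj
  where
  mem : ∀ i → f (List.lookup xs i) ∈ ys × g (f (List.lookup xs i)) ≡ List.lookup xs i
  mem i = h (∈-lookup i)
  φ : Fin (length xs) → Fin (length ys)
  φ i = Any.index (proj₁ (mem i))
  φ-inj : ∀ {i j} → φ i ≡ φ j → i ≡ j
  φ-inj {i} {j} eq = lookup-unique u i j (trans (sym (proj₂ (mem i))) (trans (cong g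
    (trans (lookup-index (proj₁ (mem i)))
        (trans (cong (List.lookup ys) eq) (sym (lookup-index (proj₁ (mem j)))))))
    (proj₂ (mem j))))

-- The bound comes first: `leq a x` tests that `x` is contained in `a`.
leq eqv : ∀ {N} → Vec Bool N → Vec Bool N → Bool
leq [] [] = true
leq (a ∷ as) (x ∷ xs) = (not x ∨ a) ∧ leq as xs
eqv [] [] = true
eqv (true ∷ as) (x ∷ xs) = x ∧ eqv as xs
eqv (false ∷ as) (x ∷ xs) = not x ∧ eqv as xs

countᴸ-map : ∀ {X Y : Set} (p : Y → Bool) (s : X → Y) xs → countᴸ p (map s xs) ≡ countᴸ (p ∘ s) xs
countᴸ-map p s [] = refl
countᴸ-map p s (x ∷ xs) = cong (λ c → if p (s x) then suc c else c) (countᴸ-map p s xs)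

tailsWithHead : ∀ {N} → Bool → List (Vec Bool (suc N)) → List (Vec Bool N)
tailsWithHead b [] = []
tailsWithHead true ((true ∷ v) ∷ ks) = v ∷ tailsWithHead true ks
tailsWithHead true ((false ∷ v) ∷ ks) = tailsWithHead true ks
tailsWithHead false ((true ∷ v) ∷ ks) = tailsWithHead false ks
tailsWithHead false ((false ∷ v) ∷ ks) = v ∷ tailsWithHead false ks

module _ {N} (A : Vec Bool N) where

  countᴸ-leq-false : ∀ ks → countᴸ (leq (false ∷ A)) ks ≡ countᴸ (leq A) (tailsWithHead false ks)
  countᴸ-leq-false [] = refl
  countᴸ-leq-false ((true ∷ v) ∷ ks) = countᴸ-leq-false ks
  countᴸ-leq-false ((false ∷ v) ∷ ks) = cong (λ c → if leq A v then suc c else c) (countᴸ-leq-false ks)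

  countᴸ-leq-true : ∀ ks → countᴸ (leq (true ∷ A)) ks ≡
    countᴸ (leq A) (tailsWithHead false ks) + countᴸ (leq A) (tailsWithHead true ks)
  countᴸ-leq-true [] = refl
  countᴸ-leq-true ((false ∷ v) ∷ ks) with leq A v
  ... | true = cong suc (countᴸ-leq-true ks)
  ... | false = countᴸ-leq-true ks
  countᴸ-leq-true ((true ∷ v) ∷ ks) with leq A v
  ... | true = trans (cong suc (countᴸ-leq-true ks)) (sym (ℕₚ.+-suc _ _))
  ... | false = countᴸ-leq-true ks

  countᴸ-eqv : ∀ b ks → countᴸ (eqv (b ∷ A)) ks ≡ countᴸ (eqv A) (tailsWithHead b ks)
  countᴸ-eqv b [] = refl
  countᴸ-eqv true ((true ∷ v) ∷ ks) = cong (λ c → if eqv A v then suc c else c) (countᴸ-eqv true ks)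
  countᴸ-eqv true ((false ∷ v) ∷ ks) = countᴸ-eqv true ks
  countᴸ-eqv false ((true ∷ v) ∷ ks) = countᴸ-eqv false ks
  countᴸ-eqv false ((false ∷ v) ∷ ks) = cong (λ c → if eqv A v then suc c else c) (countᴸ-eqv false ks)

-- One coordinate at a time: bounds that begin with `false` count the sets without the first
-- element, and subtracting them from bounds that begin with `true` counts the sets with it.
möbius : ∀ {N} (ks ls : List (Vec Bool N)) →
  (∀ A → countᴸ (leq A) ks ≡ countᴸ (leq A) ls) → ∀ A → countᴸ (eqv A) ks ≡ countᴸ (eqv A) ls
möbius {zero} ks ls h [] = trans (sym (leq≡eqv ks)) (trans (h []) (leq≡eqv ls))
  where
  leq≡eqv : ∀ ks → countᴸ (leq []) ks ≡ countᴸ (eqv []) ks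
  leq≡eqv [] = refl
  leq≡eqv ([] ∷ ks) = cong suc (leq≡eqv ks)
möbius {suc N} ks ls h (b ∷ A) = trans (countᴸ-eqv A b ks) (trans (rec b) (sym (countᴸ-eqv A b ls)))
  where
  hf : ∀ A → countᴸ (leq A) (tailsWithHead false ks) ≡ countᴸ (leq A) (tailsWithHead false ls)
  hf A = trans (sym (countᴸ-leq-false A ks)) (trans (h (false ∷ A)) (countᴸ-leq-false A ls))
  ht : ∀ A → countᴸ (leq A) (tailsWithHead true ks) ≡ countᴸ (leq A) (tailsWithHead true ls)
  ht A = ℕₚ.+-cancelˡ-≡ (countᴸ (leq A) (tailsWithHead false ks)) _ _
    (trans (sym (countᴸ-leq-true A ks)) (trans (h (true ∷ A)) (trans (countᴸ-leq-true A ls)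
      (cong (_+ countᴸ (leq A) (tailsWithHead true ls)) (sym (hf A))))))
  rec : ∀ b → countᴸ (eqv A) (tailsWithHead b ks) ≡ countᴸ (eqv A) (tailsWithHead b ls)
  rec true = möbius (tailsWithHead true ks) (tailsWithHead true ls) ht A
  rec false = möbius (tailsWithHead false ks) (tailsWithHead false ls) hf A

eqv-refl : ∀ {N} (v : Vec Bool N) → eqv v v ≡ true
eqv-refl [] = refl
eqv-refl (true ∷ v) = eqv-refl v
eqv-refl (false ∷ v) = eqv-refl v

eqv⇒≡ : ∀ {N} (u v : Vec Bool N) → eqv u v ≡ true → u ≡ v
eqv⇒≡ [] [] eq = refl
eqv⇒≡ (true ∷ u) (true ∷ v) eq = cong (true ∷_) (eqv⇒≡ u v eq)
eqv⇒≡ (false ∷ u) (false ∷ v) eq = cong (false ∷_) (eqv⇒≡ u v eq)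

module _ {N : ℕ} {U : Set} where

  -- Lists are compared by their keys only, while the payload is carried along; the index bijection
  -- of such a permutation therefore preserves the statistic.
  keyed : Setoid _ _
  keyed = On.setoid (setoid (Vec Bool N)) (proj₁ {B = λ _ → U})

  open PermS keyed using (_↭_; ↭-refl; ↭-trans; ↭-sym; ↭-prep; onIndices)

  Key : Set
  Key = Vec Bool N × U

  find-key : ∀ k (ys : List Key) → 0 < countᴸ (eqv k ∘ proj₁) ys →
    ∃₂ λ as bs → ∃ λ y → ys ≡ as List.++ y ∷ bs × k ≡ proj₁ y ×
      (∀ A → countᴸ (eqv A ∘ proj₁) ys ≡ countᴸ (eqv A ∘ proj₁) (y ∷ (as List.++ bs)))
  find-key k (y ∷ ys) lt with eqv k (proj₁ y) in eq
  ... | true = [] , ys , y , refl , eqv⇒≡ _ _ eq , λ A → refl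
  ... | false with find-key k ys lt
  ... | as , bs , z , refl , kz , h = y ∷ as , bs , z , refl , kz , swapped
    where
    swapped : ∀ A → countᴸ (eqv A ∘ proj₁) (y ∷ ys) ≡ countᴸ (eqv A ∘ proj₁) (z ∷ y ∷ (as List.++ bs))
    swapped A with eqv A (proj₁ y) | eqv A (proj₁ z) | h A
    ... | true | true | e = cong suc e
    ... | true | false | e = cong suc e
    ... | false | true | e = e
    ... | false | false | e = e

  countᴸ⇒↭ : ∀ xs ys → (∀ A → countᴸ (eqv A ∘ proj₁) xs ≡ countᴸ (eqv A ∘ proj₁) ys) → xs ↭ ys
  countᴸ⇒↭ [] [] h = ↭-refl
  countᴸ⇒↭ [] (y ∷ ys) h with h (proj₁ y)
  ... | e rewrite eqv-refl (proj₁ y) = contradiction e λ ()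
  countᴸ⇒↭ (x ∷ xs) ys h with find-key (proj₁ x) ys (subst (0 <_) (h (proj₁ x)) pos)
    where
    pos : 0 < countᴸ (eqv (proj₁ x) ∘ proj₁) (x ∷ xs)
    pos rewrite eqv-refl (proj₁ x) = s≤s z≤n
  ... | as , bs , y , refl , kx , h' =
    ↭-trans (↭-prep x (countᴸ⇒↭ xs (as List.++ bs) cancel)) (↭-sym (PermSₚ.shift keyed (sym kx) as bs))
    where
    cancel : ∀ A → countᴸ (eqv A ∘ proj₁) xs ≡ countᴸ (eqv A ∘ proj₁) (as List.++ bs)
    cancel A with trans (h A) (h' A)
    ... | e rewrite kx with eqv A (proj₁ y)
    ... | true = ℕₚ.suc-injective e
    ... | false = e

allVec : ∀ n k → List (Vec (Fin n) k)
allVec n zero = [] ∷ []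
allVec n (suc k) = cartesianProductWith _∷_ (allFin n) (allVec n k)

∈-allVec : ∀ {n k} (v : Vec (Fin n) k) → v ∈ allVec n k
∈-allVec [] = here refl
∈-allVec (x ∷ v) = ∈-cartesianProductWith⁺ _∷_ (∈-allFin x) (∈-allVec v)

allVec-unique : ∀ n k → Unique (allVec n k)
allVec-unique n zero = All.[] ∷ []
allVec-unique n (suc k) = Uniqueₚ.cartesianProductWith⁺ _∷_ Vecₚ.∷-injective (Uniqueₚ.allFin⁺ n)
    (allVec-unique n k)

_≼_ : ∀ {N} → Vec Bool N → Vec Bool N → Set
x ≼ a = ∀ i → Vec.lookup x i ≡ true → Vec.lookup a i ≡ true

leq⇒≼ : ∀ {N} (a x : Vec Bool N) → leq a x ≡ true → x ≼ a
leq⇒≼ (true ∷ a) (true ∷ x) eq zero _ = refl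
leq⇒≼ (true ∷ a) (false ∷ x) eq zero _ = refl
leq⇒≼ (false ∷ a) (false ∷ x) eq zero e = e
leq⇒≼ (true ∷ a) (true ∷ x) eq (suc i) e = leq⇒≼ a x eq i e
leq⇒≼ (true ∷ a) (false ∷ x) eq (suc i) e = leq⇒≼ a x eq i e
leq⇒≼ (false ∷ a) (false ∷ x) eq (suc i) e = leq⇒≼ a x eq i e

≼⇒leq : ∀ {N} (a x : Vec Bool N) → x ≼ a → leq a x ≡ true
≼⇒leq [] [] h = refl
≼⇒leq (true ∷ a) (true ∷ x) h = ≼⇒leq a x (h ∘ suc)
≼⇒leq (true ∷ a) (false ∷ x) h = ≼⇒leq a x (h ∘ suc)
≼⇒leq (false ∷ a) (true ∷ x) h = contradiction (h zero refl) λ ()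
≼⇒leq (false ∷ a) (false ∷ x) h = ≼⇒leq a x (h ∘ suc)

-- For each A, f A and g A only match the elements with statistic below A; neither need respect
-- the statistics themselves.
module Equidistribution {n k N : ℕ}
  {P Q : Vec (Fin n) k → Set} (P? : ∀ u → Dec (P u)) (Q? : ∀ u → Dec (Q u)) (s t : Vec (Fin n) k → Vec Bool N)
  (f g : Vec Bool N → Vec (Fin n) k → Vec (Fin n) k)
  (f-ok : ∀ A u → P u → s u ≼ A → Q (f A u) × t (f A u) ≼ A × g A (f A u) ≡ u)
  (g-ok : ∀ A u → Q u → t u ≼ A → P (g A u) × s (g A u) ≼ A × f A (g A u) ≡ u) where

  private
    U : Set
    U = Vec (Fin n) k

    elems : {R : U → Set} (R? : ∀ u → Dec (R u)) (r : U → Vec Bool N) → List (Vec Bool N × U)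
    elems R? r = map (λ u → r u , u) (filter R? (allVec n k))

    elems-unique : {R : U → Set} (R? : ∀ u → Dec (R u)) (r : U → Vec Bool N) → Unique (elems R? r)
    elems-unique R? r = Uniqueₚ.map⁺ (cong proj₂) (Uniqueₚ.filter⁺ R? (allVec-unique n k))

    ∈-elems : {R : U → Set} (R? : ∀ u → Dec (R u)) (r : U → Vec Bool N) → ∀ {u} → R u → (r u , u) ∈ elems R? r
    ∈-elems R? r p = ∈-map⁺ _ (∈-filter⁺ R? (∈-allVec _) p)

    elems-∈ : {R : U → Set} (R? : ∀ u → Dec (R u)) (r : U → Vec Bool N) → ∀ {z} → z ∈ elems R? r →
      R (proj₂ z) × proj₁ z ≡ r (proj₂ z)
    elems-∈ R? r z∈ with ∈-map⁻ _ z∈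
    ... | u , u∈ , refl = proj₂ (∈-filter⁻ R? {xs = allVec n k} u∈) , refl

    below : (A : Vec Bool N) → List (Vec Bool N × U) → List (Vec Bool N × U)
    below A = filter (λ z → Boolₚ._≟_ (leq A (proj₁ z)) true)

    -- `g A` undoes `f A`, so `f A` is injective on the elements below `A`. The opposite inequality
    -- is the same lemma with the two sides exchanged.
    half : {P Q : U → Set} (P? : ∀ u → Dec (P u)) (Q? : ∀ u → Dec (Q u)) (s t : U → Vec Bool N)
      (f g : Vec Bool N → U → U)
      (f-ok : ∀ A u → P u → s u ≼ A → Q (f A u) × t (f A u) ≼ A × g A (f A u) ≡ u) →
      ∀ A → countᴸ (leq A ∘ proj₁) (elems P? s) ≤ countᴸ (leq A ∘ proj₁) (elems Q? t)
    half P? Q? s t f g f-ok A rewrite countᴸ-filter (leq A ∘ proj₁) (elems P? s) | countᴸ-filter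
        (leq A ∘ proj₁) (elems Q? t) =
      length-≤ (λ z → t (f A (proj₂ z)) , f A (proj₂ z)) (λ z → s (g A (proj₂ z)) , g A (proj₂ z))
        (Uniqueₚ.filter⁺ _ (elems-unique P? s)) ok
      where
      ok : ∀ {z} → z ∈ below A (elems P? s) →
        (t (f A (proj₂ z)) , f A (proj₂ z)) ∈ below A (elems Q? t) ×
        (s (g A (f A (proj₂ z))) , g A (f A (proj₂ z))) ≡ z
      ok {z} z∈ with ∈-filter⁻ _ {xs = elems P? s} z∈
      ... | z∈′ , le with elems-∈ P? s z∈′
      ... | pz , refl with f-ok A (proj₂ z) pz (leq⇒≼ A _ le)
      ... | q , le′ , e = ∈-filter⁺ _ (∈-elems Q? t q) (≼⇒leq A _ le′) , cong (λ u → s u , u) e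

    perm : PermS._↭_ keyed (elems P? s) (elems Q? t)
    perm = countᴸ⇒↭ _ _ λ A → trans (sym (countᴸ-map (eqv A) proj₁ (elems P? s))) (trans
      (möbius (map proj₁ (elems P? s)) (map proj₁ (elems Q? t))
          (λ A → trans (countᴸ-map (leq A) proj₁ (elems P? s)) (trans
          (ℕₚ.≤-antisym (half P? Q? s t f g f-ok A) (half Q? P? t s g f g-ok A))
          (sym (countᴸ-map (leq A) proj₁ (elems Q? t))))) A)
      (countᴸ-map (eqv A) proj₁ (elems Q? t)))

    idx : Fin (length (elems P? s)) ↔ Fin (length (elems Q? t))
    idx = PermS.onIndices perm

    at : {R : U → Set} (R? : ∀ u → Dec (R u)) (r : U → Vec Bool N) → Fin (length (elems R? r)) → Sub R?
    at R? r i = proj₂ (List.lookup (elems R? r) i) , fromWitness (proj₁ (elems-∈ R? r (∈-lookup i)))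

    pos : {R : U → Set} (R? : ∀ u → Dec (R u)) (r : U → Vec Bool N) → Sub R? → Fin (length (elems R? r))
    pos R? r (u , p) = Any.index (∈-elems R? r (toWitness p))

    at-pos : {R : U → Set} (R? : ∀ u → Dec (R u)) (r : U → Vec Bool N) → ∀ x → at R? r (pos R? r x) ≡ x
    at-pos R? r (u , p) = Sub-≡ {P? = R?} (cong proj₂ (sym (lookup-index (∈-elems R? r (toWitness p)))))

    pos-at : {R : U → Set} (R? : ∀ u → Dec (R u)) (r : U → Vec Bool N) → ∀ i → pos R? r (at R? r i) ≡ i
    pos-at R? r i = lookup-unique (elems-unique R? r) _ _ (trans (sym (lookup-index (∈-elems R? r _)))
      (cong (_, proj₂ (List.lookup (elems R? r) i)) (sym (proj₂ (elems-∈ R? r (∈-lookup i))))))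

  bijection : Sub P? ↔ Sub Q?
  bijection = mk↔ₛ′ (at Q? t ∘ Inverse.to idx ∘ pos P? s) (at P? s ∘ Inverse.from idx ∘ pos Q? t)
    (λ y → trans (cong (at Q? t ∘ Inverse.to idx) (pos-at P? s _))
      (trans (cong (at Q? t) (Inverse.strictlyInverseˡ idx _)) (at-pos Q? t y)))
    (λ x → trans (cong (at P? s ∘ Inverse.from idx) (pos-at Q? t _))
      (trans (cong (at P? s) (Inverse.strictlyInverseʳ idx _)) (at-pos P? s x)))

  bijection-stat : ∀ x → t (proj₁ (Inverse.to bijection x)) ≡ s (proj₁ x)
  bijection-stat x = trans (sym (proj₂ (elems-∈ Q? t (∈-lookup (Inverse.to idx (pos P? s x))))))
    (trans (sym (PermSₚ.onIndices-lookup keyed perm (pos P? s x)))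
      (cong proj₁ (sym (lookup-index (∈-elems P? s (toWitness (proj₂ x)))))))

-- Blocks and descents

bit : Bool → ℕ
bit true = 1
bit false = 0

opaque
  -- Blocks of consecutive positions in Fin (2 + m): v marks the breaks, and the
  -- last position is always a block of its own.
  blk : ∀ {m} → Vec Bool m → Fin (suc (suc m)) → ℕ
  blk v zero = 0
  blk [] (suc zero) = 1
  blk (b ∷ v) (suc i) = bit b + blk v i

last : ∀ {m} → Fin (suc (suc m))
last {m} = fromℕ (suc m)

lo hi : ∀ {m} → Fin m → Fin (suc (suc m))
lo i = inject₁ (inject₁ i)
hi i = suc (inject₁ i)

toℕ-lo : ∀ {m} (i : Fin m) → toℕ (lo i) ≡ toℕ i
toℕ-lo i = trans (toℕ-inject₁ _) (toℕ-inject₁ i)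

toℕ-hi : ∀ {m} (i : Fin m) → toℕ (hi i) ≡ suc (toℕ i)
toℕ-hi i = cong suc (toℕ-inject₁ i)

lo<hi : ∀ {m} (i : Fin m) → toℕ (lo i) < toℕ (hi i)
lo<hi i rewrite toℕ-lo i | toℕ-hi i = ℕₚ.n<1+n _

opaque
  unfolding blk

  blk-mono : ∀ {m} (v : Vec Bool m) → Mono (blk v)
  blk-mono v {zero} le = z≤n
  blk-mono [] {suc zero} {suc zero} le = ℕₚ.≤-refl
  blk-mono (b ∷ v) {suc p} {suc q} (s≤s le) = ℕₚ.+-monoʳ-≤ (bit b) (blk-mono v le)

  blk-last : ∀ {m} (v : Vec Bool m) q → q ≢ last → blk v q < blk v last
  blk-last [] zero ne = s≤s z≤n
  blk-last [] (suc zero) ne = contradiction refl ne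
  blk-last (b ∷ v) zero ne = ℕₚ.≤-trans (blk-last v zero λ ()) (ℕₚ.m≤n+m _ (bit b))
  blk-last (b ∷ v) (suc q) ne = ℕₚ.+-monoʳ-< (bit b) (blk-last v q (ne ∘ cong suc))

  blk-bound : ∀ {m} (v : Vec Bool m) q → blk v q < suc (suc m)
  blk-bound v zero = s≤s z≤n
  blk-bound [] (suc zero) = s≤s (s≤s z≤n)
  blk-bound (true ∷ v) (suc i) = s≤s (blk-bound v i)
  blk-bound (false ∷ v) (suc i) = ℕₚ.m≤n⇒m≤1+n (blk-bound v i)

  blk-step : ∀ {m} (v : Vec Bool m) i → lookup v i ≡ false → blk v (lo i) ≡ blk v (hi i)
  blk-step (false ∷ []) zero refl = refl
  blk-step (false ∷ b ∷ v) zero refl = refl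
  blk-step (b ∷ v) (suc i) eq = cong (bit b +_) (blk-step v i eq)

  -- A transitive relation between neighbours spreads over a block. The `m` junctions among the
  -- first `m + 1` positions suffice because `last` shares its block with no other position.
  runs : ∀ {m} (v : Vec Bool m) (R : Fin (suc (suc m)) → Fin (suc (suc m)) → Set) →
    (∀ {x y z} → R x y → R y z → R x z) → (∀ i → lookup v i ≡ false → R (lo i) (hi i)) →
    ∀ x y → toℕ x < toℕ y → blk v x ≡ blk v y → R x y
  runs [] R tr st zero (suc zero) lt ()
  runs [] R tr st (suc zero) (suc zero) (s≤s ()) eq
  runs (false ∷ v) R tr st zero (suc zero) lt eq = st zero refl
  runs (false ∷ v) R tr st zero (suc (suc y)) lt eq = tr (st zero refl)
    (runs v (λ a b → R (suc a) (suc b)) tr (st ∘ suc) zero (suc y) (s≤s z≤n) eq)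
  runs (b ∷ v) R tr st (suc x) (suc y) (s≤s lt) eq =
    runs v (λ a b → R (suc a) (suc b)) tr (st ∘ suc) x y lt (ℕₚ.+-cancelˡ-≡ (bit b) _ _ eq)

-- The value at `last` is not read. For a permutation that fixes `last` this is the descent set of
-- its restriction to the other positions.
D : ∀ {m} → (Fin (suc (suc m)) → Fin (suc (suc m))) → Vec Bool m
D f = tabulate λ i → toℕ (f (hi i)) <ᵇ toℕ (f (lo i))

D-cong : ∀ {m} {f g : Fin (suc (suc m)) → Fin (suc (suc m))} → (∀ x → f x ≡ g x) → D f ≡ D g
D-cong h = Vecₚ.tabulate-cong λ i → cong₂ (λ a b → toℕ a <ᵇ toℕ b) (h (hi i)) (h (lo i))

<ᵇ-true : ∀ {a b} → a < b → (a <ᵇ b) ≡ true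
<ᵇ-true {a} {b} lt with a <ᵇ b | ℕₚ.<⇒<ᵇ lt
... | true | _ = refl

<ᵇ-false : ∀ {a b} → b ≤ a → (a <ᵇ b) ≡ false
<ᵇ-false {a} {b} le with a <ᵇ b in eq
... | false = refl
... | true = contradiction (ℕₚ.<ᵇ⇒< a b (subst T (sym eq) _)) (ℕₚ.≤⇒≯ le)

<ᵇ⇒<′ : ∀ {a b} → (a <ᵇ b) ≡ true → a < b
<ᵇ⇒<′ {a} {b} eq = ℕₚ.<ᵇ⇒< a b (subst T (sym eq) _)

≤∧≢⇒<F : ∀ {n} {a b : Fin n} → toℕ a ≤ toℕ b → a ≢ b → toℕ a < toℕ b
≤∧≢⇒<F le ne = ℕₚ.≤∧≢⇒< le (ne ∘ toℕ-injective)

lo≢hi : ∀ {m} (i : Fin m) → lo i ≢ hi i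
lo≢hi i eq = ℕₚ.<⇒≢ (lo<hi i) (cong toℕ eq)

Increasing : ∀ {m} → Vec Bool m → (Fin (suc (suc m)) → Fin (suc (suc m))) → Set
Increasing v f = ∀ x y → blk v x ≡ blk v y → toℕ x < toℕ y → toℕ (f x) < toℕ (f y)

Decreasing : ∀ {m} → Vec Bool m → (Fin (suc (suc m)) → Fin (suc (suc m))) → Set
Decreasing v f = ∀ x y → blk v x ≡ blk v y → toℕ x < toℕ y → toℕ (f y) < toℕ (f x)

module _ {m} (v : Vec Bool m) {f : Fin (suc (suc m)) → Fin (suc (suc m))} where

  D≼⇒Increasing : Inj f → D f ≼ v → Increasing v f
  D≼⇒Increasing fi h x y eq lt = runs v (λ a b → toℕ (f a) < toℕ (f b)) ℕₚ.<-trans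
    (λ i vi → ≤∧≢⇒<F (ℕₚ.≮⇒≥ λ l → contradiction
        (trans (sym vi) (h i (trans (Vecₚ.lookup∘tabulate _ i) (<ᵇ-true l)))) λ ())
      (lo≢hi i ∘ fi _ _))
    x y lt eq

  Increasing⇒D≼ : Increasing v f → D f ≼ v
  Increasing⇒D≼ h i e with lookup v i in vi
  ... | true = refl
  ... | false = contradiction (h (lo i) (hi i) (blk-step v i vi) (lo<hi i))
    (ℕₚ.<-asym (<ᵇ⇒<′ (trans (sym (Vecₚ.lookup∘tabulate _ i)) e)))

  notD≼⇒Decreasing : Vec.map not (D f) ≼ v → Decreasing v f
  notD≼⇒Decreasing h x y eq lt = runs v (λ a b → toℕ (f b) < toℕ (f a)) (λ p q → ℕₚ.<-trans q p)
    (λ i vi → at-join i vi) x y lt eq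
    where
    at-join : ∀ i → lookup v i ≡ false → toℕ (f (hi i)) < toℕ (f (lo i))
    at-join i vi with toℕ (f (hi i)) <ᵇ toℕ (f (lo i)) in e
    ... | true = <ᵇ⇒<′ e
    ... | false = contradiction (trans (sym vi) (h i (trans (Vecₚ.lookup-map i not (D f))
            (cong not (trans (Vecₚ.lookup∘tabulate _ i) e))))) λ ()

  Decreasing⇒notD≼ : Decreasing v f → Vec.map not (D f) ≼ v
  Decreasing⇒notD≼ h i e with lookup v i in vi
  ... | true = refl
  ... | false = contradiction (trans (sym e) (trans (Vecₚ.lookup-map i not (D f))
      (cong not (trans (Vecₚ.lookup∘tabulate _ i)
          (<ᵇ-true (h (lo i) (hi i) (blk-step v i vi) (lo<hi i))))))) λ ()

-- Rotations

toℕ-rot : ∀ {p} (i : Fin (suc p)) → toℕ i < p → toℕ (rot i) ≡ suc (toℕ i)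
toℕ-rot {suc p} zero lt = refl
toℕ-rot {suc p} (suc i) (s≤s lt) with rot i | toℕ-rot i lt
... | suc j | eq = cong suc eq

rot-last : ∀ {p} (i : Fin (suc p)) → toℕ i ≡ p → toℕ (rot i) ≡ 0
rot-last {zero} zero eq = refl
rot-last {suc p} (suc i) eq with rot i | rot-last i (ℕₚ.suc-injective eq)
... | zero | _ = refl

toℕ-rotPow-≤ : ∀ {p} t (x : Fin (suc p)) → toℕ x + t ≤ p → toℕ (rotPow t x) ≡ toℕ x + t
toℕ-rotPow-≤ zero x le = sym (ℕₚ.+-identityʳ _)
toℕ-rotPow-≤ {p} (suc t) x le = trans (toℕ-rot (rotPow t x) (subst (_< p) (sym rec) le′))
    (trans (cong suc rec) (sym (ℕₚ.+-suc _ t)))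
  where
  le′ : toℕ x + t < p
  le′ = subst (_≤ p) (ℕₚ.+-suc _ t) le
  rec : toℕ (rotPow t x) ≡ toℕ x + t
  rec = toℕ-rotPow-≤ t x (ℕₚ.<⇒≤ le′)

toℕ-rotPow-wrap : ∀ {p} t (x : Fin (suc p)) r → toℕ x + t ≡ suc p + r → r ≤ p → toℕ (rotPow t x) ≡ r
toℕ-rotPow-wrap {p} zero x r eq le = contradiction
  (subst (_< suc p) (trans (sym (ℕₚ.+-identityʳ _)) eq) (toℕ<n x)) (ℕₚ.≤⇒≯ (ℕₚ.m≤m+n (suc p) r))
toℕ-rotPow-wrap {p} (suc t) x zero eq le = rot-last (rotPow t x)
  (trans (toℕ-rotPow-≤ t x (ℕₚ.≤-reflexive eq′)) eq′)
  where
  eq′ : toℕ x + t ≡ p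
  eq′ = ℕₚ.suc-injective (trans (sym (ℕₚ.+-suc _ t)) (trans eq (ℕₚ.+-identityʳ (suc p))))
toℕ-rotPow-wrap {p} (suc t) x (suc r) eq le = trans (toℕ-rot (rotPow t x) (subst (_< p) (sym rec) le))
    (cong suc rec)
  where
  rec : toℕ (rotPow t x) ≡ r
  rec = toℕ-rotPow-wrap t x r (ℕₚ.suc-injective
      (trans (sym (ℕₚ.+-suc _ t)) (trans eq (cong suc (ℕₚ.+-suc p r))))) (ℕₚ.<⇒≤ le)

rotPow-+ : ∀ {p} a b (x : Fin (suc p)) → rotPow (a + b) x ≡ rotPow a (rotPow b x)
rotPow-+ zero b x = refl
rotPow-+ (suc a) b x = cong rot (rotPow-+ a b x)

rotPow-full : ∀ {p} (x : Fin (suc p)) → rotPow (suc p) x ≡ x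
rotPow-full {p} x = toℕ-injective (toℕ-rotPow-wrap (suc p) x (toℕ x) (ℕₚ.+-comm (toℕ x) (suc p))
    (toℕ≤pred[n] x))

-- center k is the rotation taking k to the last element.
center center⁻ : ∀ {p} → Fin (suc p) → Fin (suc p) → Fin (suc p)
center {p} k = rotPow (p ∸ toℕ k)
center⁻ k = rotPow (suc (toℕ k))

module _ {p} (k : Fin (suc p)) where

  center⁻∘center : ∀ x → center⁻ k (center k x) ≡ x
  center⁻∘center x = trans (sym (rotPow-+ (suc (toℕ k)) (p ∸ toℕ k) x))
    (trans (cong (λ t → rotPow (suc t) x) (ℕₚ.m+[n∸m]≡n (toℕ≤pred[n] k))) (rotPow-full x))

  center∘center⁻ : ∀ x → center k (center⁻ k x) ≡ x
  center∘center⁻ x = trans (sym (rotPow-+ (p ∸ toℕ k) (suc (toℕ k)) x))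
    (trans (cong (λ t → rotPow t x) (trans (ℕₚ.+-suc (p ∸ toℕ k) (toℕ k))
        (cong suc (ℕₚ.m∸n+n≡m (toℕ≤pred[n] k))))) (rotPow-full x))

  center-inj : Inj (center k)
  center-inj a b eq = trans (sym (center⁻∘center a)) (trans (cong (center⁻ k) eq) (center⁻∘center b))

  center⁻-inj : Inj (center⁻ k)
  center⁻-inj a b eq = trans (sym (center∘center⁻ a)) (trans (cong (center k) eq) (center∘center⁻ b))

  toℕ-center-≤ : ∀ x → toℕ x ≤ toℕ k → toℕ (center k x) ≡ toℕ x + (p ∸ toℕ k)
  toℕ-center-≤ x le = toℕ-rotPow-≤ (p ∸ toℕ k) x
    (ℕₚ.≤-trans (ℕₚ.+-monoˡ-≤ (p ∸ toℕ k) le) (ℕₚ.≤-reflexive (ℕₚ.m+[n∸m]≡n (toℕ≤pred[n] k))))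

  toℕ-center-> : ∀ x → toℕ k < toℕ x → toℕ (center k x) ≡ toℕ x ∸ suc (toℕ k)
  toℕ-center-> x lt = toℕ-rotPow-wrap (p ∸ toℕ k) x (toℕ x ∸ suc (toℕ k)) eq
      (ℕₚ.≤-trans (ℕₚ.m∸n≤m (toℕ x) (suc (toℕ k))) (toℕ≤pred[n] x))
    where
    eq : toℕ x + (p ∸ toℕ k) ≡ suc p + (toℕ x ∸ suc (toℕ k))
    eq = ℕₚ.+-cancelˡ-≡ (toℕ k) _ _ (trans (ℕₚ.+-comm (toℕ k) _) (trans (ℕₚ.+-assoc (toℕ x) _ _)
      (trans (cong (toℕ x +_) (ℕₚ.m∸n+n≡m (toℕ≤pred[n] k)))
      (trans (cong (_+ p) (sym (ℕₚ.m+[n∸m]≡n lt)))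
      (trans (cong suc (ℕₚ.+-assoc (toℕ k) _ p)) (trans (sym (ℕₚ.+-suc (toℕ k) _))
      (cong (λ z → toℕ k + suc z) (ℕₚ.+-comm _ p))))))))

  center-≤-< : ∀ x y → toℕ y ≤ toℕ k → toℕ x < toℕ y → toℕ (center k x) < toℕ (center k y)
  center-≤-< x y le lt = subst₂ _<_ (sym (toℕ-center-≤ x (ℕₚ.≤-trans (ℕₚ.<⇒≤ lt) le))) (sym (toℕ-center-≤ y le))
    (ℕₚ.+-monoˡ-< _ lt)

  center->-< : ∀ x y → toℕ k < toℕ x → toℕ x < toℕ y → toℕ (center k x) < toℕ (center k y)
  center->-< x y gt lt = subst₂ _<_ (sym (toℕ-center-> x gt)) (sym (toℕ-center-> y (ℕₚ.<-trans gt lt)))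
    (ℕₚ.∸-monoˡ-< lt gt)

  center-wrap : ∀ x y → toℕ k < toℕ x → toℕ y ≤ toℕ k → toℕ (center k x) < toℕ (center k y)
  center-wrap x y gt le = subst₂ _<_ (sym (toℕ-center-> x gt)) (sym (toℕ-center-≤ y le))
    (ℕₚ.<-≤-trans (ℕₚ.∸-monoˡ-< (toℕ<n x) gt) (ℕₚ.m≤n+m _ (toℕ y)))

  center-self : toℕ (center k k) ≡ p
  center-self = trans (toℕ-center-≤ k ℕₚ.≤-refl) (ℕₚ.m+[n∸m]≡n (toℕ≤pred[n] k))

rotPow-comm : ∀ {p} a b (x : Fin (suc p)) → rotPow a (rotPow b x) ≡ rotPow b (rotPow a x)
rotPow-comm a b x = trans (sym (rotPow-+ a b x))
    (trans (cong (λ t → rotPow t x) (ℕₚ.+-comm a b)) (rotPow-+ b a x))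

center-rot : ∀ {p} (k : Fin (suc p)) x → center k (rot x) ≡ rot (center k x)
center-rot {p} k x = rotPow-comm (p ∸ toℕ k) 1 x

center-rot-rot : ∀ {p} (k : Fin (suc p)) x → center (rot k) (rot x) ≡ center k x
center-rot-rot {p} k x with ℕₚ.<-cmp (toℕ k) p
... | tri< lt _ _ rewrite toℕ-rot k lt = trans (rotPow-comm (p ∸ suc (toℕ k)) 1 x)
  (cong (λ t → rotPow t x) (sym (ℕₚ.+-∸-assoc 1 lt)))
... | tri≈ _ eq _ rewrite rot-last k eq | eq | ℕₚ.n∸n≡0 p = trans (rotPow-comm p 1 x) (rotPow-full x)
... | tri> _ _ gt = contradiction (toℕ≤pred[n] k) (ℕₚ.<⇒≱ gt)

-- Rotating `k` to the end carries the old end to `center k last`; bringing that point back to the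
-- end undoes the rotation.
center-center-last : ∀ {m} (k : Fin (suc (suc m))) e → center (center k last) (center k e) ≡ e
center-center-last {m} k e with ℕₚ.<-cmp (toℕ k) (suc m)
... | tri< lt _ _ = trans (cong (λ t → rotPow (suc m ∸ t) (center k e))
        (trans (toℕ-center-> k last (subst (toℕ k <_) (sym (toℕ-fromℕ (suc m))) lt))
            (cong (_∸ suc (toℕ k)) (toℕ-fromℕ (suc m)))))
      (trans (cong (λ t → rotPow t (center k e)) (ℕₚ.m∸[m∸n]≡n lt)) (center⁻∘center k e))
... | tri> _ _ gt = contradiction (toℕ≤pred[n] k) (ℕₚ.<⇒≱ gt)
... | tri≈ _ eq _ = trans (cong (λ t → rotPow (suc m ∸ t) (rotPow (suc m ∸ toℕ k) e))
        (trans (toℕ-center-≤ k last (ℕₚ.≤-reflexive (trans (toℕ-fromℕ (suc m)) (sym eq))))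
          (trans (cong (λ t → toℕ (last {m}) + (suc m ∸ t)) eq)
              (cong₂ _+_ (toℕ-fromℕ (suc m)) (ℕₚ.n∸n≡0 (suc m))))))
      (trans (cong (λ t → rotPow (suc m ∸ t) (rotPow (suc m ∸ toℕ k) e)) (ℕₚ.+-identityʳ (suc m)))
        (trans (cong (λ t → rotPow t (rotPow (suc m ∸ toℕ k) e)) (ℕₚ.n∸n≡0 (suc m)))
          (cong (λ t → rotPow t e) (trans (cong (suc m ∸_) eq) (ℕₚ.n∸n≡0 (suc m))))))

-- Recentring permutations

module Lex (w : ℕ) where

  opaque
    -- A two-digit numeral in base `w`: lexicographic order becomes the order of `ℕ`, which `rank`
    -- expects, as long as the second digit is below `w`.
    lex : ℕ → ℕ → ℕ
    lex a b = a * w + b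

    lex-<ˡ : ∀ {a a' b b'} → b < w → a < a' → lex a b < lex a' b'
    lex-<ˡ {a} {a'} {b} {b'} b<w a<a' = ℕₚ.<-≤-trans (ℕₚ.+-monoʳ-< (a * w) b<w)
      (ℕₚ.≤-trans (ℕₚ.≤-reflexive (ℕₚ.+-comm (a * w) w))
        (ℕₚ.≤-trans (ℕₚ.*-monoˡ-≤ w a<a') (ℕₚ.m≤m+n (a' * w) b')))

    lex-<ʳ : ∀ {a a' b b'} → a ≡ a' → b < b' → lex a b < lex a' b'
    lex-<ʳ {a} refl lt = ℕₚ.+-monoʳ-< (a * w) lt

    lex-elim : ∀ {a a' b b'} → b' < w → lex a b < lex a' b' → a < a' ⊎ (a ≡ a' × b < b')
    lex-elim {a} {a'} {b} {b'} b'<w lt with ℕₚ.<-cmp a a'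
    ... | tri< l _ _ = inj₁ l
    ... | tri≈ _ refl _ = inj₂ (refl , ℕₚ.+-cancelˡ-< (a * w) b b' lt)
    ... | tri> _ _ g = contradiction (lex-<ˡ {b' = b} b'<w g) (ℕₚ.<-asym lt)

    lex-inj : ∀ {a a' b b'} → b < w → b' < w → lex a b ≡ lex a' b' → a ≡ a' × b ≡ b'
    lex-inj {a} {a'} {b} {b'} b<w b'<w eq with ℕₚ.<-cmp a a'
    ... | tri< l _ _ = contradiction eq (ℕₚ.<⇒≢ (lex-<ˡ {b' = b'} b<w l))
    ... | tri≈ _ refl _ = refl , ℕₚ.+-cancelˡ-≡ (a * w) b b' eq
    ... | tri> _ _ g = contradiction (sym eq) (ℕₚ.<⇒≢ (lex-<ˡ {b' = b} b'<w g))

-- A permutation is determined by the horizontal and the vertical order of its points. Here `ρ a` is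
-- the column of the point `a` and `f (ρ a)` its row.
rebuild : ∀ {n} {κ₁ κ₂ : Fin n → ℕ} {ρ f : Fin n → Fin n} → Inj κ₁ → Inj κ₂ → Inj ρ → Inj f →
  (∀ a b → κ₁ a < κ₁ b → toℕ (ρ a) < toℕ (ρ b)) →
  (∀ a b → κ₂ a < κ₂ b → toℕ (f (ρ a)) < toℕ (f (ρ b))) →
  ∀ y → rank κ₂ (inv (rank κ₁) y) ≡ f y
rebuild {κ₁ = κ₁} {κ₂} {ρ} {f} i₁ i₂ ρi fi h₁ h₂ y =
  trans (rank-unique i₂ (Inj-∘ fi ρi) h₂ _)
    (cong f (trans (sym (rank-unique i₁ ρi h₁ _)) (f∘inv (rank-inj κ₁ i₁) y)))

-- Both axes of the permutation matrix are rotated, so that the point in column `l` comes to the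
-- last row and column.
recenter : ∀ {p} → Fin (suc p) → (Fin (suc p) → Fin (suc p)) → Fin (suc p) → Fin (suc p)
recenter l ζ e = center (ζ l) (ζ (center⁻ l e))

recenter-inj : ∀ {p} (l : Fin (suc p)) {ζ : Fin (suc p) → Fin (suc p)} → Inj ζ → Inj (recenter l ζ)
recenter-inj l {ζ} ζi = Inj-∘ (center-inj (ζ l)) (Inj-∘ ζi (center⁻-inj l))

<last : ∀ {m} {x : Fin (suc (suc m))} → x ≢ last → toℕ x < toℕ (last {m})
<last {m} {x} ne = ≤∧≢⇒<F (ℕₚ.≤-trans (toℕ≤pred[n] x) (ℕₚ.≤-reflexive (sym (toℕ-fromℕ (suc m))))) ne

≤last : ∀ {m} (x : Fin (suc (suc m))) → toℕ x ≤ toℕ (last {m})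
≤last {m} x = ℕₚ.≤-trans (toℕ≤pred[n] x) (ℕₚ.≤-reflexive (sym (toℕ-fromℕ (suc m))))

center-self-last : ∀ {m} (k : Fin (suc (suc m))) → center k k ≡ last
center-self-last {m} k = toℕ-injective (trans (center-self k) (sym (toℕ-fromℕ (suc m))))

-- A point carries an arc label a and a block label b.  The keys hx and hy order the points
-- horizontally and vertically in the standard way; kx and ky do so with the blocks rotated, such
-- that the point labelled (a₀ , b₀) becomes the centre.  The label b∞ is that of the last block;
-- side is 0 above the centre, 1 at it, 2 below it and 3 on the last block, and right tells whether
-- a point lies to the right of the centre.
module Keys (m : ℕ) (b∞ : ℕ) where

  -- The base has to exceed both the largest side, 3, and the largest reversed arc label, `N`.
  open Lex (4 + m) public

  N : ℕ
  N = suc (suc m)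

  opaque
    side : ℕ → ℕ → ℕ → ℕ → ℕ
    side a₀ b₀ a b with ℕₚ._≟_ b b∞
    ... | yes _ = 3
    ... | no _ with ℕₚ.<-cmp b b₀
    ...   | tri< _ _ _ = 2
    ...   | tri> _ _ _ = 0
    ...   | tri≈ _ _ _ with ℕₚ.<-cmp a a₀
    ...     | tri< _ _ _ = 2
    ...     | tri≈ _ _ _ = 1
    ...     | tri> _ _ _ = 0

    right : ℕ → ℕ → ℕ → ℕ
    right a₀ a h with ℕₚ.<-cmp a a₀
    ... | tri< _ _ _ = 0
    ... | tri> _ _ _ = 1
    -- In the arc of the centre columns and rows increase together, so a point above the centre lies
    -- to its left.
    right a₀ a zero | tri≈ _ _ _ = 0
    right a₀ a (suc h) | tri≈ _ _ _ = 1

  hx hy : ℕ → ℕ → ℕ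
  hx a b = lex a b
  hy a b = lex b (N ∸ a)

  -- Along an arc the rows increase, hence sides in order and then blocks. In a block the rotated
  -- columns fall as the rows increase; since these columns begin just right of the centre, left
  -- points precede right ones and arcs are reversed on each flank.
  kx ky : ℕ → ℕ → ℕ → ℕ → ℕ
  kx a₀ b₀ a b = lex (lex a (side a₀ b₀ a b)) b
  ky a₀ b₀ a b = lex (lex (lex (side a₀ b₀ a b) b) (right a₀ a (side a₀ b₀ a b))) (N ∸ a)

  -- Rotated rows run through the points below the centre, the last row, the points above the
  -- centre, and the centre itself. With `b₀` the rotated block of the last row, a point above the
  -- centre has a later block, or the same block and a later arc.
  Above Below : ℕ → ℕ → ℕ → ℕ → Set
  Above a₀ b₀ a b = b₀ < b ⊎ (b₀ ≡ b × a₀ < a)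
  Below a₀ b₀ a b = b < b₀ ⊎ (b ≡ b₀ × a < a₀)

  module _ {a₀ b₀ a b : ℕ} where
    opaque
      unfolding side

      side-last : b ≡ b∞ → side a₀ b₀ a b ≡ 3
      side-last eq with ℕₚ._≟_ b b∞
      ... | yes _ = refl
      ... | no ne = contradiction eq ne

      side-above : b ≢ b∞ → Above a₀ b₀ a b → side a₀ b₀ a b ≡ 0
      side-above ne h with ℕₚ._≟_ b b∞
      ... | yes e = contradiction e ne
      ... | no _ with ℕₚ.<-cmp b b₀ | h
      ... | tri> _ _ _ | _ = refl
      ... | tri< l _ _ | inj₁ g = contradiction g (ℕₚ.<-asym l)
      ... | tri< l ¬e _ | inj₂ (e , _) = contradiction (sym e) ¬e
      ... | tri≈ _ e _ | inj₁ g = contradiction (sym e) (ℕₚ.<⇒≢ g)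
      ... | tri≈ _ e _ | inj₂ (_ , g) with ℕₚ.<-cmp a a₀
      ...   | tri< l _ _ = contradiction g (ℕₚ.<-asym l)
      ...   | tri≈ _ e' _ = contradiction (sym e') (ℕₚ.<⇒≢ g)
      ...   | tri> _ _ _ = refl

      side-below : b ≢ b∞ → Below a₀ b₀ a b → side a₀ b₀ a b ≡ 2
      side-below ne h with ℕₚ._≟_ b b∞
      ... | yes e = contradiction e ne
      ... | no _ with ℕₚ.<-cmp b b₀ | h
      ... | tri< _ _ _ | _ = refl
      ... | tri> _ _ g | inj₁ l = contradiction g (ℕₚ.<-asym l)
      ... | tri> _ ¬e _ | inj₂ (e , _) = contradiction e ¬e
      ... | tri≈ _ e _ | inj₁ l = contradiction e (ℕₚ.<⇒≢ l)
      ... | tri≈ _ e _ | inj₂ (_ , l) with ℕₚ.<-cmp a a₀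
      ...   | tri< _ _ _ = refl
      ...   | tri≈ _ e' _ = contradiction e' (ℕₚ.<⇒≢ l)
      ...   | tri> _ _ g = contradiction g (ℕₚ.<-asym l)

      side-centre : b ≢ b∞ → a ≡ a₀ → b ≡ b₀ → side a₀ b₀ a b ≡ 1
      side-centre ne ea eb with ℕₚ._≟_ b b∞
      ... | yes e = contradiction e ne
      ... | no _ with ℕₚ.<-cmp b b₀
      ... | tri< l _ _ = contradiction eb (ℕₚ.<⇒≢ l)
      ... | tri> _ _ g = contradiction (sym eb) (ℕₚ.<⇒≢ g)
      ... | tri≈ _ _ _ with ℕₚ.<-cmp a a₀
      ...   | tri< l _ _ = contradiction ea (ℕₚ.<⇒≢ l)
      ...   | tri≈ _ _ _ = refl
      ...   | tri> _ _ g = contradiction (sym ea) (ℕₚ.<⇒≢ g)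

      side<w : side a₀ b₀ a b < 4 + m
      side<w = ℕₚ.≤-trans side<4 (ℕₚ.m≤m+n 4 m)
        where
        side<4 : side a₀ b₀ a b < 4
        side<4 with ℕₚ._≟_ b b∞
        ... | yes _ = ℕₚ.≤-refl
        ... | no _ with ℕₚ.<-cmp b b₀
        ... | tri< _ _ _ = s≤s (s≤s (s≤s z≤n))
        ... | tri> _ _ _ = s≤s z≤n
        ... | tri≈ _ _ _ with ℕₚ.<-cmp a a₀
        ...   | tri< _ _ _ = s≤s (s≤s (s≤s z≤n))
        ...   | tri≈ _ _ _ = s≤s (s≤s z≤n)
        ...   | tri> _ _ _ = s≤s z≤n

  opaque
    unfolding right

    right-view : ∀ a₀ a h → (right a₀ a h ≡ 0 × (a < a₀ ⊎ (a ≡ a₀ × h ≡ 0))) ⊎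
                            (right a₀ a h ≡ 1 × (a₀ < a ⊎ (a ≡ a₀ × 0 < h)))
    right-view a₀ a h with ℕₚ.<-cmp a a₀
    ... | tri< l _ _ = inj₁ (refl , inj₁ l)
    ... | tri> _ _ g = inj₂ (refl , inj₁ g)
    right-view a₀ a zero | tri≈ _ e _ = inj₁ (refl , inj₂ (e , refl))
    right-view a₀ a (suc h) | tri≈ _ e _ = inj₂ (refl , inj₂ (e , s≤s z≤n))

  right<w : ∀ {a₀ a h} → right a₀ a h < 4 + m
  right<w {a₀} {a} {h} with right-view a₀ a h
  ... | inj₁ (e , _) = subst (_< 4 + m) (sym e) (s≤s z≤n)
  ... | inj₂ (e , _) = subst (_< 4 + m) (sym e) (s≤s (s≤s z≤n))

  label<w : ∀ {a} → a < N → a < 4 + m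
  label<w lt = ℕₚ.≤-trans lt (ℕₚ.m≤n+m N 2)

  neg<w : ∀ a → N ∸ a < 4 + m
  neg<w a = ℕₚ.≤-<-trans (ℕₚ.m∸n≤m N a) (ℕₚ.m≤n+m (suc N) 1)

  neg-< : ∀ {a a'} → a' < N → a < a' → N ∸ a' < N ∸ a
  neg-< {a} {a'} lt l = ℕₚ.∸-monoʳ-< l (ℕₚ.<⇒≤ lt)

  neg-<⁻ : ∀ {a a'} → N ∸ a' < N ∸ a → a < a'
  neg-<⁻ = ℕₚ.∸-cancelʳ-<

  hx-elim : ∀ {a b a' b'} → b' < N → hx a b < hx a' b' → a < a' ⊎ (a ≡ a' × b < b')
  hx-elim lt = lex-elim (label<w lt)

  hy-elim : ∀ {a b a' b'} → hy a b < hy a' b' → b < b' ⊎ (b ≡ b' × a' < a)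
  hy-elim {a} {b} {a'} {b'} lt with lex-elim (neg<w a') lt
  ... | inj₁ l = inj₁ l
  ... | inj₂ (e , l) = inj₂ (e , neg-<⁻ l)

  hx-inj : ∀ {a b a' b'} → b < N → b' < N → hx a b ≡ hx a' b' → a ≡ a' × b ≡ b'
  hx-inj lb lb' = lex-inj (label<w lb) (label<w lb')

  hy-inj : ∀ {a b a' b'} → a < N → a' < N → hy a b ≡ hy a' b' → a ≡ a' × b ≡ b'
  hy-inj {a} {b} {a'} {b'} la la' eq with lex-inj (neg<w a) (neg<w a') eq
  ... | eb , ea = ℕₚ.∸-cancelˡ-≡ (ℕₚ.<⇒≤ la) (ℕₚ.<⇒≤ la') ea , eb

  module _ {a₀ b₀ a b a' b' : ℕ} where

    kx-inj : b < N → b' < N → kx a₀ b₀ a b ≡ kx a₀ b₀ a' b' → a ≡ a' × b ≡ b'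
    kx-inj lb lb' eq with lex-inj (label<w lb) (label<w lb') eq
    ... | e , eb = proj₁ (lex-inj side<w side<w e) , eb

    ky-inj : a < N → a' < N → b < N → b' < N → ky a₀ b₀ a b ≡ ky a₀ b₀ a' b' → a ≡ a' × b ≡ b'
    ky-inj la la' lb lb' eq with lex-inj (neg<w a) (neg<w a') eq
    ... | e , ea with lex-inj right<w right<w e
    ... | e' , _ = ℕₚ.∸-cancelˡ-≡ (ℕₚ.<⇒≤ la) (ℕₚ.<⇒≤ la') ea , proj₂ (lex-inj (label<w lb) (label<w lb') e')

    kx-elim : b' < N → kx a₀ b₀ a b < kx a₀ b₀ a' b' →
      a < a' ⊎ (a ≡ a' × (side a₀ b₀ a b < side a₀ b₀ a' b' ⊎ (side a₀ b₀ a b ≡ side a₀ b₀ a' b' × b < b')))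
    kx-elim lb' lt with lex-elim (label<w lb') lt
    ... | inj₂ (e , l) with lex-inj side<w side<w e
    ...   | ea , es = inj₂ (ea , inj₂ (es , l))
    kx-elim lb' lt | inj₁ l with lex-elim side<w l
    ...   | inj₁ l' = inj₁ l'
    ...   | inj₂ (ea , l') = inj₂ (ea , inj₁ l')

    ky-elim : b < N → b' < N → ky a₀ b₀ a b < ky a₀ b₀ a' b' →
      side a₀ b₀ a b < side a₀ b₀ a' b' ⊎ (side a₀ b₀ a b ≡ side a₀ b₀ a' b' ×
        (b < b' ⊎ (b ≡ b' ×
          (right a₀ a (side a₀ b₀ a b) < right a₀ a' (side a₀ b₀ a' b') ⊎
            (right a₀ a (side a₀ b₀ a b) ≡ right a₀ a' (side a₀ b₀ a' b') × a' < a)))))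
    ky-elim lb lb' lt with lex-elim (neg<w a') lt
    ... | inj₂ (e , l) with lex-inj right<w right<w e
    ...   | e' , er with lex-inj (label<w lb) (label<w lb') e'
    ...     | es , eb = inj₂ (es , inj₂ (eb , inj₂ (er , neg-<⁻ l)))
    ky-elim lb lb' lt | inj₁ l with lex-elim right<w l
    ...   | inj₂ (e , l') with lex-inj (label<w lb) (label<w lb') e
    ...     | es , eb = inj₂ (es , inj₂ (eb , inj₁ l'))
    ky-elim lb lb' lt | inj₁ l | inj₁ l' with lex-elim (label<w lb') l'
    ...     | inj₁ l'' = inj₁ l''
    ...     | inj₂ (es , l'') = inj₂ (es , inj₁ l'')

    ky-side : side a₀ b₀ a b < side a₀ b₀ a' b' → b < N → ky a₀ b₀ a b < ky a₀ b₀ a' b'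
    ky-side l lb = lex-<ˡ (neg<w a) (lex-<ˡ right<w (lex-<ˡ (label<w lb) l))

    ky-block : side a₀ b₀ a b ≡ side a₀ b₀ a' b' → b < b' → ky a₀ b₀ a b < ky a₀ b₀ a' b'
    ky-block e l = lex-<ˡ (neg<w a) (lex-<ˡ right<w (lex-<ʳ e l))

    kx-arc : b < N → a < a' → kx a₀ b₀ a b < kx a₀ b₀ a' b'
    kx-arc lb l = lex-<ˡ (label<w lb) (lex-<ˡ side<w l)

    kx-side : b < N → a ≡ a' → side a₀ b₀ a b < side a₀ b₀ a' b' → kx a₀ b₀ a b < kx a₀ b₀ a' b'
    kx-side lb e l = lex-<ˡ (label<w lb) (lex-<ʳ e l)

swapLast : ∀ {m} → Fin (suc (suc m)) → Fin (suc (suc m)) → Fin (suc (suc m))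
swapLast l x with x ≟F last
... | yes _ = l
... | no _ with x ≟F l
...   | yes _ = last
...   | no _ = x

module _ {m} (l : Fin (suc (suc m))) where

  swapLast-last : ∀ {x} → x ≡ last → swapLast l x ≡ l
  swapLast-last {x} e with x ≟F last
  ... | yes _ = refl
  ... | no ne = contradiction e ne

  swapLast-centre : l ≢ last → ∀ {x} → x ≡ l → swapLast l x ≡ last
  swapLast-centre ne {x} e with x ≟F last
  ... | yes e' = contradiction (trans (sym e) e') ne
  ... | no _ with x ≟F l
  ...   | yes _ = refl
  ...   | no ne' = contradiction e ne'

  swapLast-other : ∀ {x} → x ≢ last → x ≢ l → swapLast l x ≡ x
  swapLast-other {x} n₁ n₂ with x ≟F last
  ... | yes e = contradiction e n₁
  ... | no _ with x ≟F l
  ...   | yes e = contradiction e n₂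
  ...   | no _ = refl

  data Point : Fin (suc (suc m)) → Set where
    origin : Point last
    centre : Point l
    other : ∀ {x} → x ≢ last → x ≢ l → Point x

  point : ∀ x → Point x
  point x with x ≟F last
  ... | yes refl = origin
  ... | no n₁ with x ≟F l
  ...   | yes refl = centre
  ...   | no n₂ = other n₁ n₂

  swapLast-involutive : l ≢ last → ∀ x → swapLast l (swapLast l x) ≡ x
  swapLast-involutive ne x with point x
  ... | origin = trans (cong (swapLast l) (swapLast-last refl)) (swapLast-centre ne refl)
  ... | centre = trans (cong (swapLast l) (swapLast-centre ne refl)) (swapLast-last refl)
  ... | other n₁ n₂ = trans (cong (swapLast l) (swapLast-other n₁ n₂)) (swapLast-other n₁ n₂)

  swapLast-inj : l ≢ last → Inj (swapLast l)
  swapLast-inj ne a b eq = trans (sym (swapLast-involutive ne a))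
    (trans (cong (swapLast l) eq) (swapLast-involutive ne b))

swapLast-natural : ∀ {m} {ρ : Fin (suc (suc m)) → Fin (suc (suc m))} {l l'} → Inj ρ → l ≢ last →
  ρ last ≡ last → ρ l ≡ l' → ∀ x → swapLast l' (ρ x) ≡ ρ (swapLast l x)
swapLast-natural {ρ = ρ} {l} {l'} ρi ne e₁ e₂ x with point l x
... | origin = trans (swapLast-last l' e₁) (trans (sym e₂) (cong ρ (sym (swapLast-last l refl))))
... | centre = trans (swapLast-centre l' ne' e₂) (trans (sym e₁) (cong ρ (sym (swapLast-centre l ne refl))))
  where
  ne' : l' ≢ last
  ne' e = ne (ρi _ _ (trans e₂ (trans e (sym e₁))))
... | other n₁ n₂ = trans (swapLast-other l' (λ e → n₁ (ρi _ _ (trans e (sym e₁))))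
      (λ e → n₂ (ρi _ _ (trans e (sym e₂)))))
  (cong ρ (sym (swapLast-other l n₁ n₂)))

module _ {n} {f : Fin n → Fin n} (fi : Inj f) where

  inj-cmp : ∀ {x y} → x ≢ y → toℕ (f x) < toℕ (f y) ⊎ toℕ (f y) < toℕ (f x)
  inj-cmp {x} {y} ne with ℕₚ.<-cmp (toℕ (f x)) (toℕ (f y))
  ... | tri< l _ _ = inj₁ l
  ... | tri≈ _ e _ = contradiction (fi _ _ (toℕ-injective e)) ne
  ... | tri> _ _ g = inj₂ g

module _ {m} (v : Vec Bool m) where

  blk-reflects-< : ∀ {x y} → blk v x < blk v y → toℕ x < toℕ y
  blk-reflects-< lt = ℕₚ.≰⇒> λ le → ℕₚ.<⇒≱ lt (blk-mono v le)

  blk-≡-last : ∀ {x} → blk v x ≡ blk v last → x ≡ last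
  blk-≡-last {x} eq with x ≟F last
  ... | yes e = e
  ... | no ne = contradiction eq (ℕₚ.<⇒≢ (blk-last v x ne))

-- mirror reverses every block of v.
module Mirror {m} (v : Vec Bool m) where

  open Lex (4 + m)

  mkey : Fin (suc (suc m)) → ℕ
  mkey x = lex (blk v x) (suc (suc m) ∸ toℕ x)

  open Keys m 0 using (neg<w; neg-<; neg-<⁻)

  mkey-inj : Inj mkey
  mkey-inj x y eq = toℕ-injective (ℕₚ.∸-cancelˡ-≡ (ℕₚ.<⇒≤ (toℕ<n x)) (ℕₚ.<⇒≤ (toℕ<n y))
    (proj₂ (lex-inj (neg<w (toℕ x)) (neg<w (toℕ y)) eq)))

  mkey-arc : ∀ {x y} → blk v x < blk v y → mkey x < mkey y
  mkey-arc {x} lt = lex-<ˡ (neg<w (toℕ x)) lt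

  mkey-back : ∀ {x y} → blk v x ≡ blk v y → toℕ y < toℕ x → mkey x < mkey y
  mkey-back {x} {y} e lt = lex-<ʳ e (neg-< (toℕ<n x) lt)

  mkey-elim : ∀ {x y} → mkey x < mkey y → blk v x < blk v y ⊎ (blk v x ≡ blk v y × toℕ y < toℕ x)
  mkey-elim {x} {y} lt with lex-elim (neg<w (toℕ y)) lt
  ... | inj₁ l = inj₁ l
  ... | inj₂ (e , l) = inj₂ (e , neg-<⁻ l)

  mirror : Fin (suc (suc m)) → Fin (suc (suc m))
  mirror = rank mkey

  mirror-inj : Inj mirror
  mirror-inj = rank-inj mkey mkey-inj

  blk-mirror : ∀ x → blk v (mirror x) ≡ blk v x
  blk-mirror = label-preserved {b = blk v} {ρ = mirror} {g = λ x → x} (blk-mono v) mirror-inj (λ _ _ e → e)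
    (λ _ → refl) (λ x y lt → rank-mono mkey x y (mkey-arc lt))

  mirror-involutive : ∀ x → mirror (mirror x) ≡ x
  mirror-involutive = same-order {f = λ x → x} (λ _ _ e → e) (Inj-∘ mirror-inj mirror-inj) mono
    where
    mono : ∀ x y → toℕ x < toℕ y → toℕ (mirror (mirror x)) < toℕ (mirror (mirror y))
    mono x y lt with ℕₚ.m≤n⇒m<n∨m≡n (blk-mono v {x} {y} (ℕₚ.<⇒≤ lt))
    ... | inj₁ l = blk-reflects-< v (subst₂ _<_ (sym (trans (blk-mirror _) (blk-mirror x)))
          (sym (trans (blk-mirror _) (blk-mirror y))) l)
    ... | inj₂ e = rank-mono mkey _ _ (mkey-back (trans (blk-mirror x) (trans e (sym (blk-mirror y))))
                     (rank-mono mkey _ _ (mkey-back (sym e) lt)))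

  mirror-last : ∀ {x} → mirror x ≡ last → x ≡ last
  mirror-last {x} e = blk-≡-last v (trans (sym (blk-mirror x)) (cong (blk v) e))

-- Straightening a matrix whose blocks are read around another centre

module Core {m} (S J : Vec Bool m) (l : Fin (suc (suc m))) (l≢last : l ≢ last) where

  open Keys m (blk J last)
  open Mirror S

  private
    P : Set
    P = Fin (suc (suc m))
    arc : P → ℕ
    arc = blk S
    arc<N : ∀ x → arc x < N
    arc<N = blk-bound S

  row : (P → P) → P → P
  row ζ x = center (ζ l) (ζ x)

  -- The blocks of J are read in the frame centred at l, the arcs of S in the standard frame.
  record Rotated (ζ : P → P) : Set where
    field
      inj : Inj ζ
      fix : ζ last ≡ last
      inc : Increasing S ζ
      dec : ∀ x y → blk J (row ζ x) ≡ blk J (row ζ y) → toℕ (row ζ x) < toℕ (row ζ y) →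
            toℕ (center l y) < toℕ (center l x)

  record Straight (ζ : P → P) : Set where
    field
      inj : Inj ζ
      fix : ζ last ≡ last
      inc : Increasing S ζ
      dec : ∀ x y → blk J (ζ x) ≡ blk J (ζ y) → toℕ (ζ x) < toℕ (ζ y) → toℕ y < toℕ x

  -- The points l and last exchange their block labels when the centre moves.
  rlabel slabel : (P → P) → P → ℕ
  rlabel ζ x = blk J (row ζ (swapLast l x))
  slabel ζ x = blk J (ζ x)

  -- Every point keeps its arc and its exchanged block label, and its column and row are assigned
  -- afresh by sorting. `unstraighten` takes as centre the point in column `mirror l`, where
  -- straightening puts `l`.
  straighten unstraighten : (P → P) → P → P
  straighten ζ y = rank (λ x → hy (arc x) (rlabel ζ x)) (inv (rank (λ x → hx (arc x) (rlabel ζ x))) y)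
  unstraighten ζ y = rank (λ x → ky (arc (mirror l)) (slabel ζ (mirror l)) (arc x) (slabel ζ x))
    (inv (rank (λ x → kx (arc (mirror l)) (slabel ζ (mirror l)) (arc x) (slabel ζ x))) y)

  arc-inc : ∀ {ζ : P → P} → Inj ζ → Increasing S ζ → ∀ {x y} → arc x ≡ arc y → toℕ (ζ x) < toℕ (ζ y) →
      toℕ x < toℕ y
  arc-inc {ζ} ζi inc {x} {y} e lt with ℕₚ.<-cmp (toℕ x) (toℕ y)
  ... | tri< l _ _ = l
  ... | tri≈ _ e' _ = contradiction (cong (toℕ ∘ ζ) (toℕ-injective e')) (ℕₚ.<⇒≢ lt)
  ... | tri> _ _ g = contradiction (inc y x (sym e) g) (ℕₚ.<-asym lt)

  Flank : ℕ → P → Set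
  Flank r p = (r ≡ 0 × toℕ p < toℕ l) ⊎ (r ≡ 1 × toℕ l < toℕ p)

  -- In the frame of `l` the columns right of `l` come before those left of it. Reading the left
  -- flank first, and each flank from right to left, therefore makes the rotated columns fall.
  columns-reversed : ∀ {r r′ p q} → r < r′ ⊎ (r ≡ r′ × toℕ q < toℕ p) → Flank r p → Flank r′ q →
    toℕ (center l q) < toℕ (center l p)
  columns-reversed _ (inj₁ (_ , p<l)) (inj₂ (_ , l<q)) = center-wrap l _ _ l<q (ℕₚ.<⇒≤ p<l)
  columns-reversed (inj₁ c) (inj₁ (e , _)) (inj₁ (e′ , _)) = contradiction (trans e (sym e′)) (ℕₚ.<⇒≢ c)
  columns-reversed (inj₁ c) (inj₂ (e , _)) (inj₁ (e′ , _)) = contradiction (subst₂ _<_ e e′ c) λ ()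
  columns-reversed (inj₁ c) (inj₂ (e , _)) (inj₂ (e′ , _)) = contradiction (trans e (sym e′)) (ℕₚ.<⇒≢ c)
  columns-reversed (inj₂ (_ , c)) (inj₁ (_ , p<l)) (inj₁ _) = center-≤-< l _ _ (ℕₚ.<⇒≤ p<l) c
  columns-reversed (inj₂ (er , _)) (inj₂ (e , _)) (inj₁ (e′ , _)) =
      contradiction (trans (sym e) (trans er e′)) λ ()
  columns-reversed (inj₂ (_ , c)) (inj₂ _) (inj₂ (_ , l<q)) = center->-< l _ _ l<q c

  module FromRotated {ζ : P → P} (v : Rotated ζ) where

    open Rotated v

    B : P → ℕ
    B = rlabel ζ

    B<N : ∀ x → B x < N
    B<N x = blk-bound J _

    row-inj : Inj (row ζ)
    row-inj = Inj-∘ (center-inj (ζ l)) inj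

    B-other : ∀ {x} → x ≢ last → x ≢ l → B x ≡ blk J (row ζ x)
    B-other n₁ n₂ = cong (blk J ∘ row ζ) (swapLast-other l n₁ n₂)

    B-centre : B l ≡ blk J (row ζ last)
    B-centre = cong (blk J ∘ row ζ) (swapLast-centre l l≢last refl)

    row-l : row ζ l ≡ last
    row-l = center-self-last (ζ l)

    B-last : B last ≡ blk J last
    B-last = trans (cong (blk J ∘ row ζ) (swapLast-last l refl)) (cong (blk J) row-l)

    B≢∞ : ∀ {x} → x ≢ last → B x ≢ blk J last
    B≢∞ {x} ne e = ne (swapLast-inj l l≢last _ _ (trans
      (row-inj _ _ (trans (blk-≡-last J e) (sym row-l))) (sym (swapLast-last l refl))))

    sideAt rightAt : P → ℕ
    sideAt x = side (arc l) (B l) (arc x) (B x)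
    rightAt x = right (arc l) (arc x) (sideAt x)

    ζl<last : toℕ (ζ l) < toℕ (ζ last)
    ζl<last = subst (λ z → toℕ (ζ l) < toℕ z) (sym fix) (<last (λ e → l≢last (inj _ _ (trans e (sym fix)))))

    data View (x : P) : Set where
      isLast : x ≡ last → sideAt x ≡ 3 → View x
      isCentre : x ≡ l → sideAt x ≡ 1 → View x
      isAbove : x ≢ last → x ≢ l → toℕ (ζ x) < toℕ (ζ l) → Above (arc l) (B l) (arc x) (B x) →
          sideAt x ≡ 0 → View x
      isBelow : x ≢ last → x ≢ l → toℕ (ζ l) < toℕ (ζ x) → Below (arc l) (B l) (arc x) (B x) →
          sideAt x ≡ 2 → View x

    -- In the rotated rows a point above `l` comes after `last` and a point below `l` before it,
    -- while `B l` is the block of `last` there; so blocks compare weakly as required. On a tie,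
    -- `dec` against `last` decides on which side of `l` the column lies, and `inc` excludes the arc
    -- of `l` itself.
    view : ∀ x → View x
    view x with point l x
    ... | origin = isLast refl (side-last B-last)
    ... | centre = isCentre refl (side-centre (B≢∞ l≢last) refl refl)
    ... | other n₁ n₂ with inj-cmp inj n₂
    ...   | inj₁ lt = isAbove n₁ n₂ lt above (side-above (B≢∞ n₁) above)
      where
      row< : toℕ (row ζ last) < toℕ (row ζ x)
      row< = center-wrap (ζ l) (ζ last) (ζ x) ζl<last (ℕₚ.<⇒≤ lt)
      above : Above (arc l) (B l) (arc x) (B x)
      above with ℕₚ.m≤n⇒m<n∨m≡n (blk-mono J (ℕₚ.<⇒≤ row<))
      ... | inj₁ l' = inj₁ (subst₂ _<_ (sym B-centre) (sym (B-other n₁ n₂)) l')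
      ... | inj₂ e = inj₂ (trans B-centre (trans e (sym (B-other n₁ n₂))) ,
              ℕₚ.≤∧≢⇒< (blk-mono S (ℕₚ.<⇒≤ l<x)) λ ea → ℕₚ.<-asym lt (inc l x ea l<x))
        where
        l<x : toℕ l < toℕ x
        l<x = ℕₚ.≰⇒> λ x≤l → ℕₚ.<-asym (dec last x e row<) (center-wrap l last x (<last l≢last) x≤l)
    ...   | inj₂ gt = isBelow n₁ n₂ gt below (side-below (B≢∞ n₁) below)
      where
      row> : toℕ (row ζ x) < toℕ (row ζ last)
      row> = center->-< (ζ l) (ζ x) (ζ last) gt (subst (λ z → toℕ (ζ x) < toℕ z) (sym fix)
        (<last (λ e → n₁ (inj _ _ (trans e (sym fix))))))
      below : Below (arc l) (B l) (arc x) (B x)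
      below with ℕₚ.m≤n⇒m<n∨m≡n (blk-mono J (ℕₚ.<⇒≤ row>))
      ... | inj₁ l' = inj₁ (subst₂ _<_ (sym (B-other n₁ n₂)) (sym B-centre) l')
      ... | inj₂ e = inj₂ (trans (B-other n₁ n₂) (trans e (sym B-centre)) ,
              ℕₚ.≤∧≢⇒< (blk-mono S (ℕₚ.<⇒≤ x<l)) λ ea → ℕₚ.<-asym gt (inc x l ea x<l))
        where
        x<l : toℕ x < toℕ l
        x<l = ℕₚ.≰⇒> λ l≤x → ℕₚ.<-asym (dec x last e row>)
          (center->-< l x last (≤∧≢⇒<F l≤x (n₂ ∘ sym)) (<last n₁))

    side-mono : ∀ x y → sideAt x < sideAt y → toℕ (ζ x) < toℕ (ζ y)
    side-mono x y lt with view x | view y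
    ... | isLast _ e | isLast _ e' = contradiction (trans e (sym e')) (ℕₚ.<⇒≢ lt)
    ... | isLast _ e | isCentre _ e' = contradiction (subst₂ _<_ e e' lt) λ { (s≤s ()) }
    ... | isLast _ e | isAbove _ _ _ _ e' = contradiction (subst₂ _<_ e e' lt) λ ()
    ... | isLast _ e | isBelow _ _ _ _ e' = contradiction (subst₂ _<_ e e' lt) λ { (s≤s (s≤s ())) }
    ... | isCentre refl _ | isLast refl _ = ζl<last
    ... | isCentre refl e | isCentre refl e' = contradiction refl (ℕₚ.<⇒≢ lt)
    ... | isCentre refl e | isAbove _ _ _ _ e' = contradiction (subst₂ _<_ e e' lt) λ ()
    ... | isCentre refl e | isBelow _ _ gt _ e' = gt
    ... | isAbove _ _ l _ _ | isLast refl _ = ℕₚ.<-trans l ζl<last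
    ... | isAbove _ _ l _ _ | isCentre refl _ = l
    ... | isAbove _ _ _ _ e | isAbove _ _ _ _ e' = contradiction (trans e (sym e')) (ℕₚ.<⇒≢ lt)
    ... | isAbove _ _ l _ _ | isBelow _ _ g _ _ = ℕₚ.<-trans l g
    ... | isBelow n₁ _ _ _ _ | isLast refl _ = subst (λ z → toℕ (ζ x) < toℕ z) (sym fix)
          (<last (λ e → n₁ (inj _ _ (trans e (sym fix)))))
    ... | isBelow _ _ _ _ e | isCentre refl e' = contradiction (subst₂ _<_ e e' lt) λ { (s≤s ()) }
    ... | isBelow _ _ _ _ e | isAbove _ _ _ _ e' = contradiction (subst₂ _<_ e e' lt) λ ()
    ... | isBelow _ _ _ _ e | isBelow _ _ _ _ e' = contradiction (trans e (sym e')) (ℕₚ.<⇒≢ lt)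

    data SameSide (x y : P) : Set where
      equal : x ≡ y → SameSide x y
      same : (x ≢ last × x ≢ l) → (y ≢ last × y ≢ l) →
        (toℕ (ζ x) < toℕ (ζ l) × toℕ (ζ y) < toℕ (ζ l)) ⊎ (toℕ (ζ l) < toℕ (ζ x) × toℕ (ζ l) < toℕ (ζ y)) →
            SameSide x y

    sameSide : ∀ x y → sideAt x ≡ sideAt y → SameSide x y
    sameSide x y eq with view x | view y
    ... | isLast refl _ | isLast refl _ = equal refl
    ... | isCentre refl _ | isCentre refl _ = equal refl
    ... | isAbove n₁ n₂ l _ _ | isAbove n₃ n₄ l' _ _ = same (n₁ , n₂) (n₃ , n₄) (inj₁ (l , l'))
    ... | isBelow n₁ n₂ l _ _ | isBelow n₃ n₄ l' _ _ = same (n₁ , n₂) (n₃ , n₄) (inj₂ (l , l'))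
    ... | isLast _ e | isCentre _ e' = contradiction (trans (sym e) (trans eq e')) λ ()
    ... | isLast _ e | isAbove _ _ _ _ e' = contradiction (trans (sym e) (trans eq e')) λ ()
    ... | isLast _ e | isBelow _ _ _ _ e' = contradiction (trans (sym e) (trans eq e')) λ ()
    ... | isCentre _ e | isLast _ e' = contradiction (trans (sym e) (trans eq e')) λ ()
    ... | isCentre _ e | isAbove _ _ _ _ e' = contradiction (trans (sym e) (trans eq e')) λ ()
    ... | isCentre _ e | isBelow _ _ _ _ e' = contradiction (trans (sym e) (trans eq e')) λ ()
    ... | isAbove _ _ _ _ e | isLast _ e' = contradiction (trans (sym e) (trans eq e')) λ ()
    ... | isAbove _ _ _ _ e | isCentre _ e' = contradiction (trans (sym e) (trans eq e')) λ ()
    ... | isAbove _ _ _ _ e | isBelow _ _ _ _ e' = contradiction (trans (sym e) (trans eq e')) λ ()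
    ... | isBelow _ _ _ _ e | isLast _ e' = contradiction (trans (sym e) (trans eq e')) λ ()
    ... | isBelow _ _ _ _ e | isCentre _ e' = contradiction (trans (sym e) (trans eq e')) λ ()
    ... | isBelow _ _ _ _ e | isAbove _ _ _ _ e' = contradiction (trans (sym e) (trans eq e')) λ ()

    private
      Sides : P → P → Set
      Sides x y = (toℕ (ζ x) < toℕ (ζ l) × toℕ (ζ y) < toℕ (ζ l)) ⊎
          (toℕ (ζ l) < toℕ (ζ x) × toℕ (ζ l) < toℕ (ζ y))

      ζ<⇒row< : ∀ {x y} → Sides x y → toℕ (ζ x) < toℕ (ζ y) → toℕ (row ζ x) < toℕ (row ζ y)
      ζ<⇒row< (inj₁ (a , b)) lt = center-≤-< (ζ l) _ _ (ℕₚ.<⇒≤ b) lt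
      ζ<⇒row< (inj₂ (a , b)) lt = center->-< (ζ l) _ _ a lt

      Sides-sym : ∀ {x y} → Sides x y → Sides y x
      Sides-sym (inj₁ (a , b)) = inj₁ (b , a)
      Sides-sym (inj₂ (a , b)) = inj₂ (b , a)

      row<⇒ζ< : ∀ {x y} → Sides x y → toℕ (row ζ x) < toℕ (row ζ y) → toℕ (ζ x) < toℕ (ζ y)
      row<⇒ζ< {x} {y} s lt with ℕₚ.<-cmp (toℕ (ζ x)) (toℕ (ζ y))
      ... | tri< l' _ _ = l'
      ... | tri≈ _ e _ = contradiction (cong (λ z → toℕ (center (ζ l) z)) (toℕ-injective e)) (ℕₚ.<⇒≢ lt)
      ... | tri> _ _ g = contradiction (ζ<⇒row< (Sides-sym s) g) (ℕₚ.<-asym lt)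

      col<⇒row> : ∀ {x y} → blk J (row ζ x) ≡ blk J (row ζ y) → toℕ (center l y) < toℕ (center l x) →
        toℕ (row ζ x) < toℕ (row ζ y)
      col<⇒row> {x} {y} e lt with ℕₚ.<-cmp (toℕ (row ζ x)) (toℕ (row ζ y))
      ... | tri< l' _ _ = l'
      ... | tri≈ _ e' _ = contradiction (cong (toℕ ∘ center l) (row-inj _ _ (toℕ-injective (sym e'))))
            (ℕₚ.<⇒≢ lt)
      ... | tri> _ _ g = contradiction (dec y x (sym e) g) (ℕₚ.<-asym lt)

    block-mono : ∀ x y → sideAt x ≡ sideAt y → B x < B y → toℕ (ζ x) < toℕ (ζ y)
    block-mono x y es lt with sameSide x y es
    ... | equal e = contradiction (cong B e) (ℕₚ.<⇒≢ lt)
    ... | same (n₁ , n₂) (n₃ , n₄) s = row<⇒ζ< s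
      (blk-reflects-< J (subst₂ _<_ (B-other n₁ n₂) (B-other n₃ n₄) lt))

    kx-sorted : ∀ x y → kx (arc l) (B l) (arc x) (B x) < kx (arc l) (B l) (arc y) (B y) → toℕ x < toℕ y
    kx-sorted x y lt with kx-elim (B<N y) lt
    ... | inj₁ l' = blk-reflects-< S l'
    ... | inj₂ (e , inj₁ l') = arc-inc inj inc e (side-mono x y l')
    ... | inj₂ (e , inj₂ (es , l')) = arc-inc inj inc e (block-mono x y es l')

    right-spec : ∀ x → x ≢ last → x ≢ l → Flank (rightAt x) x
    right-spec x n₁ n₂ with right-view (arc l) (arc x) (sideAt x)
    ... | inj₁ (e , inj₁ lt) = inj₁ (e , blk-reflects-< S lt)
    ... | inj₂ (e , inj₁ gt) = inj₂ (e , blk-reflects-< S gt)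
    ... | inj₁ (e , inj₂ (ea , es)) = inj₁ (e , arc-inc inj inc ea (side-mono x l
            (subst₂ _<_ (sym es) (sym (side-centre (B≢∞ l≢last) refl refl)) (s≤s z≤n))))
    ... | inj₂ (e , inj₂ (ea , es)) with view x
    ...   | isLast ex _ = contradiction ex n₁
    ...   | isCentre ex _ = contradiction ex n₂
    ...   | isAbove _ _ _ _ e0 = contradiction (sym e0) (ℕₚ.<⇒≢ es)
    ...   | isBelow _ _ gt _ _ = inj₂ (e , arc-inc inj inc (sym ea) gt)

    ky-sorted : ∀ x y → ky (arc l) (B l) (arc x) (B x) < ky (arc l) (B l) (arc y) (B y) → toℕ (ζ x) < toℕ (ζ y)
    ky-sorted x y lt with ky-elim (B<N x) (B<N y) lt
    ... | inj₁ l' = side-mono x y l'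
    ... | inj₂ (es , inj₁ l') = block-mono x y es l'
    ... | inj₂ (es , inj₂ (eb , r)) with sameSide x y es
    ...   | equal refl = ⊥-elim (absurd r)
      where
      absurd : (rightAt x < rightAt x) ⊎ (rightAt x ≡ rightAt x × arc x < arc x) → ⊥
      absurd (inj₁ q) = ℕₚ.<-irrefl refl q
      absurd (inj₂ (_ , q)) = ℕₚ.<-irrefl refl q
    ...   | same (n₁ , n₂) (n₃ , n₄) s =
      row<⇒ζ< s (col<⇒row> (trans (sym (B-other n₁ n₂)) (trans eb (B-other n₃ n₄)))
        (columns-reversed (Sum.map₂ (λ (e , a) → e , blk-reflects-< S a) r) (right-spec x n₁ n₂)
            (right-spec y n₃ n₄)))

    -- Arcs rise and blocks fall, so two points with a common arc and block can only be separated by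
    -- the column cut: `l` lies strictly between them in the same arc. By `inc` it then lies between
    -- them vertically too, so they are not on one side of it.
    crossing : ∀ x y → x ≢ l → Sides x y → arc x ≡ arc y → blk J (row ζ x) ≡ blk J (row ζ y) → toℕ x < toℕ y → ⊥
    crossing x y n₂ s ea eb lt with dec x y eb (ζ<⇒row< s (inc x y ea lt)) | toℕ y ≤? toℕ l | toℕ l <? toℕ x
    ... | d | yes y≤l | _ = ℕₚ.<-asym d (center-≤-< l x y y≤l lt)
    ... | d | no _ | yes l<x = ℕₚ.<-asym d (center->-< l x y l<x lt)
    ... | d | no y≰l | no l≮x = opposite s
      where
      x<l : toℕ x < toℕ l
      x<l = ≤∧≢⇒<F (ℕₚ.≮⇒≥ l≮x) n₂
      l<y : toℕ l < toℕ y
      l<y = ℕₚ.≰⇒> y≰l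
      el : arc x ≡ arc l
      el = ℕₚ.≤-antisym (blk-mono S (ℕₚ.<⇒≤ x<l))
          (ℕₚ.≤-trans (blk-mono S (ℕₚ.<⇒≤ l<y)) (ℕₚ.≤-reflexive (sym ea)))
      opposite : Sides x y → ⊥
      opposite (inj₁ (_ , y<)) = ℕₚ.<-asym y< (inc l y (trans (sym el) ea) l<y)
      opposite (inj₂ (x> , _)) = ℕₚ.<-asym x> (inc x l el x<l)

    label-inj : ∀ x y → arc x ≡ arc y → B x ≡ B y → x ≡ y
    -- The side is a function of the labels, so equal labels already force a common side.
    label-inj x y ea eb with sameSide x y (cong₂ (side (arc l) (B l)) ea eb)
    ... | equal e = e
    ... | same (n₁ , n₂) (n₃ , n₄) s with ℕₚ.<-cmp (toℕ x) (toℕ y)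
    ...   | tri≈ _ e _ = toℕ-injective e
    ...   | tri< lt _ _ = ⊥-elim (crossing x y n₂ s ea
          (trans (sym (B-other n₁ n₂)) (trans eb (B-other n₃ n₄))) lt)
    ...   | tri> _ _ gt = ⊥-elim (crossing y x n₄ (Sides-sym s) (sym ea)
          (trans (sym (B-other n₃ n₄)) (trans (sym eb) (B-other n₁ n₂))) gt)

    private
      X Y : P → ℕ
      X x = hx (arc x) (B x)
      Y x = hy (arc x) (B x)

      X-inj : Inj X
      X-inj x y e with hx-inj (B<N x) (B<N y) e
      ... | ea , eb = label-inj x y ea eb

      Y-inj : Inj Y
      Y-inj x y e with hy-inj (arc<N x) (arc<N y) e
      ... | ea , eb = label-inj x y ea eb

      r₁ r₂ : P → P
      r₁ = rank X
      r₂ = rank Y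

      r₁-inj : Inj r₁
      r₁-inj = rank-inj X X-inj

      r₂-inj : Inj r₂
      r₂-inj = rank-inj Y Y-inj

      arc-r₁ : ∀ x → arc (r₁ x) ≡ arc x
      arc-r₁ = label-preserved {b = arc} {ρ = r₁} {g = λ x → x} (blk-mono S) r₁-inj (λ _ _ e → e) (λ _ → refl)
        (λ x y lt → rank-mono X x y (lex-<ˡ (label<w (B<N x)) lt))

      blk-r₂ : ∀ x → blk J (r₂ x) ≡ B x
      blk-r₂ = label-preserved {b = blk J} {ρ = r₂} {g = row ζ ∘ swapLast l} (blk-mono J) r₂-inj
        (Inj-∘ row-inj (swapLast-inj l l≢last)) (λ _ → refl)
        (λ x y lt → rank-mono Y x y (lex-<ˡ (neg<w (arc x)) lt))

      r₁-last : r₁ last ≡ last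
      r₁-last = blk-≡-last S (arc-r₁ last)

      r₂-last : r₂ last ≡ last
      r₂-last = blk-≡-last J (trans (blk-r₂ last) B-last)

      arc-l≢last : arc last ≢ arc l
      arc-l≢last e = l≢last (blk-≡-last S (sym e))

    -- In the arc of `l` the points to its left lie above it and carry later blocks, those to its
    -- right earlier ones. The standard reading sorts an arc by block and so exchanges the two
    -- groups, which reflects `l` in its arc.
    mirror-l : mirror l ≡ r₁ l
    mirror-l = rank-≡ l to from
      where
      to : ∀ y → mkey y < mkey l → X y < X l
      to y lt with mkey-elim lt
      ... | inj₁ l' = lex-<ˡ (label<w (B<N y)) l'
      ... | inj₂ (e , l<y) with view y
      ...   | isLast refl _ = contradiction e arc-l≢last
      ...   | isCentre refl _ = contradiction l<y (ℕₚ.<-irrefl refl)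
      ...   | isAbove _ _ yl _ _ = contradiction (inc l y (sym e) l<y) (ℕₚ.<-asym yl)
      ...   | isBelow _ _ _ (inj₁ b) _ = lex-<ʳ e b
      ...   | isBelow _ _ _ (inj₂ (_ , a)) _ = contradiction e (ℕₚ.<⇒≢ a)
      from : ∀ y → X y < X l → mkey y < mkey l
      from y lt with hx-elim (B<N l) lt
      ... | inj₁ l' = mkey-arc l'
      ... | inj₂ (e , b) with view y
      ...   | isLast refl _ = contradiction e arc-l≢last
      ...   | isCentre refl _ = contradiction b (ℕₚ.<-irrefl refl)
      ...   | isAbove _ _ _ (inj₁ b') _ = contradiction b (ℕₚ.<-asym b')
      ...   | isAbove _ _ _ (inj₂ (b' , _)) _ = contradiction (sym b') (ℕₚ.<⇒≢ b)
      ...   | isBelow _ _ gt _ _ = mkey-back e (arc-inc inj inc (sym e) gt)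

    module Straightened {η : P → P} (h : ∀ y → η y ≡ straighten ζ y) where

      private
        η-r₁ : ∀ x → η (r₁ x) ≡ r₂ x
        η-r₁ x = trans (h (r₁ x)) (cong r₂ (inv∘f r₁-inj x))

        on-r₁ : (Q : P → Set) → (∀ x → Q (r₁ x)) → ∀ y → Q y
        on-r₁ Q q y = subst Q (f∘inv r₁-inj y) (q (inv r₁ y))

        η-inj : Inj η
        η-inj a b e = inv-inj r₁-inj a b (r₂-inj _ _ (trans (sym (h a)) (trans e (h b))))

      straight : Straight η
      straight = record
        { inj = η-inj
        ; fix = trans (cong η (sym r₁-last)) (trans (η-r₁ last) r₂-last)
        ; inc = on-r₁ _ λ x → on-r₁ _ λ y e lt → subst₂ (λ a b → toℕ a < toℕ b) (sym (η-r₁ x)) (sym (η-r₁ y))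
                  (inc′ x y (trans (sym (arc-r₁ x)) (trans e (arc-r₁ y))) (rank-reflects X x y lt))
        ; dec = on-r₁ _ λ x → on-r₁ _ λ y e lt →
                  dec′ x y (trans (sym (blk-r₂ x))
                      (trans (cong (blk J) (sym (η-r₁ x)))
                      (trans e (trans (cong (blk J) (η-r₁ y)) (blk-r₂ y)))))
                    (rank-reflects Y x y (subst₂ (λ a b → toℕ a < toℕ b) (η-r₁ x) (η-r₁ y) lt))
        }
        where
        inc′ : ∀ x y → arc x ≡ arc y → X x < X y → toℕ (r₂ x) < toℕ (r₂ y)
        inc′ x y e lt with hx-elim (B<N y) lt
        ... | inj₁ a = contradiction e (ℕₚ.<⇒≢ a)
        ... | inj₂ (_ , b) = rank-mono Y x y (lex-<ˡ (neg<w (arc x)) b)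
        dec′ : ∀ x y → B x ≡ B y → Y x < Y y → toℕ (r₁ y) < toℕ (r₁ x)
        dec′ x y e lt with hy-elim lt
        ... | inj₁ b = contradiction e (ℕₚ.<⇒≢ b)
        ... | inj₂ (_ , a) = rank-mono X y x (lex-<ˡ (label<w (B<N y)) a)

      private
        arc-inv : ∀ a → arc a ≡ arc (inv r₁ a)
        arc-inv a = trans (cong arc (sym (f∘inv r₁-inj a))) (arc-r₁ (inv r₁ a))

        label-inv : ∀ a → slabel η a ≡ B (inv r₁ a)
        label-inv a = trans (cong (blk J) (h a)) (blk-r₂ (inv r₁ a))

        label-inj′ : ∀ a b → arc a ≡ arc b → slabel η a ≡ slabel η b → a ≡ b
        label-inj′ a b ea eb = inv-inj r₁-inj a b (label-inj _ _
          (trans (sym (arc-inv a)) (trans ea (arc-inv b))) (trans (sym (label-inv a)) (trans eb (label-inv b))))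

        centre-label : slabel η (mirror l) ≡ B l
        centre-label = trans (label-inv (mirror l)) (cong B (trans (cong (inv r₁) mirror-l) (inv∘f r₁-inj l)))

        key : (k : ℕ → ℕ → ℕ → ℕ → ℕ) → ∀ a →
          k (arc (mirror l)) (slabel η (mirror l)) (arc a) (slabel η a) ≡ k (arc l) (B l) (arc (inv r₁ a))
              (B (inv r₁ a))
        key k a = trans (cong₂ (λ p q → k p q (arc a) (slabel η a)) (blk-mirror l) centre-label)
          (cong₂ (k (arc l) (B l)) (arc-inv a) (label-inv a))

      unstraighten∘straighten : ∀ y → unstraighten η y ≡ ζ y
      -- `inv r₁` sends a column of `η` to the column of the same point in `ζ`.
      unstraighten∘straighten = rebuild {ρ = inv r₁} {f = ζ}
        (λ a b e → let ea , eb = kx-inj (blk-bound J _) (blk-bound J _) e in label-inj′ a b ea eb)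
        (λ a b e → let ea , eb = ky-inj (arc<N a) (arc<N b) (blk-bound J _) (blk-bound J _) e in label-inj′ a b ea eb)
        (inv-inj r₁-inj) inj
        (λ a b lt → kx-sorted _ _ (subst₂ _<_ (key kx a) (key kx b) lt))
        (λ a b lt → ky-sorted _ _ (subst₂ _<_ (key ky a) (key ky b) lt))

  module FromStraight {ζ : P → P} (v : Straight ζ) where

    open Straight v

    C : P → ℕ
    C = slabel ζ

    C<N : ∀ x → C x < N
    C<N x = blk-bound J _

    x₀ : P
    x₀ = mirror l

    x₀≢last : x₀ ≢ last
    x₀≢last e = l≢last (mirror-last e)

    C-last : C last ≡ blk J last
    C-last = cong (blk J) fix

    C≢∞ : ∀ {x} → x ≢ last → C x ≢ blk J last
    C≢∞ ne e = ne (inj _ _ (trans (blk-≡-last J e) (sym fix)))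

    label-inj : ∀ x y → arc x ≡ arc y → C x ≡ C y → x ≡ y
    label-inj x y ea ec with ℕₚ.<-cmp (toℕ x) (toℕ y)
    ... | tri≈ _ e _ = toℕ-injective e
    ... | tri< lt _ _ = contradiction (dec x y ec (inc x y ea lt)) (ℕₚ.<-asym lt)
    ... | tri> _ _ gt = contradiction (dec y x (sym ec) (inc y x (sym ea) gt)) (ℕₚ.<-asym gt)

    hx-sorted : ∀ x y → hx (arc x) (C x) < hx (arc y) (C y) → toℕ x < toℕ y
    hx-sorted x y lt with hx-elim (C<N y) lt
    ... | inj₁ a = blk-reflects-< S a
    ... | inj₂ (e , c) = arc-inc inj inc e (blk-reflects-< J c)

    hy-sorted : ∀ x y → hy (arc x) (C x) < hy (arc y) (C y) → toℕ (ζ x) < toℕ (ζ y)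
    hy-sorted x y lt with hy-elim lt
    ... | inj₁ c = blk-reflects-< J c
    ... | inj₂ (e , a) with ℕₚ.<-cmp (toℕ (ζ x)) (toℕ (ζ y))
    ...   | tri< l' _ _ = l'
    ...   | tri≈ _ e' _ = contradiction (cong arc (inj _ _ (toℕ-injective (sym e')))) (ℕₚ.<⇒≢ a)
    ...   | tri> _ _ g = contradiction (blk-reflects-< S a) (ℕₚ.<-asym (dec y x (sym e) g))

    sideAt rightAt X Y : P → ℕ
    sideAt x = side (arc x₀) (C x₀) (arc x) (C x)
    rightAt x = right (arc x₀) (arc x) (sideAt x)
    X x = kx (arc x₀) (C x₀) (arc x) (C x)
    Y x = ky (arc x₀) (C x₀) (arc x) (C x)

    private
      X-inj : Inj X
      X-inj x y e with kx-inj (C<N x) (C<N y) e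
      ... | ea , eb = label-inj x y ea eb

      Y-inj : Inj Y
      Y-inj x y e with ky-inj (arc<N x) (arc<N y) (C<N x) (C<N y) e
      ... | ea , eb = label-inj x y ea eb

      rX rY : P → P
      rX = rank X
      rY = rank Y

      rX-inj : Inj rX
      rX-inj = rank-inj X X-inj

      rY-inj : Inj rY
      rY-inj = rank-inj Y Y-inj

      arc-rX : ∀ x → arc (rX x) ≡ arc x
      arc-rX = label-preserved {b = arc} {ρ = rX} {g = λ x → x} (blk-mono S) rX-inj (λ _ _ e → e) (λ _ → refl)
        (λ x y lt → rank-mono X x y (kx-arc (C<N x) lt))

      rX-last : rX last ≡ last
      rX-last = blk-≡-last S (arc-rX last)

    data View (x : P) : Set where
      isLast : x ≡ last → sideAt x ≡ 3 → View x
      isCentre : x ≡ x₀ → sideAt x ≡ 1 → View x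
      isAbove : x ≢ last → x ≢ x₀ → Above (arc x₀) (C x₀) (arc x) (C x) → sideAt x ≡ 0 → View x
      isBelow : x ≢ last → x ≢ x₀ → Below (arc x₀) (C x₀) (arc x) (C x) → sideAt x ≡ 2 → View x

    side-x₀ : sideAt x₀ ≡ 1
    side-x₀ = side-centre (C≢∞ x₀≢last) refl refl

    side-O : sideAt last ≡ 3
    side-O = side-last C-last

    view : ∀ x → View x
    view x with point x₀ x
    ... | origin = isLast refl side-O
    ... | centre = isCentre refl side-x₀
    ... | other n₁ n₂ with ℕₚ.<-cmp (C x) (C x₀)
    ...   | tri< l' _ _ = isBelow n₁ n₂ (inj₁ l') (side-below (C≢∞ n₁) (inj₁ l'))
    ...   | tri> _ _ g = isAbove n₁ n₂ (inj₁ g) (side-above (C≢∞ n₁) (inj₁ g))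
    ...   | tri≈ _ e _ with ℕₚ.<-cmp (arc x) (arc x₀)
    ...     | tri< l' _ _ = isBelow n₁ n₂ (inj₂ (e , l')) (side-below (C≢∞ n₁) (inj₂ (e , l')))
    ...     | tri> _ _ g = isAbove n₁ n₂ (inj₂ (sym e , g)) (side-above (C≢∞ n₁) (inj₂ (sym e , g)))
    ...     | tri≈ _ e' _ = contradiction (label-inj x x₀ e' e) n₂

    private
      Y-side : ∀ {x y i j} → sideAt x ≡ i → sideAt y ≡ j → i < j → toℕ (rY x) < toℕ (rY y)
      Y-side {x} {y} e e' lt = rank-mono Y x y (ky-side (subst₂ _<_ (sym e) (sym e') lt) (C<N x))

      X-side : ∀ {x y i j} → arc x ≡ arc y → sideAt x ≡ i → sideAt y ≡ j → i < j → toℕ (rX x) < toℕ (rX y)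
      X-side {x} {y} ea e e' lt = rank-mono X x y (kx-side (C<N x) ea (subst₂ _<_ (sym e) (sym e') lt))

      rY-≤last : ∀ x → x ≢ last → toℕ (rY x) < toℕ (rY last)
      rY-≤last x ne with view x
      ... | isLast e _ = contradiction e ne
      ... | isCentre _ e = Y-side e side-O (s≤s (s≤s z≤n))
      ... | isAbove _ _ _ e = Y-side e side-O (s≤s z≤n)
      ... | isBelow _ _ _ e = Y-side e side-O (s≤s (s≤s (s≤s z≤n)))

      rY-last : rY last ≡ last
      rY-last with inv rY last ≟F last
      ... | yes e = trans (cong rY (sym e)) (f∘inv rY-inj last)
      ... | no ne = contradiction (≤last (rY last))
        (ℕₚ.<⇒≱ (subst (λ z → toℕ z < toℕ (rY last)) (f∘inv rY-inj last) (rY-≤last _ ne)))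

      arc-x₀≢last : arc last ≢ arc x₀
      arc-x₀≢last e = x₀≢last (blk-≡-last S (sym e))

    -- In the arc of `x₀` the points to its right carry later blocks, hence count as above and are
    -- now read first. This reflects `x₀` in its arc, and `mirror` is an involution.
    rX-x₀ : rX x₀ ≡ l
    rX-x₀ = trans (rank-≡ x₀ to from) (mirror-involutive l)
      where
      to : ∀ y → X y < X x₀ → mkey y < mkey x₀
      to y lt with kx-elim (C<N x₀) lt
      ... | inj₁ a = mkey-arc a
      ... | inj₂ (ea , q) with view y
      ...   | isLast refl _ = contradiction ea arc-x₀≢last
      ...   | isCentre refl _ = contradiction lt (ℕₚ.<-irrefl refl)
      ...   | isAbove _ _ (inj₁ c) _ = mkey-back ea (arc-inc inj inc (sym ea) (blk-reflects-< J c))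
      ...   | isAbove _ _ (inj₂ (_ , a)) _ = contradiction (sym ea) (ℕₚ.<⇒≢ a)
      to y lt | inj₂ (ea , inj₁ s) | isBelow _ _ _ e = contradiction (subst₂ _<_ e side-x₀ s) λ { (s≤s ()) }
      to y lt | inj₂ (ea , inj₂ (s , _)) | isBelow _ _ _ e =
          contradiction (trans (sym e) (trans s side-x₀)) λ ()
      from : ∀ y → mkey y < mkey x₀ → X y < X x₀
      from y lt with mkey-elim lt
      ... | inj₁ a = kx-arc (C<N y) a
      ... | inj₂ (ea , x₀<y) with view y
      ...   | isLast refl _ = contradiction ea arc-x₀≢last
      ...   | isCentre refl _ = contradiction lt (ℕₚ.<-irrefl refl)
      ...   | isAbove _ _ _ e = kx-side (C<N y) ea (subst₂ _<_ (sym e) (sym side-x₀) (s≤s z≤n))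
      ...   | isBelow _ _ (inj₁ c) _ = contradiction x₀<y (ℕₚ.<-asym (arc-inc inj inc ea (blk-reflects-< J c)))
      ...   | isBelow _ _ (inj₂ (_ , a)) _ = contradiction ea (ℕₚ.<⇒≢ a)

    private
      rw : P → P
      rw x = center (rY x₀) (rY x)

      rw-inj : Inj rw
      rw-inj = Inj-∘ (center-inj (rY x₀)) rY-inj

      rw-x₀ : rw x₀ ≡ last
      rw-x₀ = center-self-last (rY x₀)

      -- Block labels in the rotated frame: `x₀` takes over the last block and `last` that of `x₀`,
      -- which reverses the exchange in `rlabel`.
      L : P → ℕ
      L x = C (swapLast x₀ x)

      L-last : L last ≡ C x₀
      L-last = cong C (swapLast-last x₀ refl)

      L-x₀ : L x₀ ≡ blk J last
      L-x₀ = trans (cong C (swapLast-centre x₀ x₀≢last refl)) C-last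

      L-other : ∀ {x} → x ≢ last → x ≢ x₀ → L x ≡ C x
      L-other n₁ n₂ = cong C (swapLast-other x₀ n₁ n₂)

      above-C : ∀ {x} → Above (arc x₀) (C x₀) (arc x) (C x) → C x₀ ≤ C x
      above-C (inj₁ c) = ℕₚ.<⇒≤ c
      above-C (inj₂ (e , _)) = ℕₚ.≤-reflexive e

      below-C : ∀ {x} → Below (arc x₀) (C x₀) (arc x) (C x) → C x ≤ C x₀
      below-C (inj₁ c) = ℕₚ.<⇒≤ c
      below-C (inj₂ (e , _)) = ℕₚ.≤-reflexive e

      above-arc : ∀ {x} → Above (arc x₀) (C x₀) (arc x) (C x) → C x₀ ≡ C x → arc x₀ < arc x
      above-arc (inj₁ c) e = contradiction e (ℕₚ.<⇒≢ c)
      above-arc (inj₂ (_ , a)) e = a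

      below-arc : ∀ {x} → Below (arc x₀) (C x₀) (arc x) (C x) → C x ≡ C x₀ → arc x < arc x₀
      below-arc (inj₁ c) e = contradiction e (ℕₚ.<⇒≢ c)
      below-arc (inj₂ (_ , a)) e = a

      rY-x₀<last : toℕ (rY x₀) < toℕ (rY last)
      rY-x₀<last = rY-≤last x₀ x₀≢last

      last<above : ∀ {x} → sideAt x ≡ 0 → toℕ (rw last) < toℕ (rw x)
      last<above e = center-wrap (rY x₀) _ _ rY-x₀<last (ℕₚ.<⇒≤ (Y-side e side-x₀ (s≤s z≤n)))

      below<last : ∀ {x} → x ≢ last → sideAt x ≡ 2 → toℕ (rw x) < toℕ (rw last)
      below<last n e = center->-< (rY x₀) _ _ (Y-side side-x₀ e (s≤s (s≤s z≤n))) (rY-≤last _ n)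

      above-< : ∀ {x y} → sideAt y ≡ 0 → toℕ (rY x) < toℕ (rY y) → toℕ (rw x) < toℕ (rw y)
      above-< e lt = center-≤-< (rY x₀) _ _ (ℕₚ.<⇒≤ (Y-side e side-x₀ (s≤s z≤n))) lt

      below-< : ∀ {x y} → sideAt x ≡ 2 → toℕ (rY x) < toℕ (rY y) → toℕ (rw x) < toℕ (rw y)
      below-< e lt = center->-< (rY x₀) _ _ (Y-side side-x₀ e (s≤s (s≤s z≤n))) lt

      below<above : ∀ {x y} → sideAt x ≡ 2 → sideAt y ≡ 0 → toℕ (rw x) < toℕ (rw y)
      below<above e e' = center-wrap (rY x₀) _ _ (Y-side side-x₀ e (s≤s (s≤s z≤n)))
          (ℕₚ.<⇒≤ (Y-side e' side-x₀ (s≤s z≤n)))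

      -- The rotated rows run below, last, above, centre, and `Below` and `Above` make the blocks
      -- weakly increase in this order.
      L-mono : ∀ x y → L x < L y → toℕ (rw x) < toℕ (rw y)
      L-mono x y lt with view x | view y
      ... | isCentre refl _ | _ = contradiction (subst (_≤ blk J last) refl (blk-mono J (≤last _)))
            (ℕₚ.<⇒≱ (subst (_< L y) L-x₀ lt))
      ... | isLast refl _ | isCentre refl _ = subst (λ z → toℕ (rw last) < toℕ z) (sym rw-x₀)
              (<last (λ e → x₀≢last (rw-inj _ _ (trans rw-x₀ (sym e)))))
      ... | isAbove _ n₂ _ _ | isCentre refl _ = subst (λ z → toℕ (rw x) < toℕ z) (sym rw-x₀)
              (<last (λ e → n₂ (rw-inj _ _ (trans e (sym rw-x₀)))))
      ... | isBelow _ n₂ _ _ | isCentre refl _ = subst (λ z → toℕ (rw x) < toℕ z) (sym rw-x₀)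
              (<last (λ e → n₂ (rw-inj _ _ (trans e (sym rw-x₀)))))
      ... | isLast refl _ | isLast refl _ = contradiction lt (ℕₚ.<-irrefl refl)
      ... | isLast refl _ | isAbove _ _ _ e = last<above e
      ... | isLast refl _ | isBelow n₁ n₂ b _ = contradiction (below-C b)
            (ℕₚ.<⇒≱ (subst₂ _<_ L-last (L-other n₁ n₂) lt))
      ... | isAbove n₁ n₂ a _ | isLast refl _ = contradiction (above-C a)
            (ℕₚ.<⇒≱ (subst₂ _<_ (L-other n₁ n₂) L-last lt))
      ... | isBelow n₁ _ _ e | isLast refl _ = below<last n₁ e
      ... | isAbove n₁ n₂ _ e | isAbove n₃ n₄ _ e' = above-< e' (rank-mono Y x y
              (ky-block (trans e (sym e')) (subst₂ _<_ (L-other n₁ n₂) (L-other n₃ n₄) lt)))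
      ... | isBelow n₁ n₂ _ e | isBelow n₃ n₄ _ e' = below-< e (rank-mono Y x y
              (ky-block (trans e (sym e')) (subst₂ _<_ (L-other n₁ n₂) (L-other n₃ n₄) lt)))
      ... | isBelow _ _ _ e | isAbove _ _ _ e' = below<above e e'
      ... | isAbove n₁ n₂ a _ | isBelow n₃ n₄ b _ = contradiction (ℕₚ.≤-trans (below-C b) (above-C a))
              (ℕₚ.<⇒≱ (subst₂ _<_ (L-other n₁ n₂) (L-other n₃ n₄) lt))

      blk-rw : ∀ x → blk J (rw x) ≡ L x
      blk-rw = label-preserved {b = blk J} {ρ = rw} {g = ζ ∘ swapLast x₀} (blk-mono J) rw-inj
        (Inj-∘ inj (swapLast-inj x₀ x₀≢last)) (λ _ → refl) L-mono

      arc<⇒left : ∀ {x} → arc x < arc x₀ → toℕ (rX x) < toℕ l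
      arc<⇒left {x} a = subst (λ z → toℕ (rX x) < toℕ z) rX-x₀ (rank-mono X x x₀ (kx-arc (C<N x) a))

      arc>⇒right : ∀ {x} → arc x₀ < arc x → toℕ l < toℕ (rX x)
      arc>⇒right {x} a = subst (λ z → toℕ z < toℕ (rX x)) rX-x₀ (rank-mono X x₀ x (kx-arc (C<N x₀) a))

      right-spec : ∀ x → x ≢ last → x ≢ x₀ → Flank (rightAt x) (rX x)
      right-spec x n₁ n₂ with right-view (arc x₀) (arc x) (sideAt x)
      ... | inj₁ (e , inj₁ a) = inj₁ (e , arc<⇒left a)
      ... | inj₂ (e , inj₁ a) = inj₂ (e , arc>⇒right a)
      ... | inj₁ (e , inj₂ (ea , es)) = inj₁
            (e , subst (λ z → toℕ (rX x) < toℕ z) rX-x₀ (X-side ea es side-x₀ (s≤s z≤n)))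
      ... | inj₂ (e , inj₂ (ea , es)) with view x
      ...   | isLast ex _ = contradiction ex n₁
      ...   | isCentre ex _ = contradiction ex n₂
      ...   | isAbove _ _ _ e0 = contradiction (sym e0) (ℕₚ.<⇒≢ es)
      ...   | isBelow _ _ _ e2 = inj₂ (e , subst (λ z → toℕ z < toℕ (rX x)) rX-x₀
            (X-side (sym ea) side-x₀ e2 (s≤s (s≤s z≤n))))

      same-col : ∀ {x y} → x ≢ last → x ≢ x₀ → y ≢ last → y ≢ x₀ → C x ≡ C y → sideAt x ≡ sideAt y →
        toℕ (rY x) < toℕ (rY y) → toℕ (center l (rX y)) < toℕ (center l (rX x))
      same-col {x} {y} n₁ n₂ n₃ n₄ ec es lt with ky-elim (C<N x) (C<N y) (rank-reflects Y x y lt)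
      ... | inj₁ s = contradiction es (ℕₚ.<⇒≢ s)
      ... | inj₂ (_ , inj₁ c) = contradiction ec (ℕₚ.<⇒≢ c)
      ... | inj₂ (_ , inj₂ (_ , q)) = columns-reversed
        (Sum.map₂ (λ (e , a) → e , rank-mono X y x (kx-arc (C<N y) a)) q) (right-spec x n₁ n₂)
            (right-spec y n₃ n₄)

      rX<last : ∀ {x} → x ≢ last → toℕ (rX x) < toℕ (last {m})
      rX<last n = <last (λ e → n (rX-inj _ _ (trans e (sym rX-last))))

      -- Points on different sides of the centre can share a rotated block only if it is the block
      -- that the last row now occupies. There the ties in `Below` and `Above` put the lower points
      -- left of `l` and the upper ones right of it, so the rotated columns fall across the cut as
      -- well.
      rw-dec : ∀ x y → L x ≡ L y → toℕ (rw x) < toℕ (rw y) → toℕ (center l (rX y)) < toℕ (center l (rX x))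
      rw-dec x y e lt with view x | view y
      ... | isCentre refl _ | _ = contradiction (≤last (rw y))
            (ℕₚ.<⇒≱ (subst (λ z → toℕ z < toℕ (rw y)) rw-x₀ lt))
      ... | isLast refl _ | isCentre refl _ = contradiction (trans (sym L-last) (trans e L-x₀)) (C≢∞ x₀≢last)
      ... | isAbove n₁ n₂ _ _ | isCentre refl _ = contradiction (trans (sym (L-other n₁ n₂)) (trans e L-x₀))
            (C≢∞ n₁)
      ... | isBelow n₁ n₂ _ _ | isCentre refl _ = contradiction (trans (sym (L-other n₁ n₂)) (trans e L-x₀))
            (C≢∞ n₁)
      ... | isLast refl _ | isLast refl _ = contradiction lt (ℕₚ.<-irrefl refl)
      ... | isLast refl _ | isAbove n₁ n₂ a _ = subst (λ z → toℕ (center l (rX y)) < toℕ (center l z))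
            (sym rX-last)
              (center->-< l (rX y) last (arc>⇒right
                  (above-arc a (trans (sym L-last) (trans e (L-other n₁ n₂))))) (rX<last n₁))
      ... | isLast refl _ | isBelow n₁ _ _ s = contradiction lt (ℕₚ.<-asym (below<last n₁ s))
      ... | isAbove _ _ _ s | isLast refl _ = contradiction lt (ℕₚ.<-asym (last<above s))
      ... | isBelow n₁ n₂ b _ | isLast refl _ = subst (λ z → toℕ (center l z) < toℕ (center l (rX x)))
            (sym rX-last)
              (center-wrap l last (rX x) (<last l≢last)
                  (ℕₚ.<⇒≤ (arc<⇒left (below-arc b (trans (sym (L-other n₁ n₂)) (trans e L-last))))))
      ... | isAbove n₁ n₂ _ s | isAbove n₃ n₄ _ s' = same-col n₁ n₂ n₃ n₄
              (trans (sym (L-other n₁ n₂)) (trans e (L-other n₃ n₄))) (trans s (sym s'))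
                  (reflect (inj-cmp rY-inj (λ q → ℕₚ.<⇒≢ lt (cong (toℕ ∘ rw) q))))
        where
        reflect : toℕ (rY x) < toℕ (rY y) ⊎ toℕ (rY y) < toℕ (rY x) → toℕ (rY x) < toℕ (rY y)
        reflect (inj₁ q) = q
        reflect (inj₂ q) = contradiction lt (ℕₚ.<-asym (above-< s q))
      ... | isBelow n₁ n₂ _ s | isBelow n₃ n₄ _ s' = same-col n₁ n₂ n₃ n₄
              (trans (sym (L-other n₁ n₂)) (trans e (L-other n₃ n₄))) (trans s (sym s'))
                  (reflect (inj-cmp rY-inj (λ q → ℕₚ.<⇒≢ lt (cong (toℕ ∘ rw) q))))
        where
        reflect : toℕ (rY x) < toℕ (rY y) ⊎ toℕ (rY y) < toℕ (rY x) → toℕ (rY x) < toℕ (rY y)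
        reflect (inj₁ q) = q
        reflect (inj₂ q) = contradiction lt (ℕₚ.<-asym (below-< s' q))
      ... | isAbove _ _ _ s | isBelow _ _ _ s' = contradiction lt (ℕₚ.<-asym (below<above s' s))
      ... | isBelow n₁ n₂ b _ | isAbove n₃ n₄ a _ = center-wrap l _ _ (arc>⇒right (above-arc a ec₂))
            (ℕₚ.<⇒≤ (arc<⇒left (below-arc b ec₁)))
        where
        ec : C x ≡ C y
        ec = trans (sym (L-other n₁ n₂)) (trans e (L-other n₃ n₄))
        ec₁ : C x ≡ C x₀
        ec₁ = ℕₚ.≤-antisym (below-C b) (ℕₚ.≤-trans (above-C a) (ℕₚ.≤-reflexive (sym ec)))
        ec₂ : C x₀ ≡ C y
        ec₂ = trans (sym ec₁) ec

    module Unstraightened {η : P → P} (h : ∀ y → η y ≡ unstraighten ζ y) where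

      private
        η-rX : ∀ x → η (rX x) ≡ rY x
        η-rX x = trans (h (rX x)) (cong rY (inv∘f rX-inj x))

        on-rX : (Q : P → Set) → (∀ x → Q (rX x)) → ∀ y → Q y
        on-rX Q q y = subst Q (f∘inv rX-inj y) (q (inv rX y))

        η-inj : Inj η
        η-inj a b e = inv-inj rX-inj a b (rY-inj _ _ (trans (sym (h a)) (trans e (h b))))

        row-rX : ∀ x → row η (rX x) ≡ rw x
        row-rX x = cong₂ center (trans (cong η (sym rX-x₀)) (η-rX x₀)) (η-rX x)

        blk-row : ∀ x → blk J (row η (rX x)) ≡ L x
        blk-row x = trans (cong (blk J) (row-rX x)) (blk-rw x)

      rotated : Rotated η
      rotated = record
        { inj = η-inj
        ; fix = trans (cong η (sym rX-last)) (trans (η-rX last) rY-last)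
        ; inc = on-rX _ λ x → on-rX _ λ y e lt → subst₂ (λ a b → toℕ a < toℕ b) (sym (η-rX x)) (sym (η-rX y))
                  (inc′ x y (trans (sym (arc-rX x)) (trans e (arc-rX y))) (rank-reflects X x y lt))
        ; dec = on-rX _ λ x → on-rX _ λ y e lt → rw-dec x y (trans (sym (blk-row x)) (trans e (blk-row y)))
                  (subst₂ (λ a b → toℕ a < toℕ b) (row-rX x) (row-rX y) lt)
        }
        where
        inc′ : ∀ x y → arc x ≡ arc y → X x < X y → toℕ (rY x) < toℕ (rY y)
        inc′ x y e lt with kx-elim (C<N y) lt
        ... | inj₁ a = contradiction e (ℕₚ.<⇒≢ a)
        ... | inj₂ (_ , inj₁ s) = rank-mono Y x y (ky-side s (C<N x))
        ... | inj₂ (_ , inj₂ (s , c)) = rank-mono Y x y (ky-block s c)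

      private
        rlabel-rX : ∀ x → rlabel η (rX x) ≡ C x
        rlabel-rX x = trans (cong (blk J ∘ row η) (swapLast-natural rX-inj x₀≢last rX-last rX-x₀ x))
          (trans (blk-row (swapLast x₀ x)) (cong C (swapLast-involutive x₀ x₀≢last x)))

        arc-inv : ∀ a → arc a ≡ arc (inv rX a)
        arc-inv a = trans (cong arc (sym (f∘inv rX-inj a))) (arc-rX (inv rX a))

        label-inv : ∀ a → rlabel η a ≡ C (inv rX a)
        label-inv a = trans (cong (rlabel η) (sym (f∘inv rX-inj a))) (rlabel-rX (inv rX a))

        label-inj′ : ∀ a b → arc a ≡ arc b → rlabel η a ≡ rlabel η b → a ≡ b
        label-inj′ a b ea eb = inv-inj rX-inj a b (label-inj _ _
          (trans (sym (arc-inv a)) (trans ea (arc-inv b))) (trans (sym (label-inv a)) (trans eb (label-inv b))))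

      straighten∘unstraighten : ∀ y → straighten η y ≡ ζ y
      straighten∘unstraighten = rebuild {ρ = inv rX} {f = ζ}
        (λ a b e → let ea , eb = hx-inj (blk-bound J _) (blk-bound J _) e in label-inj′ a b ea eb)
        (λ a b e → let ea , eb = hy-inj (arc<N a) (arc<N b) e in label-inj′ a b ea eb)
        (inv-inj rX-inj) inj
        (λ a b lt → hx-sorted _ _ (subst₂ _<_ (cong₂ hx (arc-inv a) (label-inv a))
            (cong₂ hx (arc-inv b) (label-inv b)) lt))
        (λ a b lt → hy-sorted _ _ (subst₂ _<_ (cong₂ hy (arc-inv a) (label-inv a))
            (cong₂ hy (arc-inv b) (label-inv b)) lt))

-- Equidistribution of recentred and standard inverse descent sets

≼-++⁻ : ∀ {k l} (x : Vec Bool k) (y : Vec Bool l) A → (x ++ᵛ y) ≼ A → x ≼ take k A × y ≼ drop k A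
≼-++⁻ {k} x y A h with Vec.splitAt k A
... | a , b , refl = split x a h
  where
  split : ∀ {k} (x a : Vec Bool k) → (x ++ᵛ y) ≼ (a ++ᵛ b) → x ≼ a × y ≼ b
  split [] [] h = (λ ()) , h
  split (_ ∷ x) (_ ∷ a) h with split x a (h ∘ suc)
  ... | p , q = (λ { zero → h zero ; (suc i) → p i }) , q

≼-++⁺ : ∀ {k l} (x : Vec Bool k) (y : Vec Bool l) A → x ≼ take k A → y ≼ drop k A → (x ++ᵛ y) ≼ A
≼-++⁺ {k} x y A p q with Vec.splitAt k A
... | a , b , refl = join x a p
  where
  join : ∀ {k} (x a : Vec Bool k) → x ≼ a → (x ++ᵛ y) ≼ (a ++ᵛ b)
  join [] [] p = q
  join (_ ∷ x) (_ ∷ a) p zero = p zero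
  join (_ ∷ x) (_ ∷ a) p (suc i) = join x a (p ∘ suc) i

lookup-ext : ∀ {A : Set} {n} {u v : Vec A n} → (∀ i → lookup u i ≡ lookup v i) → u ≡ v
lookup-ext {u = u} {v} h = trans (sym (Vecₚ.tabulate∘lookup u))
    (trans (Vecₚ.tabulate-cong h) (Vecₚ.tabulate∘lookup v))

map-not-injective : ∀ {n} {u v : Vec Bool n} → Vec.map not u ≡ Vec.map not v → u ≡ v
map-not-injective {u = []} {[]} e = refl
map-not-injective {u = _ ∷ _} {_ ∷ _} e with Vecₚ.∷-injective e
... | e₁ , e₂ = cong₂ _∷_ (Boolₚ.not-injective e₁) (map-not-injective e₂)

BlockDecreasing : ∀ {m} → Vec Bool m → (Fin (suc (suc m)) → Fin (suc (suc m))) → Set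
BlockDecreasing J f = ∀ x y → blk J (f x) ≡ blk J (f y) → toℕ (f x) < toℕ (f y) → toℕ y < toℕ x

module _ {m} (J : Vec Bool m) {f : Fin (suc (suc m)) → Fin (suc (suc m))} (fi : Inj f) where

  BlockDecreasing⇒≼ : BlockDecreasing J f → Vec.map not (D (inv f)) ≼ J
  BlockDecreasing⇒≼ h = Decreasing⇒notD≼ J λ p q e lt →
    h (inv f p) (inv f q) (subst₂ (λ a b → blk J a ≡ blk J b) (sym (f∘inv fi p)) (sym (f∘inv fi q)) e)
      (subst₂ (λ a b → toℕ a < toℕ b) (sym (f∘inv fi p)) (sym (f∘inv fi q)) lt)

  ≼⇒BlockDecreasing : Vec.map not (D (inv f)) ≼ J → BlockDecreasing J f
  ≼⇒BlockDecreasing h x y e lt = subst₂ (λ a b → toℕ a < toℕ b) (inv∘f fi y) (inv∘f fi x)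
    (notD≼⇒Decreasing J {inv f} h (f x) (f y) e lt)

Word : ℕ → Set
Word m = Vec (Fin (suc (suc m))) (suc (suc m))

Fixing : ∀ {m} → Fin (suc (suc m)) → Word m → Set
Fixing k u = IsPerm u × lookup u k ≡ last

fixing? : ∀ {m} k (u : Word m) → Dec (Fixing k u)
fixing? k u = isPerm? u ×-dec (lookup u k ≟F last)

iDes : ∀ {m} → Word m → Vec Bool m
iDes u = D (inv (lookup u))

iDesAt : ∀ {m} → Fin (suc (suc m)) → Word m → Vec Bool m
iDesAt l u = D (inv (recenter l (lookup u)))

module Vertical {m} (l : Fin (suc (suc m))) where

  -- Because of the complement, blocks decrease where arcs increase, so that a point is determined
  -- by its arc and its block.
  private
    sV sH : Word m → Vec Bool (m + m)
    sV u = Vec.map not (iDesAt l u) ++ᵛ D (lookup u)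
    sH u = Vec.map not (iDes u) ++ᵛ D (lookup u)

  Straightening : Set
  Straightening = Σ (Sub (fixing? {m} last) ↔ Sub (fixing? {m} last)) λ Φ →
    ∀ x → iDes (proj₁ (Inverse.to Φ x)) ≡ iDesAt l (proj₁ x) × D (lookup (proj₁ (Inverse.to Φ x))) ≡ D
        (lookup (proj₁ x))

  module _ (l≢last : l ≢ last) where

    private
      -- The first `m` bits of the bound concern the complemented inverse descents and give the
      -- blocks; the others concern descents and give the arcs.
      module C A = Core {m} (drop m A) (take m A) l l≢last

      f g : Vec Bool (m + m) → Word m → Word m
      f A u = tabulate (C.straighten A (lookup u))
      g A u = tabulate (C.unstraighten A (lookup u))

      lf : ∀ A u y → lookup (f A u) y ≡ C.straighten A (lookup u) y
      lf A u = Vecₚ.lookup∘tabulate _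

      lg : ∀ A u y → lookup (g A u) y ≡ C.unstraighten A (lookup u) y
      lg A u = Vecₚ.lookup∘tabulate _

      rowcol : ∀ (ζ : Fin (suc (suc m)) → Fin (suc (suc m))) x → recenter l ζ (center l x) ≡ center (ζ l) (ζ x)
      rowcol ζ x = cong (center (ζ l) ∘ ζ) (center⁻∘center l x)

      toRotated : ∀ A u → Fixing last u → sV u ≼ A → C.Rotated A (lookup u)
      toRotated A u (p , e) le with ≼-++⁻ (Vec.map not (iDesAt l u)) _ A le
      ... | leJ , leS = record
        { inj = p ; fix = e ; inc = D≼⇒Increasing (drop m A) p leS
        ; dec = λ x y eb lt → ≼⇒BlockDecreasing (take m A) (recenter-inj l p) leJ (center l x) (center l y)
            (subst₂ (λ a b → blk (take m A) a ≡ blk (take m A) b) (sym (rowcol (lookup u) x))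
                (sym (rowcol (lookup u) y)) eb)
            (subst₂ (λ a b → toℕ a < toℕ b) (sym (rowcol (lookup u) x)) (sym (rowcol (lookup u) y)) lt) }

      fromRotated : ∀ A u → C.Rotated A (lookup u) → Fixing last u × sV u ≼ A
      fromRotated A u r = (inj , fix) , ≼-++⁺ (Vec.map not (iDesAt l u)) _ A
          (BlockDecreasing⇒≼ (take m A) (recenter-inj l inj) λ x y eb lt →
            subst₂ (λ a b → toℕ a < toℕ b) (center∘center⁻ l y) (center∘center⁻ l x)
              (dec (center⁻ l x) (center⁻ l y) eb lt))
          (Increasing⇒D≼ (drop m A) inc)
        where open C.Rotated A r

      toStraight : ∀ A u → Fixing last u → sH u ≼ A → C.Straight A (lookup u)
      toStraight A u (p , e) le with ≼-++⁻ (Vec.map not (iDes u)) _ A le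
      ... | leJ , leS = record
        { inj = p ; fix = e ; inc = D≼⇒Increasing (drop m A) p leS ; dec = ≼⇒BlockDecreasing (take m A) p leJ }

      fromStraight : ∀ A u → C.Straight A (lookup u) → Fixing last u × sH u ≼ A
      fromStraight A u r = (inj , fix) , ≼-++⁺ (Vec.map not (iDes u)) _ A
          (BlockDecreasing⇒≼ (take m A) inj dec) (Increasing⇒D≼ (drop m A) inc)
        where open C.Straight A r

      f-ok : ∀ A u → Fixing last u → sV u ≼ A → Fixing last (f A u) × sH (f A u) ≼ A × g A (f A u) ≡ u
      f-ok A u p le = proj₁ q , proj₂ q , lookup-ext λ y → trans (lg A (f A u) y) (St.unstraighten∘straighten y)
        where
        module R = C.FromRotated A (toRotated A u p le)
        module St = R.Straightened {lookup (f A u)} (lf A u)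
        q : Fixing last (f A u) × sH (f A u) ≼ A
        q = fromStraight A (f A u) St.straight

      g-ok : ∀ A u → Fixing last u → sH u ≼ A → Fixing last (g A u) × sV (g A u) ≼ A × f A (g A u) ≡ u
      g-ok A u p le = proj₁ q , proj₂ q , lookup-ext λ y → trans (lf A (g A u) y) (St.straighten∘unstraighten y)
        where
        module R = C.FromStraight A (toStraight A u p le)
        module St = R.Unstraightened {lookup (g A u)} (lg A u)
        q : Fixing last (g A u) × sV (g A u) ≼ A
        q = fromRotated A (g A u) St.rotated

      module E = Equidistribution (fixing? last) (fixing? last) sV sH f g f-ok g-ok

    straightening-proper : Straightening
    straightening-proper = E.bijection , λ x →
      let e₁ , e₂ = Vecₚ.++-injective (Vec.map not (iDes (proj₁ (Inverse.to E.bijection x)))) _ (E.bijection-stat x)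
      in map-not-injective e₁ , e₂

center-last : ∀ {m} (x : Fin (suc (suc m))) → center last x ≡ x
center-last {m} x = cong (λ t → rotPow t x) (trans (cong (suc m ∸_) (toℕ-fromℕ (suc m))) (ℕₚ.n∸n≡0 m))

center⁻-last : ∀ {m} (x : Fin (suc (suc m))) → center⁻ last x ≡ x
center⁻-last {m} x = trans (sym (center-last _)) (center∘center⁻ last x)

opaque
  straightening : ∀ {m} (l : Fin (suc (suc m))) → Vertical.Straightening l
  straightening {m} l with l ≟F last
  ... | no ne = Vertical.straightening-proper l ne
  -- Centring at the point that already stands last changes nothing, so the identity serves.
  ... | yes refl = mk↔ₛ′ (λ x → x) (λ x → x) (λ _ → refl) (λ _ → refl) , λ x →
        eq (proj₁ x) (toWitness (proj₂ x)) , refl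
    where
    eq : ∀ u → Fixing last u → iDes u ≡ iDesAt (last {m}) u
    eq u (p , e) = D-cong (inv-cong p (recenter-inj last p) λ x →
      trans (sym (center-last (lookup u x))) (cong₂ center (sym e) (cong (lookup u) (sym (center⁻-last x)))))

-- Rotating and re-sorting the words of tableaux

module BlockSort {m} (J : Vec Bool m) where

  open Keys m 0
  private
    P : Set
    P = Fin (suc (suc m))

  key : (P → P) → P → ℕ
  key g x = lex (blk J (g x)) (N ∸ toℕ x)

  -- For injective `g`, the only block-decreasing permutation that sends each position into the same
  -- block as `g` does.
  blockSort : (P → P) → P → P
  blockSort g = rank (key g)

  key-inj : ∀ g → Inj (key g)
  key-inj g x y e = toℕ-injective (ℕₚ.∸-cancelˡ-≡ (ℕₚ.<⇒≤ (toℕ<n x)) (ℕₚ.<⇒≤ (toℕ<n y))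
    (proj₂ (lex-inj (neg<w (toℕ x)) (neg<w (toℕ y)) e)))

  blockSort-inj : ∀ g → Inj (blockSort g)
  blockSort-inj g = rank-inj (key g) (key-inj g)

  blk-blockSort : ∀ {g} → Inj g → ∀ x → blk J (blockSort g x) ≡ blk J (g x)
  blk-blockSort {g} gi = label-preserved {b = blk J} {ρ = blockSort g} {g = g} (blk-mono J)
      (blockSort-inj g) gi (λ _ → refl)
    (λ x y lt → rank-mono (key g) x y (lex-<ˡ (neg<w (toℕ x)) lt))

  blockSort-decreasing : ∀ {g} → Inj g → BlockDecreasing J (blockSort g)
  blockSort-decreasing {g} gi x y e lt with lex-elim (neg<w (toℕ y)) (rank-reflects (key g) x y lt)
  ... | inj₁ l = contradiction (trans (sym (blk-blockSort gi x)) (trans e (blk-blockSort gi y))) (ℕₚ.<⇒≢ l)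
  ... | inj₂ (_ , l) = neg-<⁻ l

  blockSort-unique : ∀ {g h} → Inj h → BlockDecreasing J h → (∀ x → blk J (g x) ≡ blk J (h x)) → ∀ x →
      blockSort g x ≡ h x
  blockSort-unique {g} {h} hi hd e = rank-unique (key-inj g) hi sorted
    where
    sorted : ∀ x y → key g x < key g y → toℕ (h x) < toℕ (h y)
    sorted x y lt with lex-elim (neg<w (toℕ y)) lt
    ... | inj₁ l = blk-reflects-< J (subst₂ _<_ (e x) (e y) l)
    ... | inj₂ (eb , l) with ℕₚ.<-cmp (toℕ (h x)) (toℕ (h y))
    ...   | tri< l' _ _ = l'
    ...   | tri≈ _ e' _ = contradiction (cong toℕ (hi _ _ (toℕ-injective (sym e')))) (ℕₚ.<⇒≢ (neg-<⁻ l))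
    ...   | tri> _ _ q = contradiction (hd y x (trans (sym (e y)) (trans (sym eb) (e x))) q)
          (ℕₚ.<-asym (neg-<⁻ l))

rot-inject₁ : ∀ {p} (i : Fin p) → rot (inject₁ i) ≡ suc i
rot-inject₁ {suc p} i = toℕ-injective (trans
    (toℕ-rot (inject₁ i) (subst (_< suc p) (sym (toℕ-inject₁ i)) (toℕ<n i)))
  (cong suc (toℕ-inject₁ i)))

center⁻-to-last : ∀ {m} (k : Fin (suc (suc m))) → center⁻ k last ≡ k
center⁻-to-last k = trans (cong (center⁻ k) (sym (center-self-last k))) (center⁻∘center k k)

-- Unlike `D`, this also reads the junction with the last position.
linDes : ∀ {m} → Word m → Vec Bool (suc m)
linDes u = tabulate λ i → toℕ (lookup u (suc i)) <ᵇ toℕ (lookup u (inject₁ i))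

-- The cyclic descent set of the word `lookup u ∘ center k`, in which the last entry of `u` stands
-- at position `k`.
cDesAt : ∀ {m} → Fin (suc (suc m)) → Word m → Vec Bool (suc (suc m))
cDesAt k u = tabulate λ i → lookup (cDesPerm u) (center k i)

lookup-cDesAt : ∀ {m} k (u : Word m) i → lookup (cDesAt k u) i ≡
  (toℕ (lookup u (rot (center k i))) <ᵇ toℕ (lookup u (center k i)))
lookup-cDesAt k u i = trans (Vecₚ.lookup∘tabulate (λ i → lookup (cDesPerm u) (center k i)) i)
  (Vecₚ.lookup∘tabulate (λ i → toℕ (lookup u (rot i)) <ᵇ toℕ (lookup u i)) (center k i))

module Tableau {m} (k : Fin (suc (suc m))) where

  private
    sT sH : Word m → Vec Bool (m + suc m)
    sT u = Vec.map not (iDes u) ++ᵛ linDes u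
    sH u = Vec.map not (iDes u) ++ᵛ tabulate (λ i → lookup (cDesAt k u) (inject₁ i))

    module _ (J : Vec Bool m) {σ ζ : Word m} (σi : IsPerm σ) (ζi : IsPerm ζ) (σk : lookup σ k ≡ last)
      (σd : BlockDecreasing J (lookup σ)) (ζd : BlockDecreasing J (lookup ζ))
      (lab : ∀ e → blk J (lookup ζ (center k e)) ≡ blk J (lookup σ e)) where

      -- Rotation keeps cyclic neighbours and re-sorting keeps blocks. Neighbours from different
      -- blocks compare as their blocks do; neighbours from one block form a descent in both words
      -- unless the rotation cuts between them. The only cut is after `k`, whose value is alone in
      -- its block.
      same-descent : ∀ e e' → toℕ e' ≡ suc (toℕ e) → (toℕ (lookup σ e') <ᵇ toℕ (lookup σ e)) ≡
        (toℕ (lookup ζ (rot (center k e))) <ᵇ toℕ (lookup ζ (center k e)))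
      same-descent e e' se = subst (λ z → (toℕ (lookup σ e') <ᵇ toℕ (lookup σ e)) ≡
          (toℕ (lookup ζ z) <ᵇ toℕ (lookup ζ (center k e))))
          (trans (cong (center k) (toℕ-injective
              (trans se (sym (toℕ-rot e (s≤s⁻¹ (subst (_< suc (suc m)) se (toℕ<n e'))))))))
              (center-rot k e)) main
        where
        main : (toℕ (lookup σ e') <ᵇ toℕ (lookup σ e)) ≡
            (toℕ (lookup ζ (center k e')) <ᵇ toℕ (lookup ζ (center k e)))
        main with ℕₚ.<-cmp (blk J (lookup σ e')) (blk J (lookup σ e))
        ... | tri< l _ _ = trans (<ᵇ-true (blk-reflects-< J l))
              (sym (<ᵇ-true (blk-reflects-< J (subst₂ _<_ (sym (lab e')) (sym (lab e)) l))))
        ... | tri> _ _ g = trans (<ᵇ-false (ℕₚ.<⇒≤ (blk-reflects-< J g)))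
                (sym (<ᵇ-false (ℕₚ.<⇒≤ (blk-reflects-< J (subst₂ _<_ (sym (lab e)) (sym (lab e')) g)))))
        ... | tri≈ _ eq _ = trans (<ᵇ-true σ<) (sym (<ᵇ-true ζ<))
          where
          e<e' : toℕ e < toℕ e'
          e<e' = ℕₚ.≤-reflexive (sym se)
          e≢e' : e ≢ e'
          e≢e' q = ℕₚ.<⇒≢ e<e' (cong toℕ q)
          e≢k : e ≢ k
          e≢k refl = e≢e' (σi _ _ (trans σk (sym (blk-≡-last J (trans eq (cong (blk J) σk))))))
          c<c' : toℕ (center k e) < toℕ (center k e')
          c<c' with toℕ e' ≤? toℕ k
          ... | yes le = center-≤-< k e e' le e<e'
          ... | no nle = center->-< k e e' (≤∧≢⇒<F (s≤s⁻¹ (subst (toℕ k <_) se (ℕₚ.≰⇒> nle))) (e≢k ∘ sym)) e<e'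
          σ< : toℕ (lookup σ e') < toℕ (lookup σ e)
          σ< with inj-cmp σi e≢e'
          ... | inj₂ l = l
          ... | inj₁ l = contradiction (σd e e' (sym eq) l) (ℕₚ.<-asym e<e')
          ζ< : toℕ (lookup ζ (center k e')) < toℕ (lookup ζ (center k e))
          ζ< with inj-cmp ζi (e≢e' ∘ center-inj k e e')
          ... | inj₂ l = l
          ... | inj₁ l = contradiction (ζd _ _ (trans (lab e) (trans (sym eq) (sym (lab e')))) l)
                (ℕₚ.<-asym c<c')

      same-descents : linDes σ ≡ tabulate (λ i → lookup (cDesAt k ζ) (inject₁ i))
      same-descents = Vecₚ.tabulate-cong λ i → trans
          (same-descent (inject₁ i) (suc i) (cong suc (sym (toℕ-inject₁ i))))
        (sym (lookup-cDesAt k ζ (inject₁ i)))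

    module B (A : Vec Bool (m + suc m)) = BlockSort {m} (take m A)

    -- Rotating the positions spoils the decreasing order within the blocks, and `blockSort`
    -- restores it.
    f g : Vec Bool (m + suc m) → Word m → Word m
    f A u = tabulate (B.blockSort A (lookup u ∘ center⁻ k))
    g A u = tabulate (B.blockSort A (lookup u ∘ center k))

    lf : ∀ A u x → lookup (f A u) x ≡ B.blockSort A (lookup u ∘ center⁻ k) x
    lf A u = Vecₚ.lookup∘tabulate _

    lg : ∀ A u x → lookup (g A u) x ≡ B.blockSort A (lookup u ∘ center k) x
    lg A u = Vecₚ.lookup∘tabulate _

    Inj-resp : ∀ {p q : Fin (suc (suc m)) → Fin (suc (suc m))} → (∀ x → p x ≡ q x) → Inj q → Inj p
    Inj-resp h qi a b e = qi a b (trans (sym (h a)) (trans e (h b)))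

    BD-resp : ∀ {J} {p q : Fin (suc (suc m)) → Fin (suc (suc m))} → (∀ x → p x ≡ q x) →
        BlockDecreasing J q → BlockDecreasing J p
    BD-resp {J} h d x y e lt = d x y (subst₂ (λ a b → blk J a ≡ blk J b) (h x) (h y) e)
      (subst₂ (λ a b → toℕ a < toℕ b) (h x) (h y) lt)

    f-ok : ∀ A u → Fixing k u → sT u ≼ A → Fixing last (f A u) × sH (f A u) ≼ A × g A (f A u) ≡ u
    f-ok A u (p , e) le with ≼-++⁻ (Vec.map not (iDes u)) _ A le
    ... | leJ , leS = (fi , ffix) , ≼-++⁺ (Vec.map not (iDes (f A u))) _ A (BlockDecreasing⇒≼ J fi fd)
            (subst (_≼ drop m A) (same-descents J {u} {f A u} p fi e ud fd lab) leS) ,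
          lookup-ext λ x → trans (lg A (f A u) x) (B.blockSort-unique A p ud lab x)
      where
      J : Vec Bool m
      J = take m A
      gi : Inj (lookup u ∘ center⁻ k)
      gi = Inj-∘ p (center⁻-inj k)
      ud : BlockDecreasing J (lookup u)
      ud = ≼⇒BlockDecreasing J p leJ
      fi : IsPerm (f A u)
      fi = Inj-resp (lf A u) (B.blockSort-inj A _)
      fd : BlockDecreasing J (lookup (f A u))
      fd = BD-resp (lf A u) (B.blockSort-decreasing A gi)
      blk-f : ∀ x → blk J (lookup (f A u) x) ≡ blk J (lookup u (center⁻ k x))
      blk-f x = trans (cong (blk J) (lf A u x)) (B.blk-blockSort A gi x)
      lab : ∀ x → blk J (lookup (f A u) (center k x)) ≡ blk J (lookup u x)
      lab x = trans (blk-f (center k x)) (cong (blk J ∘ lookup u) (center⁻∘center k x))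
      ffix : lookup (f A u) last ≡ last
      ffix = blk-≡-last J (trans (blk-f last) (cong (blk J) (trans (cong (lookup u) (center⁻-to-last k)) e)))

    g-ok : ∀ A u → Fixing last u → sH u ≼ A → Fixing k (g A u) × sT (g A u) ≼ A × f A (g A u) ≡ u
    g-ok A u (p , e) le with ≼-++⁻ (Vec.map not (iDes u)) _ A le
    ... | leJ , leS = (gi , gfix) , ≼-++⁺ (Vec.map not (iDes (g A u))) _ A (BlockDecreasing⇒≼ J gi gd)
            (subst (_≼ drop m A) (sym (same-descents J {g A u} {u} gi p gfix gd ud (λ x → sym (blk-g x))))
                leS) ,
          lookup-ext λ x → trans (lf A (g A u) x) (B.blockSort-unique A p ud
            (λ x → trans (blk-g (center⁻ k x)) (cong (blk J ∘ lookup u) (center∘center⁻ k x))) x)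
      where
      J : Vec Bool m
      J = take m A
      hi′ : Inj (lookup u ∘ center k)
      hi′ = Inj-∘ p (center-inj k)
      ud : BlockDecreasing J (lookup u)
      ud = ≼⇒BlockDecreasing J p leJ
      gi : IsPerm (g A u)
      gi = Inj-resp (lg A u) (B.blockSort-inj A _)
      gd : BlockDecreasing J (lookup (g A u))
      gd = BD-resp (lg A u) (B.blockSort-decreasing A hi′)
      blk-g : ∀ x → blk J (lookup (g A u) x) ≡ blk J (lookup u (center k x))
      blk-g x = trans (cong (blk J) (lg A u x)) (B.blk-blockSort A hi′ x)
      gfix : lookup (g A u) k ≡ last
      gfix = blk-≡-last J (trans (blk-g k) (cong (blk J) (trans (cong (lookup u) (center-self-last k)) e)))

    module E = Equidistribution (fixing? k) (fixing? last) sT sH f g f-ok g-ok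

  opaque
    -- The last bit of `cDesAt` has no counterpart in `linDes`; it is the bit that the cyclic
    -- extension adds to the descent set of a tableau.
    resort : Σ (Sub (fixing? k) ↔ Sub (fixing? {m} last)) λ Φ →
      ∀ x → iDes (proj₁ (Inverse.to Φ x)) ≡ iDes (proj₁ x) ×
            (∀ i → lookup (cDesAt k (proj₁ (Inverse.to Φ x))) (inject₁ i) ≡ lookup (linDes (proj₁ x)) i)
    resort = E.bijection , λ x →
      let e₁ , e₂ = Vecₚ.++-injective (Vec.map not (iDes (proj₁ (Inverse.to E.bijection x)))) _ (E.bijection-stat x)
      in map-not-injective e₁ , λ i → trans
        (sym (Vecₚ.lookup∘tabulate (λ i → lookup (cDesAt k (proj₁ (Inverse.to E.bijection x))) (inject₁ i)) i))
        (cong (λ v → lookup v i) e₂)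

-- Ribbons

-- Rows are numbered from the bottom here; row r occupies the columns rowStart r ≤ j < rowEnd r.
rowStart rowEnd : ∀ {m} → Vec Bool m → ℕ → ℕ
rowStart J zero = 0
rowStart [] (suc r) = 1
rowStart (true ∷ J) (suc r) = rowStart J r
rowStart (false ∷ J) (suc r) = suc (rowStart J (suc r))
rowEnd [] zero = 1
rowEnd [] (suc r) = 2
rowEnd (true ∷ J) zero = 1
rowEnd (true ∷ J) (suc r) = rowEnd J r
rowEnd (false ∷ J) r = suc (rowEnd J r)

top : ∀ {m} → Vec Bool m → ℕ
top [] = 1
top (b ∷ J) = bit b + top J

0<rowEnd : ∀ {m} (J : Vec Bool m) r → 0 < rowEnd J r
0<rowEnd [] zero = s≤s z≤n
0<rowEnd [] (suc r) = s≤s z≤n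
0<rowEnd (true ∷ J) zero = s≤s z≤n
0<rowEnd (true ∷ J) (suc r) = 0<rowEnd J r
0<rowEnd (false ∷ J) r = s≤s z≤n

rowStart-step : ∀ {m} (J : Vec Bool m) r → rowStart J r ≤ rowStart J (suc r)
rowStart-step J zero = z≤n
rowStart-step [] (suc r) = ℕₚ.≤-refl
rowStart-step (true ∷ J) (suc r) = rowStart-step J r
rowStart-step (false ∷ J) (suc r) = s≤s (rowStart-step J (suc r))

rowEnd-step : ∀ {m} (J : Vec Bool m) r → rowEnd J r ≤ rowEnd J (suc r)
rowEnd-step [] zero = s≤s z≤n
rowEnd-step [] (suc r) = ℕₚ.≤-refl
rowEnd-step (true ∷ J) zero = 0<rowEnd J 0
rowEnd-step (true ∷ J) (suc r) = rowEnd-step J r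
rowEnd-step (false ∷ J) r = s≤s (rowEnd-step J r)

rowStart≤rowEnd : ∀ {m} (J : Vec Bool m) r → rowStart J r ≤ rowEnd J r
rowStart≤rowEnd J zero = z≤n
rowStart≤rowEnd [] (suc r) = s≤s z≤n
rowStart≤rowEnd (true ∷ J) (suc r) = rowStart≤rowEnd J r
rowStart≤rowEnd (false ∷ J) (suc r) = s≤s (rowStart≤rowEnd J (suc r))

Σ↓ : (ℕ → ℕ) → ℕ → ℕ
Σ↓ f n = sum (applyDownFrom f n)

Σ↓-shift : ∀ f n → Σ↓ f (suc n) ≡ Σ↓ (f ∘ suc) n + f 0
Σ↓-shift f zero = ℕₚ.+-comm (f 0) 0
Σ↓-shift f (suc n) = trans (cong (f (suc n) +_) (Σ↓-shift f n)) (sym (ℕₚ.+-assoc (f (suc n)) _ _))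

Σ↓-suc : ∀ f n → Σ↓ (suc ∘ f) n ≡ Σ↓ f n + n
Σ↓-suc f zero = refl
Σ↓-suc f (suc n) = trans (cong (suc (f n) +_) (Σ↓-suc f n))
  (solve 3 (λ a b c → con 1 :+ a :+ (b :+ c) := a :+ b :+ (con 1 :+ c)) refl (f n) (Σ↓ f n) n)
  where open +-*-Solver

-- A leading break puts a row with a single cell underneath; a leading join lengthens the bottom row
-- by one cell and moves all other rows one column to the right.
cell-count : ∀ {m} (J : Vec Bool m) → Σ↓ (rowEnd J) (suc (top J)) ≡ Σ↓ (rowStart J) (suc (top J)) + suc (suc m)
cell-count [] = refl
cell-count {suc m} (true ∷ J) = trans (Σ↓-shift (rowEnd (true ∷ J)) (suc (top J)))
  (trans (cong (_+ 1) (cell-count J)) (trans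
    (solve 2 (λ a b → a :+ b :+ con 1 := a :+ con 0 :+ (con 1 :+ b)) refl (Σ↓ (rowStart J) (suc (top J)))
        (suc (suc m)))
    (cong (_+ suc (suc (suc m))) (sym (Σ↓-shift (rowStart (true ∷ J)) (suc (top J)))))))
  where open +-*-Solver
cell-count {suc m} (false ∷ J) = trans (Σ↓-suc (rowEnd J) (suc t)) (trans (cong (_+ suc t) (cell-count J))
  (trans (cong (λ z → z + suc (suc m) + suc t) (Σ↓-shift (rowStart J) t))
  (trans (solve 3 (λ a b c → a :+ con 0 :+ b :+ (con 1 :+ c) := a :+ c :+ con 0 :+ (con 1 :+ b)) refl
           (Σ↓ (rowStart J ∘ suc) t) (suc (suc m)) t)
  (trans (cong (λ z → z + 0 + suc (suc (suc m))) (sym (Σ↓-suc (rowStart J ∘ suc) t)))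
    (cong (_+ suc (suc (suc m))) (sym (Σ↓-shift (rowStart (false ∷ J)) t)))))))
  where
  open +-*-Solver
  t : ℕ
  t = top J

part-applyDownFrom : ∀ f R i → i ≤ R → part (applyDownFrom f (suc R)) i ≡ f (R ∸ i)
part-applyDownFrom f R zero le = refl
part-applyDownFrom f (suc R) (suc i) (s≤s le) = part-applyDownFrom f R i le

part-decreasing : ∀ f R → (∀ r → f r ≤ f (suc r)) → ∀ i →
  part (applyDownFrom f R) (suc i) ≤ part (applyDownFrom f R) i
part-decreasing f zero mono i = z≤n
part-decreasing f (suc zero) mono zero = z≤n
part-decreasing f (suc (suc R)) mono zero = mono R
part-decreasing f (suc R) mono (suc i) = part-decreasing f R mono i

part-≤ : ∀ f g R → (∀ r → f r ≤ g r) → ∀ i → part (applyDownFrom f R) i ≤ part (applyDownFrom g R) i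
part-≤ f g zero le i = z≤n
part-≤ f g (suc R) le zero = le R
part-≤ f g (suc R) le (suc i) = part-≤ f g R le i

-- The ribbon with descent set J, together with a detached cell to its north-east.
ribbon⊕cell : ∀ {m} → Vec Bool m → SkewShape (suc (suc m))
ribbon⊕cell J = record
  { outer = applyDownFrom (rowEnd J) (suc (top J))
  ; inner = applyDownFrom (rowStart J) (suc (top J))
  ; outer-dec = part-decreasing (rowEnd J) (suc (top J)) (rowEnd-step J)
  ; inner-dec = part-decreasing (rowStart J) (suc (top J)) (rowStart-step J)
  ; inner⊆outer = part-≤ (rowStart J) (rowEnd J) (suc (top J)) (rowStart≤rowEnd J)
  ; size = cell-count J
  }

opaque
  unfolding blk

  blk-last≡top : ∀ {m} (J : Vec Bool m) → blk J last ≡ top J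
  blk-last≡top [] = refl
  blk-last≡top (b ∷ J) = cong (bit b +_) (blk-last≡top J)

  column-bounds : ∀ {m} (J : Vec Bool m) p →
    rowStart J (blk J p) ≤ blk (Vec.map not J) p × blk (Vec.map not J) p < rowEnd J (blk J p)
  column-bounds J zero = z≤n , 0<rowEnd J 0
  column-bounds [] (suc zero) = s≤s z≤n , s≤s (s≤s z≤n)
  column-bounds (true ∷ J) (suc p) = column-bounds J p
  column-bounds (false ∷ J) (suc p) with blk J p | column-bounds J p
  ... | zero | a , b = z≤n , s≤s b
  ... | suc r | a , b = s≤s a , s≤s b

  position : ∀ {m} (J : Vec Bool m) r j → r ≤ top J → rowStart J r ≤ j → j < rowEnd J r →
    ∃ λ p → blk J p ≡ r × blk (Vec.map not J) p ≡ j
  position [] zero zero le a b = zero , refl , refl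
  position [] zero (suc j) le a (s≤s ())
  position [] (suc zero) (suc zero) le a b = suc zero , refl , refl
  position [] (suc zero) (suc (suc j)) le a (s≤s (s≤s ()))
  position [] (suc (suc r)) j (s≤s ()) a b
  position (true ∷ J) zero zero le a b = zero , refl , refl
  position (true ∷ J) zero (suc j) le a (s≤s ())
  position (true ∷ J) (suc r) j (s≤s le) a b with position J r j le a b
  ... | p , e₁ , e₂ = suc p , cong suc e₁ , e₂
  position (false ∷ J) zero zero le a b = zero , refl , refl
  position (false ∷ J) zero (suc j) le a (s≤s b) with position J zero j le z≤n b
  ... | p , e₁ , e₂ = suc p , e₁ , cong suc e₂
  position (false ∷ J) (suc r) (suc j) le (s≤s a) (s≤s b) with position J (suc r) j le a b
  ... | p , e₁ , e₂ = suc p , e₁ , cong suc e₂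

  cell-labels-inj : ∀ {m} (J : Vec Bool m) p q → blk J p ≡ blk J q →
      blk (Vec.map not J) p ≡ blk (Vec.map not J) q → p ≡ q
  cell-labels-inj J zero zero _ _ = refl
  cell-labels-inj [] zero (suc zero) () _
  cell-labels-inj [] (suc zero) zero () _
  cell-labels-inj [] (suc zero) (suc zero) _ _ = refl
  cell-labels-inj (true ∷ J) zero (suc q) () _
  cell-labels-inj (false ∷ J) zero (suc q) _ ()
  cell-labels-inj (true ∷ J) (suc p) zero () _
  cell-labels-inj (false ∷ J) (suc p) zero _ ()
  cell-labels-inj (b ∷ J) (suc p) (suc q) e₁ e₂ =
    cong suc (cell-labels-inj J p q (ℕₚ.+-cancelˡ-≡ (bit b) _ _ e₁) (ℕₚ.+-cancelˡ-≡ (bit (not b)) _ _ e₂))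

  detached : ∀ {m} (J : Vec Bool m) r → r < top J → rowEnd J r ≤ blk (Vec.map not J) last
  detached [] zero lt = s≤s z≤n
  detached [] (suc r) (s≤s ())
  detached (true ∷ J) zero lt = ℕₚ.≤-trans (s≤s z≤n) (blk-last (Vec.map not J) zero λ ())
  detached (true ∷ J) (suc r) (s≤s lt) = detached J r lt
  detached (false ∷ J) r lt = s≤s (detached J r lt)

  top-start : ∀ {m} (J : Vec Bool m) → rowStart J (top J) ≡ blk (Vec.map not J) last
  top-start [] = refl
  top-start (true ∷ J) = top-start J
  top-start (false ∷ J) with top J in eq | top-start J
  -- The top row is not the bottom row, because `last` forms a block of its own.
  ... | zero | _ = contradiction (trans (blk-last≡top J) eq) (λ e → ℕₚ.<⇒≢ (blk-last J zero λ ()) (sym e))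
  ... | suc t | e = cong suc e

  top-end : ∀ {m} (J : Vec Bool m) → rowEnd J (top J) ≡ suc (blk (Vec.map not J) last)
  top-end [] = refl
  top-end (true ∷ J) = top-end J
  top-end (false ∷ J) = cong suc (top-end J)

≼-refl : ∀ {n} {v w : Vec Bool n} → v ≡ w → v ≼ w
≼-refl refl i e = e

≼-complement : ∀ {n} (x v : Vec Bool n) → x ≼ v → Vec.map not x ≼ Vec.map not v → x ≡ v
≼-complement [] [] _ _ = refl
≼-complement (true ∷ x) (true ∷ v) p q = cong (true ∷_) (≼-complement x v (p ∘ suc) (q ∘ suc))
≼-complement (true ∷ x) (false ∷ v) p q = contradiction (p zero refl) λ ()
≼-complement (false ∷ x) (true ∷ v) p q = contradiction (q zero refl) λ ()
≼-complement (false ∷ x) (false ∷ v) p q = cong (false ∷_) (≼-complement x v (p ∘ suc) (q ∘ suc))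

module Ribbon {m} (J : Vec Bool m) where

  private
    P : Set
    P = Fin (suc (suc m))

  shape : SkewShape (suc (suc m))
  shape = ribbon⊕cell J

  R : ℕ
  R = top J

  rowOf colOf : P → ℕ
  rowOf p = R ∸ blk J p
  colOf = blk (Vec.map not J)

  -- The ribbon is numbered from its south-west end: a break of `J` steps up, a join steps right.
  -- Both labellings grow at `last`, so the final step is diagonal and reaches the detached cell.
  cell : P → ℕ × ℕ
  cell p = rowOf p , colOf p

  blk≤R : ∀ p → blk J p ≤ R
  blk≤R p = ℕₚ.≤-trans (blk-mono J (≤last p)) (ℕₚ.≤-reflexive (blk-last≡top J))

  isCell : ∀ {i j} → i ≤ R → rowStart J (R ∸ i) ≤ j → j < rowEnd J (R ∸ i) → IsCell shape (i , j)
  isCell {i} {j} le a b = subst (i <_) (sym (length-applyDownFrom (rowEnd J) (suc R))) (s≤s le) ,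
    subst (_≤ j) (sym (part-applyDownFrom (rowStart J) R i le)) a ,
    subst (j <_) (sym (part-applyDownFrom (rowEnd J) R i le)) b

  isCell⁻ : ∀ {i j} → IsCell shape (i , j) → i ≤ R × rowStart J (R ∸ i) ≤ j × j < rowEnd J (R ∸ i)
  isCell⁻ {i} {j} (lt , a , b) = le , subst (_≤ j) (part-applyDownFrom (rowStart J) R i le) a ,
      subst (j <_) (part-applyDownFrom (rowEnd J) R i le) b
    where
    le : i ≤ R
    le = s≤s⁻¹ (subst (i <_) (length-applyDownFrom (rowEnd J) (suc R)) lt)

  cell-isCell : ∀ p → IsCell shape (cell p)
  cell-isCell p = isCell (ℕₚ.m∸n≤m R (blk J p))
      (subst (λ r → rowStart J r ≤ colOf p) (sym (ℕₚ.m∸[m∸n]≡n (blk≤R p))) (proj₁ (column-bounds J p)))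
    (subst (λ r → colOf p < rowEnd J r) (sym (ℕₚ.m∸[m∸n]≡n (blk≤R p))) (proj₂ (column-bounds J p)))

  cell-surj : ∀ c → IsCell shape c → ∃ λ p → cell p ≡ c
  cell-surj (i , j) ic with isCell⁻ ic
  ... | le , a , b with position J (R ∸ i) j (ℕₚ.m∸n≤m R i) a b
  ... | p , e₁ , e₂ = p , cong₂ _,_ (trans (cong (R ∸_) e₁) (ℕₚ.m∸[m∸n]≡n le)) e₂

  rowOf-≡ : ∀ {p q} → rowOf p ≡ rowOf q → blk J p ≡ blk J q
  rowOf-≡ {p} {q} e = ℕₚ.∸-cancelˡ-≡ (blk≤R p) (blk≤R q) e

  rowOf-< : ∀ {p q} → rowOf p < rowOf q → blk J q < blk J p
  rowOf-< lt = ℕₚ.∸-cancelʳ-< lt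

  rowOf-<⁻ : ∀ {p q} → blk J q < blk J p → rowOf p < rowOf q
  rowOf-<⁻ {p} {q} lt = ℕₚ.∸-monoʳ-< lt (blk≤R p)

  cell-inj : Inj cell
  cell-inj p q e = cell-labels-inj J p q (rowOf-≡ (cong proj₁ e)) (cong proj₂ e)

  -- No neighbour of the detached cell belongs to the shape, so no path leaves it.
  not-ribbon : ¬ ConnectedRibbon shape
  not-ribbon (conn , _) = contradiction (stuck
      (conn (cell last) (cell zero) (cell-isCell last) (cell-isCell zero)))
      λ e → contradiction (cell-inj last zero (sym e)) λ ()
    where
    rowOf-last : rowOf last ≡ 0
    rowOf-last = trans (cong (R ∸_) (blk-last≡top J)) (ℕₚ.n∸n≡0 R)
    C : ℕ
    C = colOf last
    reach-cell : ∀ {c d} → Reach shape c d → IsCell shape c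
    reach-cell (here ic) = ic
    reach-cell (step ic _ _) = ic
    isolated : ∀ {c'} → Adjacent (0 , C) c' → ¬ IsCell shape c'
    isolated (inj₁ (refl , inj₁ refl)) ic with isCell⁻ ic
    ... | _ , _ , b = ℕₚ.<-irrefl refl (ℕₚ.≤-trans b (ℕₚ.≤-reflexive (top-end J)))
    isolated {_ , j'} (inj₁ (refl , inj₂ e)) ic with isCell⁻ ic
    ... | _ , a , _ = ℕₚ.1+n≰n (ℕₚ.≤-trans (ℕₚ.≤-reflexive e)
          (ℕₚ.≤-trans (ℕₚ.≤-reflexive (sym (top-start J))) a))
    isolated (inj₂ (refl , inj₁ refl)) ic with isCell⁻ ic
    ... | le , _ , b = ℕₚ.<⇒≱ b (detached J (R ∸ 1) (ℕₚ.∸-monoʳ-< {R} (s≤s z≤n) le))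
    isolated (inj₂ (_ , inj₂ ())) ic
    stuck : ∀ {d} → Reach shape (cell last) d → d ≡ cell last
    stuck (here _) = refl
    stuck (step {c' = c'} _ adj r) = contradiction (reach-cell r)
        (isolated (subst (λ z → Adjacent (z , C) c') rowOf-last adj))

  opaque
    -- Junk value zero when c is not a cell.
    pos : ℕ × ℕ → P
    pos c with any? (λ p → ×-≡-dec ℕₚ._≟_ ℕₚ._≟_ (cell p) c)
    ... | yes (p , _) = p
    ... | no _ = zero

    cell-pos : ∀ c → IsCell shape c → cell (pos c) ≡ c
    cell-pos c ic with any? (λ p → ×-≡-dec ℕₚ._≟_ ℕₚ._≟_ (cell p) c)
    ... | yes (_ , e) = e
    ... | no ne = contradiction (cell-surj c ic) ne

  ofTableau : Vec (ℕ × ℕ) (suc (suc m)) → Word m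
  ofTableau T = Vec.map pos T

  toTableau : Word m → Vec (ℕ × ℕ) (suc (suc m))
  toTableau σ = Vec.map cell σ

  lookup-toTableau : ∀ σ k → lookup (toTableau σ) k ≡ cell (lookup σ k)
  lookup-toTableau σ k = Vecₚ.lookup-map k cell σ

  cell-ofTableau : ∀ T → (∀ k → IsCell shape (lookup T k)) → ∀ k → cell (lookup (ofTableau T) k) ≡ lookup T k
  cell-ofTableau T ic k = trans (cong cell (Vecₚ.lookup-map k pos T)) (cell-pos _ (ic k))

  HasDescents : Word m → Set
  HasDescents σ = IsPerm σ × iDes σ ≡ J

  hasDescents? : ∀ σ → Dec (HasDescents σ)
  hasDescents? σ = isPerm? σ ×-dec Vecₚ.≡-dec Boolₚ._≟_ (iDes σ) J

  module _ {σ : Word m} (σi : IsPerm σ) where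

    private
      τ : P → P
      τ = inv (lookup σ)

    increasing-rows : Increasing J τ → ∀ k k' → rowOf (lookup σ k) ≡ rowOf (lookup σ k') →
      colOf (lookup σ k) < colOf (lookup σ k') → toℕ k < toℕ k'
    increasing-rows h k k' e lt = subst₂ (λ a b → toℕ a < toℕ b) (inv∘f σi k) (inv∘f σi k')
      (h _ _ (rowOf-≡ e) (blk-reflects-< (Vec.map not J) lt))

    decreasing-cols : Decreasing (Vec.map not J) τ → ∀ k k' → colOf (lookup σ k) ≡ colOf (lookup σ k') →
      rowOf (lookup σ k) < rowOf (lookup σ k') → toℕ k < toℕ k'
    decreasing-cols h k k' e lt = subst₂ (λ a b → toℕ a < toℕ b) (inv∘f σi k) (inv∘f σi k')
      (h _ _ (sym e) (blk-reflects-< J (rowOf-< {lookup σ k} {lookup σ k'} lt)))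

    rows⇒increasing : (∀ k k' → rowOf (lookup σ k) ≡ rowOf (lookup σ k') →
      colOf (lookup σ k) < colOf (lookup σ k') → toℕ k < toℕ k') → Increasing J τ
    rows⇒increasing h p q e lt = h (τ p) (τ q)
      (subst₂ (λ a b → rowOf a ≡ rowOf b) (sym (f∘inv σi p)) (sym (f∘inv σi q)) (cong (R ∸_) e))
      (subst₂ (λ a b → colOf a < colOf b) (sym (f∘inv σi p)) (sym (f∘inv σi q)) col<)
      where
      col< : colOf p < colOf q
      col< = ℕₚ.≤∧≢⇒< (blk-mono (Vec.map not J) (ℕₚ.<⇒≤ lt)) λ ec →
        ℕₚ.<⇒≢ lt (cong toℕ (cell-labels-inj J p q e ec))

    cols⇒decreasing : (∀ k k' → colOf (lookup σ k) ≡ colOf (lookup σ k') →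
      rowOf (lookup σ k) < rowOf (lookup σ k') → toℕ k < toℕ k') → Decreasing (Vec.map not J) τ
    cols⇒decreasing h p q e lt = h (τ q) (τ p)
      (subst₂ (λ a b → colOf a ≡ colOf b) (sym (f∘inv σi q)) (sym (f∘inv σi p)) (sym e))
      (subst₂ (λ a b → rowOf a < rowOf b) (sym (f∘inv σi q)) (sym (f∘inv σi p)) (rowOf-<⁻ {q} {p} blk<))
      where
      blk< : blk J p < blk J q
      blk< = ℕₚ.≤∧≢⇒< (blk-mono J (ℕₚ.<⇒≤ lt)) λ eb →
        ℕₚ.<⇒≢ lt (cong toℕ (cell-labels-inj J p q eb e))

  toTableau-SYT : ∀ σ → HasDescents σ → IsSYT shape (toTableau σ)
  toTableau-SYT σ (σi , e) = record
    { cells = λ k → subst (IsCell shape) (sym (lookup-toTableau σ k)) (cell-isCell (lookup σ k))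
    ; inj = λ k k' eq → σi k k' (cell-inj _ _
        (trans (sym (lookup-toTableau σ k)) (trans eq (lookup-toTableau σ k'))))
    ; surj = λ i j ic → let p , ep = cell-surj (i , j) ic in
        inv (lookup σ) p , trans (lookup-toTableau σ _) (trans (cong cell (f∘inv σi p)) ep)
    ; rows = λ k k' → subst₂ (λ c c' → proj₁ c ≡ proj₁ c' → proj₂ c < proj₂ c' → toℕ k < toℕ k')
        (sym (lookup-toTableau σ k)) (sym (lookup-toTableau σ k'))
        (increasing-rows {σ} σi (D≼⇒Increasing J (inv-inj σi) (≼-refl e)) k k')
    ; cols = λ k k' → subst₂ (λ c c' → proj₂ c ≡ proj₂ c' → proj₁ c < proj₁ c' → toℕ k < toℕ k')
        (sym (lookup-toTableau σ k)) (sym (lookup-toTableau σ k'))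
        (decreasing-cols {σ} σi (notD≼⇒Decreasing (Vec.map not J) (≼-refl (cong (Vec.map not) e))) k k')
    }

  -- Rows are the blocks of `J` and forbid inverse descents outside `J`; columns are the blocks of
  -- the complement and force them on `J`.
  ofTableau-descents : ∀ T → IsSYT shape T → HasDescents (ofTableau T)
  ofTableau-descents T syt = σi , ≼-complement (iDes σ) J
      (Increasing⇒D≼ J (rows⇒increasing {σ} σi λ k k' → subst₂
          (λ c c' → proj₁ c ≡ proj₁ c' → proj₂ c < proj₂ c' → toℕ k < toℕ k')
        (sym (ce k)) (sym (ce k')) (IsSYT.rows syt k k')))
      (Decreasing⇒notD≼ (Vec.map not J) (cols⇒decreasing {σ} σi λ k k' →
          subst₂ (λ c c' → proj₂ c ≡ proj₂ c' → proj₁ c < proj₁ c' → toℕ k < toℕ k')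
        (sym (ce k)) (sym (ce k')) (IsSYT.cols syt k k')))
    where
    σ : Word m
    σ = ofTableau T
    ce : ∀ k → cell (lookup σ k) ≡ lookup T k
    ce = cell-ofTableau T (IsSYT.cells syt)
    σi : IsPerm σ
    σi k k' e = IsSYT.inj syt k k' (trans (sym (ce k)) (trans (cong cell e) (ce k')))

  opaque
    tableaux : SYT shape ↔ Sub hasDescents?
    tableaux = mk↔ₛ′ to from to∘from from∘to
      where
      to : SYT shape → Sub hasDescents?
      to (T , p) = ofTableau T , fromWitness (ofTableau-descents T (toWitness p))
      from : Sub hasDescents? → SYT shape
      from (σ , p) = toTableau σ , fromWitness (toTableau-SYT σ (toWitness p))
      to∘from : ∀ x → to (from x) ≡ x
      to∘from (σ , p) = Sub-≡ {P? = hasDescents?} (lookup-ext λ k → cell-inj _ _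
        (trans (cell-ofTableau (toTableau σ) (IsSYT.cells (toTableau-SYT σ (toWitness p))) k)
            (lookup-toTableau σ k)))
      from∘to : ∀ T → from (to T) ≡ T
      from∘to (T , p) = Sub-≡ {P? = isSYT? shape} (lookup-ext λ k →
        trans (lookup-toTableau (ofTableau T) k) (cell-ofTableau T (IsSYT.cells (toWitness p)) k))

    -- Higher rows hold later positions of the ribbon numbering, so a smaller next value lies in a
    -- lower row or in the same row. The latter would contradict the growth of entries along rows.
    tableaux-Des : ∀ T i → lookup (linDes (proj₁ (Inverse.to tableaux T))) i ≡ lookup (DesT (proj₁ T)) i
    tableaux-Des (T , p) i = trans (Vecₚ.lookup∘tabulate
        (λ i → toℕ (lookup σ (suc i)) <ᵇ toℕ (lookup σ (inject₁ i))) i)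
      (trans main (sym (trans (Vecₚ.lookup∘tabulate
          (λ i → proj₁ (lookup T (inject₁ i)) <ᵇ proj₁ (lookup T (suc i))) i)
        (cong₂ (λ c c' → proj₁ c <ᵇ proj₁ c') (sym (ce (inject₁ i))) (sym (ce (suc i)))))))
      where
      σ : Word m
      σ = ofTableau T
      syt : IsSYT shape T
      syt = toWitness p
      ce : ∀ k → cell (lookup σ k) ≡ lookup T k
      ce = cell-ofTableau T (IsSYT.cells syt)
      e e' : P
      e = inject₁ i
      e' = suc i
      σi : IsPerm σ
      σi = proj₁ (ofTableau-descents T syt)
      main : (toℕ (lookup σ e') <ᵇ toℕ (lookup σ e)) ≡ (rowOf (lookup σ e) <ᵇ rowOf (lookup σ e'))
      main with ℕₚ.<-cmp (blk J (lookup σ e')) (blk J (lookup σ e))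
      ... | tri< l _ _ = trans (<ᵇ-true (blk-reflects-< J l))
            (sym (<ᵇ-true (rowOf-<⁻ {lookup σ e} {lookup σ e'} l)))
      ... | tri> _ _ g = trans (<ᵇ-false (ℕₚ.<⇒≤ (blk-reflects-< J g)))
            (sym (<ᵇ-false (ℕₚ.<⇒≤ (rowOf-<⁻ {lookup σ e'} {lookup σ e} g))))
      ... | tri≈ _ eb _ = trans (<ᵇ-false (ℕₚ.≮⇒≥ λ lt → ℕₚ.<-asym (ℕₚ.≤-reflexive (cong suc (toℕ-inject₁ i)))
              (subst₂ (λ a b → toℕ a < toℕ b) (inv∘f σi e') (inv∘f σi e)
                (D≼⇒Increasing J (inv-inj σi) (≼-refl (proj₂ (ofTableau-descents T syt))) _ _ eb lt))))
            (sym (<ᵇ-false (ℕₚ.≤-reflexive (cong (R ∸_) eb))))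

-- Rotated inverse descent classes

lookup-∷ʳ-inject₁ : ∀ {A : Set} {n} (xs : Vec A n) x i → lookup (xs ∷ʳ x) (inject₁ i) ≡ lookup xs i
lookup-∷ʳ-inject₁ (y ∷ xs) x zero = refl
lookup-∷ʳ-inject₁ (y ∷ xs) x (suc i) = lookup-∷ʳ-inject₁ xs x i

lookup-∷ʳ-fromℕ : ∀ {A : Set} {n} (xs : Vec A n) x → lookup (xs ∷ʳ x) (fromℕ n) ≡ x
lookup-∷ʳ-fromℕ [] x = refl
lookup-∷ʳ-fromℕ (y ∷ xs) x = lookup-∷ʳ-fromℕ xs x

module _ {m} (σ : Vec (Fin (suc m)) (suc m)) where

  embed-inject₁ : ∀ i → lookup (embed σ) (inject₁ i) ≡ inject₁ (lookup σ i)
  embed-inject₁ i = trans (lookup-∷ʳ-inject₁ (Vec.map inject₁ σ) (fromℕ (suc m)) i)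
      (Vecₚ.lookup-map i inject₁ σ)

  embed-last : lookup (embed σ) last ≡ last
  embed-last = lookup-∷ʳ-fromℕ (Vec.map inject₁ σ) (fromℕ (suc m))

  D-embed : D (lookup (embed σ)) ≡ des σ
  D-embed = Vecₚ.tabulate-cong λ i → cong₂ _<ᵇ_
    (trans (cong toℕ (embed-inject₁ (suc i))) (toℕ-inject₁ (lookup σ (suc i))))
    (trans (cong toℕ (embed-inject₁ (inject₁ i))) (toℕ-inject₁ (lookup σ (inject₁ i))))

center-rotPow : ∀ {p} t (a b : Fin (suc p)) → center (rotPow t a) (rotPow t b) ≡ center a b
center-rotPow zero a b = refl
center-rotPow (suc t) a b = trans (center-rot-rot (rotPow t a) (rotPow t b)) (center-rotPow t a b)

rotPow-rot : ∀ {p} (y x : Fin (suc p)) → rotPow (toℕ (rot y)) x ≡ center⁻ y x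
rotPow-rot {p} y x with ℕₚ.<-cmp (toℕ y) p
... | tri< lt _ _ = cong (λ t → rotPow t x) (toℕ-rot y lt)
... | tri≈ _ e _ = trans (cong (λ t → rotPow t x) (rot-last y e))
      (trans (sym (rotPow-full x)) (cong (λ t → rotPow (suc t) x) (sym e)))
... | tri> _ _ gt = contradiction (toℕ≤pred[n] y) (ℕₚ.<⇒≱ gt)

-- The representative of the coset C_n π that fixes the last element.
normalize : ∀ {m} → Word m → Fin (suc (suc m)) → Fin (suc (suc m))
normalize π e = center (lookup π last) (lookup π e)

normalize-inj : ∀ {m} {π : Word m} → IsPerm π → Inj (normalize π)
normalize-inj {π = π} πi = Inj-∘ (center-inj (lookup π last)) πi

-- `τ` fixes `last`, so normalizing removes the rotation of values whatever its exponent and returns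
-- `τ`.
InCD⇒descents : ∀ {m} {J : Subset m} {π} → InCD m J π → D (inv (normalize π)) ≡ J
InCD⇒descents {m} {J} {π} (πi , k , τ , (σ , (σi , dσ) , inverse) , rotated) =
  trans (D-cong λ i → inv-unique ni (trans (norm≡τ _) (inverse i))) (trans (D-embed σ) dσ)
  where
  ni : Inj (normalize π)
  ni = normalize-inj {π = π} πi
  τ-last : lookup τ last ≡ last
  τ-last = trans (cong (lookup τ) (sym (embed-last σ))) (inverse last)
  norm≡τ : ∀ e → normalize π e ≡ lookup τ e
  norm≡τ e = trans (cong₂ center (trans (rotated last) (cong (rotPow (toℕ k)) τ-last)) (rotated e))
    (trans (center-rotPow (toℕ k) last (lookup τ e)) (center-last (lookup τ e)))

descents⇒InCD : ∀ {m} {J : Subset m} {π} → IsPerm π → D (inv (normalize π)) ≡ J → InCD m J π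
-- The exponent is the value at `last` plus one, reduced modulo n: `rot` wraps the largest value to
-- 0, where the full turn is the identity.
descents⇒InCD {m} {J} {π} πi dπ = πi , rot (lookup π last) , τ ,
    (σ , (σi , trans (sym (D-embed σ)) (trans (D-cong embed-σ) dπ)) ,
    λ i → trans (lτ _) (trans (cong ν (embed-σ i)) (f∘inv νi i))) ,
    λ i → sym (trans (rotPow-rot (lookup π last) (lookup τ i))
      (trans (cong (center⁻ (lookup π last)) (lτ i)) (center⁻∘center (lookup π last) (lookup π i))))
  where
  ν : Fin (suc (suc m)) → Fin (suc (suc m))
  ν = normalize π
  νi : Inj ν
  νi = normalize-inj {π = π} πi
  τ : Word m
  τ = tabulate ν
  lτ : ∀ i → lookup τ i ≡ ν i
  lτ = Vecₚ.lookup∘tabulate ν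
  inv-last : inv ν last ≡ last
  inv-last = inv-unique νi (center-self-last (lookup π last))
  not-last : ∀ j → suc m ≢ toℕ (inv ν (inject₁ j))
  not-last j e = fromℕ≢inject₁ {i = j} (inv-inj νi _ _
    (trans inv-last (toℕ-injective (trans (toℕ-fromℕ (suc m)) e))))
  σ : Vec (Fin (suc m)) (suc m)
  σ = tabulate λ j → lower₁ (inv ν (inject₁ j)) (not-last j)
  inject₁-σ : ∀ j → inject₁ (lookup σ j) ≡ inv ν (inject₁ j)
  inject₁-σ j = trans (cong inject₁ (Vecₚ.lookup∘tabulate (λ j → lower₁ (inv ν (inject₁ j)) (not-last j))
      j)) (inject₁-lower₁ _ (not-last j))
  embed-σ : ∀ i → lookup (embed σ) i ≡ inv ν i
  embed-σ i with topView i
  ... | ‵fromℕ = trans (embed-last σ) (sym inv-last)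
  ... | ‵inject₁ j = trans (embed-inject₁ σ j) (inject₁-σ j)
  σi : IsPerm σ
  σi a b e = inject₁-injective (inv-inj νi _ _
      (trans (sym (inject₁-σ a)) (trans (cong inject₁ e) (inject₁-σ b))))

≡-irrelevant : ∀ {A : Set} {x y : A} (p q : x ≡ y) → p ≡ q
≡-irrelevant refl refl = refl

Restricted : ∀ {X A : Set} → (X → A) → A → Set
Restricted {X} a J = Σ X λ x → a x ≡ J

Restricted-≡ : ∀ {X A : Set} {a : X → A} {J : A} {x y : Restricted a J} → proj₁ x ≡ proj₁ y → x ≡ y
Restricted-≡ {x = x , p} {.x , q} refl = cong (x ,_) (≡-irrelevant p q)

restrict : ∀ {X Y A : Set} {a : X → A} {b : Y → A} (Φ : X ↔ Y) → (∀ x → b (Inverse.to Φ x) ≡ a x) →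
  ∀ J → Restricted a J ↔ Restricted b J
restrict {b = b} Φ h J = mk↔ₛ′
  (λ (x , e) → Inverse.to Φ x , trans (h x) e)
  (λ (y , e) → Inverse.from Φ y , trans (sym (h _)) (trans (cong b (Inverse.strictlyInverseˡ Φ y)) e))
  (λ (y , e) → Restricted-≡ (Inverse.strictlyInverseˡ Φ y))
  (λ (x , e) → Restricted-≡ (Inverse.strictlyInverseʳ Φ x))

fibrewise : ∀ {I : Set} {X : I → Set} {Y : Set} → (∀ i → X i ↔ Y) → Σ I X ↔ (I × Y)
fibrewise Φ = mk↔ₛ′ (λ (i , x) → i , Inverse.to (Φ i) x) (λ (i , y) → i , Inverse.from (Φ i) y)
  (λ (i , y) → cong (i ,_) (Inverse.strictlyInverseˡ (Φ i) y))
  (λ (i , x) → cong (i ,_) (Inverse.strictlyInverseʳ (Φ i) x))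

-- With the largest value in last place, the junction before it is an ascent and the cyclic junction
-- after it a descent, so only the junctions read by `D` are free.
D⇒cDesPerm : ∀ {m} {u v : Word m} → Fixing last u → Fixing last v → D (lookup u) ≡ D (lookup v) →
    cDesPerm u ≡ cDesPerm v
D⇒cDesPerm {m} {u} {v} fu fv eq = Vecₚ.tabulate-cong λ i → same i
  where
  descent : Word m → Fin (suc (suc m)) → Bool
  descent u i = toℕ (lookup u (rot i)) <ᵇ toℕ (lookup u i)
  at-last : ∀ u → Fixing last u → descent u last ≡ true
  at-last u (p , e) = <ᵇ-true (subst (λ z → toℕ (lookup u (rot last)) < toℕ z) (sym e)
    (<last λ q → contradiction (trans (sym (rot-last last (toℕ-fromℕ (suc m))))
        (cong toℕ (p _ _ (trans q (sym e)))))
      λ q' → contradiction (trans q' (toℕ-fromℕ (suc m))) λ ()))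
  at-penultimate : ∀ u → Fixing last u → descent u (inject₁ (fromℕ m)) ≡ false
  at-penultimate u (p , e) = <ᵇ-false (subst (λ z → toℕ (lookup u (inject₁ (fromℕ m))) ≤ toℕ z)
    (sym (trans (cong (lookup u) (rot-inject₁ (fromℕ m))) e)) (≤last _))
  at-lo : ∀ u i → descent u (lo i) ≡ lookup (D (lookup u)) i
  at-lo u i = trans (cong (λ z → toℕ (lookup u z) <ᵇ toℕ (lookup u (lo i))) (rot-inject₁ (inject₁ i)))
    (sym (Vecₚ.lookup∘tabulate (λ i → toℕ (lookup u (hi i)) <ᵇ toℕ (lookup u (lo i))) i))
  same : ∀ i → descent u i ≡ descent v i
  same i with topView i
  ... | ‵fromℕ = trans (at-last u fu) (sym (at-last v fv))
  ... | ‵inject₁ j with topView j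
  ...   | ‵fromℕ = trans (at-penultimate u fu) (sym (at-penultimate v fv))
  ...   | ‵inject₁ i′ = trans (at-lo u i′) (trans (cong (λ w → lookup w i′) eq) (sym (at-lo v i′)))

-- Comparing the rotated class with the tableaux

module Assembly (m : ℕ) (J : Subset m) where

  private
    P : Set
    P = Fin (suc (suc m))

  Centred : Set
  Centred = Restricted {Sub (fixing? {m} last)} (iDes ∘ proj₁) J

  -- Normalizing rotates the value at the last position to the end. After the positions have been
  -- rotated by `center k`, that position is `center k last`, so the condition on the inverse
  -- descents is read around this column.
  V : P → Set
  V k = Restricted {Sub (fixing? {m} last)} (iDesAt (center k last) ∘ proj₁) J

  module _ {π ζ : Word m} {k : P} (h : ∀ x → lookup ζ (center k x) ≡ lookup π x) where

    recenter≡normalize : ∀ e → recenter (center k last) (lookup ζ) e ≡ normalize π e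
    recenter≡normalize e = cong₂ center (h last) (trans (cong (lookup ζ) (trans
      (cong (center⁻ (center k last)) (sym (center-center-last k e)))
          (center⁻∘center (center k last) (center k e)))) (h e))

    iDesAt≡normalized : IsPerm π → IsPerm ζ → iDesAt (center k last) ζ ≡ D (inv (normalize π))
    iDesAt≡normalized πi ζi = D-cong (inv-cong (recenter-inj (center k last) ζi) (normalize-inj {π = π} πi)
        recenter≡normalize)

    cDesPerm-rotated : cDesPerm π ≡ cDesAt k ζ
    cDesPerm-rotated = Vecₚ.tabulate-cong λ i → trans
      (cong₂ (λ a b → toℕ a <ᵇ toℕ b) (trans (sym (h (rot i))) (cong (lookup ζ) (center-rot k i))) (sym (h i)))
      (sym (Vecₚ.lookup∘tabulate (λ i → toℕ (lookup ζ (rot i)) <ᵇ toℕ (lookup ζ i)) (center k i)))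

  V-≡ : ∀ {k k' u u' p p' e e'} → k ≡ k' → u ≡ u' →
    _≡_ {A = Σ P V} (k , (u , p) , e) (k' , (u' , p') , e')
  V-≡ {k} refl refl = cong (k ,_) (Restricted-≡ (Sub-≡ {P? = fixing? last} refl))

  private
    centreOf : Word m → P
    centreOf π = inv (lookup π) last
    rotateBy : P → Word m → Word m
    rotateBy k π = tabulate (lookup π ∘ center⁻ k)
    unrotate : P → Word m → Word m
    unrotate k ζ = tabulate (lookup ζ ∘ center k)
    l-rot : ∀ k π x → lookup (rotateBy k π) x ≡ lookup π (center⁻ k x)
    l-rot k π = Vecₚ.lookup∘tabulate (lookup π ∘ center⁻ k)
    l-unrot : ∀ k ζ x → lookup (unrotate k ζ) x ≡ lookup ζ (center k x)
    l-unrot k ζ = Vecₚ.lookup∘tabulate (lookup ζ ∘ center k)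
    rot-perm : ∀ k π → IsPerm π → IsPerm (rotateBy k π)
    rot-perm k π πi a b e = Inj-∘ πi (center⁻-inj k) a b (trans (sym (l-rot k π a)) (trans e (l-rot k π b)))
    unrot-perm : ∀ k ζ → IsPerm ζ → IsPerm (unrotate k ζ)
    unrot-perm k ζ ζi a b e = Inj-∘ ζi (center-inj k) a b
        (trans (sym (l-unrot k ζ a)) (trans e (l-unrot k ζ b)))
    rot-fixing : ∀ π → IsPerm π → Fixing last (rotateBy (centreOf π) π)
    rot-fixing π πi = rot-perm (centreOf π) π πi ,
      trans (l-rot (centreOf π) π last) (trans (cong (lookup π) (center⁻-to-last (centreOf π))) (f∘inv πi last))
    compat : ∀ k π x → lookup (rotateBy k π) (center k x) ≡ lookup π x
    compat k π x = trans (l-rot k π (center k x)) (cong (lookup π) (center⁻∘center k x))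

  opaque
    rotations : CD m J ↔ Σ P V
    rotations = mk↔ₛ′ to from to∘from from∘to
      where
      to : CD m J → Σ P V
      to (π , p) = centreOf π , (rotateBy (centreOf π) π , fromWitness (rot-fixing π (proj₁ (toWitness p)))) ,
        trans (iDesAt≡normalized {π} {rotateBy (centreOf π) π} {centreOf π} (compat (centreOf π) π)
            (proj₁ (toWitness p)) (proj₁ (rot-fixing π (proj₁ (toWitness p)))))
          (InCD⇒descents {π = π} (toWitness p))
      from : Σ P V → CD m J
      from (k , (ζ , p) , e) = unrotate k ζ , fromWitness
          (descents⇒InCD {π = unrotate k ζ} ui
          (trans (sym (iDesAt≡normalized {unrotate k ζ} {ζ} {k} (λ x → sym (l-unrot k ζ x)) ui ζi)) e))
        where
        ζi : IsPerm ζ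
        ζi = proj₁ (toWitness p)
        ui : IsPerm (unrotate k ζ)
        ui = unrot-perm k ζ ζi
      to∘from : ∀ y → to (from y) ≡ y
      to∘from (k , (ζ , p) , e) = V-≡ k≡ (lookup-ext λ x → trans
          (cong (λ k′ → lookup (rotateBy k′ (unrotate k ζ)) x) k≡)
          (trans (l-rot k (unrotate k ζ) x)
              (trans (l-unrot k ζ (center⁻ k x)) (cong (lookup ζ) (center∘center⁻ k x)))))
        where
        k≡ : centreOf (unrotate k ζ) ≡ k
        k≡ = inv-unique (unrot-perm k ζ (proj₁ (toWitness p)))
          (trans (l-unrot k ζ k) (trans (cong (lookup ζ) (center-self-last k)) (proj₂ (toWitness p))))
      from∘to : ∀ x → from (to x) ≡ x
      from∘to (π , p) = Sub-≡ {P? = inCD? m J} (lookup-ext λ x →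
        trans (l-unrot (centreOf π) (rotateBy (centreOf π) π) x) (compat (centreOf π) π x))

    rotations-lookup : ∀ a x → lookup (proj₁ (proj₁ (proj₂ (Inverse.to rotations a))))
        (center (proj₁ (Inverse.to rotations a)) x) ≡
      lookup (proj₁ a) x
    rotations-lookup (π , _) = compat (centreOf π) π

  straightenAll : Σ P V ↔ (P × Centred)
  straightenAll = fibrewise λ k →
    restrict (proj₁ (straightening (center k last))) (λ x → proj₁ (proj₂ (straightening (center k last)) x)) J

  cDes⟨_⟩ : P × Centred → Subset (suc (suc m))
  cDes⟨ k , (ζ , _) , _ ⟩ = cDesAt k ζ

  straightenAll-cDes : ∀ z → cDesAt (proj₁ z) (proj₁ (proj₁ (proj₂ z))) ≡ cDes⟨ Inverse.to straightenAll z ⟩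
  straightenAll-cDes (k , x , _) = cong (λ c → tabulate (λ i → lookup c (center k i)))
    (D⇒cDesPerm {u = proj₁ x} {proj₁ (Inverse.to (proj₁ (straightening (center k last))) x)}
        (toWitness (proj₂ x)) (toWitness (proj₂ (Inverse.to (proj₁ (straightening (center k last))) x)))
      (sym (proj₂ (proj₂ (straightening (center k last)) x))))

  straightened : CD m J ↔ (P × Centred)
  straightened = straightenAll ↔-∘ rotations

  straightened-cDes : ∀ a → cDesPerm (proj₁ a) ≡ cDes⟨ Inverse.to straightened a ⟩
  straightened-cDes a = trans (cDesPerm-rotated {proj₁ a} {proj₁ (proj₁ (proj₂ (Inverse.to rotations a)))}
      {proj₁ (Inverse.to rotations a)} (rotations-lookup a))
    (straightenAll-cDes (Inverse.to rotations a))

  open Ribbon J using (shape; not-ribbon; hasDescents?; tableaux; tableaux-Des)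

  TabAt : P → Set
  TabAt k = Restricted {Sub (fixing? k)} (iDes ∘ proj₁) J

  TabAt-≡ : ∀ {k k′ σ q q′ e e′} → k ≡ k′ → _≡_ {A = Σ P TabAt} (k , (σ , q) , e) (k′ , (σ , q′) , e′)
  TabAt-≡ {k} refl = cong (k ,_) (Restricted-≡ (Sub-≡ {P? = fixing? k} refl))

  opaque
    byLargest : Sub hasDescents? ↔ Σ P TabAt
    byLargest = mk↔ₛ′
      (λ (σ , p) → inv (lookup σ) last , (σ , fromWitness
          (proj₁ (toWitness p) , f∘inv (proj₁ (toWitness p)) last)) , proj₂ (toWitness p))
      (λ (k , (σ , q) , e) → σ , fromWitness (proj₁ (toWitness q) , e))
      (λ (k , (σ , q) , e) → TabAt-≡ (inv-unique (proj₁ (toWitness q)) (proj₂ (toWitness q))))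
      (λ _ → Sub-≡ {P? = hasDescents?} refl)

    byLargest-word : ∀ x → proj₁ (proj₁ (proj₂ (Inverse.to byLargest x))) ≡ proj₁ x
    byLargest-word _ = refl

  resortAll : Σ P TabAt ↔ (P × Centred)
  resortAll = fibrewise λ k → restrict (proj₁ (Tableau.resort k)) (λ x → proj₁ (proj₂ (Tableau.resort k) x)) J

  resortAll-Des : ∀ z i → lookup cDes⟨ Inverse.to resortAll z ⟩ (inject₁ i) ≡ lookup
      (linDes (proj₁ (proj₁ (proj₂ z)))) i
  resortAll-Des (k , x , _) = proj₂ (proj₂ (Tableau.resort k) x)

  tabulated : SYT shape ↔ (P × Centred)
  tabulated = resortAll ↔-∘ (byLargest ↔-∘ tableaux)

  tabulated-Des : ∀ T i → lookup cDes⟨ Inverse.to tabulated T ⟩ (inject₁ i) ≡ lookup (DesT (proj₁ T)) i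
  tabulated-Des T i = trans (resortAll-Des (Inverse.to byLargest (Inverse.to tableaux T)) i)
    (trans (cong (λ σ → lookup (linDes σ) i) (byLargest-word (Inverse.to tableaux T))) (tableaux-Des T i))

  -- `cDesAt k ζ` depends on `k` only through a rotation of the indices, so moving the centre by one
  -- step and keeping `ζ` rotates the cyclic descent set.
  rotateCentre : (P × Centred) ↔ (P × Centred)
  rotateCentre = mk↔ₛ′ (λ (k , z) → rot k , z) (λ (k , z) → rotPow (suc m) k , z)
    (λ (k , z) → cong (_, z) (rotPow-full k))
    (λ (k , z) → cong (_, z) (trans (rotPow-comm (suc m) 1 k) (rotPow-full k)))

  -- The centre carries the largest value of the word, so the step after it falls. Likewise the step
  -- into it rises, which keeps the set from being full.
  cDes-centre : ∀ z → lookup cDes⟨ z ⟩ (proj₁ z) ≡ true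
  cDes-centre (k , (ζ , p) , _) = trans (lookup-cDesAt k ζ k) (<ᵇ-true
    (subst (λ c → toℕ (lookup ζ (rot c)) < toℕ (lookup ζ c)) (sym (center-self-last k))
      (subst (λ c → toℕ (lookup ζ (rot last)) < toℕ c) (sym fix)
        (<last λ q → contradiction (trans (sym (rot-last last (toℕ-fromℕ (suc m))))
            (cong toℕ (inj _ _ (trans q (sym fix))))) λ ()))))
    where
    inj : IsPerm ζ
    inj = proj₁ (toWitness p)
    fix : lookup ζ last ≡ last
    fix = proj₂ (toWitness p)

  cDes-before-centre : ∀ z → ∃ λ i → lookup cDes⟨ z ⟩ i ≡ false
  cDes-before-centre (k , (ζ , p) , _) = center⁻ k penultimate ,
      trans (lookup-cDesAt k ζ (center⁻ k penultimate)) (<ᵇ-false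
    (subst (λ c → toℕ (lookup ζ c) ≤ toℕ (lookup ζ (rot c))) (sym (center∘center⁻ k penultimate))
      (subst (λ c → toℕ (lookup ζ penultimate) ≤ toℕ c)
          (sym (trans (cong (lookup ζ) (rot-inject₁ (fromℕ m))) (proj₂ (toWitness p)))) (≤last _))))
    where
    penultimate : P
    penultimate = inject₁ (fromℕ m)

  extension : CyclicDescentExtension shape
  extension = record
    { cDes = λ T → cDes⟨ Inverse.to tabulated T ⟩
    ; ψ = ↔-sym tabulated ↔-∘ (rotateCentre ↔-∘ tabulated)
    ; extends = tabulated-Des
    ; equivariant = λ T i → let z = Inverse.to tabulated T in
        trans (cong (λ z → lookup cDes⟨ z ⟩ (rot i))
            (Inverse.strictlyInverseˡ tabulated (Inverse.to rotateCentre z)))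
          (rotated z i)
    ; nonEmpty = λ T e → let z = Inverse.to tabulated T in
        contradiction (trans (sym (cDes-centre z))
            (trans (cong (λ v → lookup v (proj₁ z)) e) (Vecₚ.lookup-replicate (proj₁ z) false))) λ ()
    ; nonFull = λ T e → let i , ei = cDes-before-centre (Inverse.to tabulated T) in
        contradiction (trans (sym ei) (trans (cong (λ v → lookup v i) e) (Vecₚ.lookup-replicate i true))) λ ()
    }
    where
    rotated : ∀ z i → lookup cDes⟨ Inverse.to rotateCentre z ⟩ (rot i) ≡ lookup cDes⟨ z ⟩ i
    rotated (k , (ζ , _) , _) i = trans (lookup-cDesAt (rot k) ζ (rot i))
      (trans (cong (λ c → toℕ (lookup ζ (rot c)) <ᵇ toℕ (lookup ζ c)) (center-rot-rot k i))
          (sym (lookup-cDesAt k ζ i)))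

  cyclicSchurPositive : CyclicSchurPositive (suc m) (CD m J) proj₁
  cyclicSchurPositive = 1 , (λ _ → shape) , (λ _ → not-ribbon) , (λ _ → extension) ,
    mk↔ₛ′ (λ a → zero , Inverse.to Φ a) (λ (_ , T) → Inverse.from Φ T)
      (λ { (zero , T) → cong (zero ,_) (Inverse.strictlyInverseˡ Φ T) }) (Inverse.strictlyInverseʳ Φ) ,
    λ a → trans (straightened-cDes a) (sym
        (cong cDes⟨_⟩ (Inverse.strictlyInverseˡ tabulated (Inverse.to straightened a))))
    where
    Φ : CD m J ↔ SYT shape
    -- Both sides are compared inside `P × Centred`, where their statistics are one and the same
    -- function.
    Φ = ↔-sym tabulated ↔-∘ straightened

theorem4p9 : ∀ (m : ℕ) (J : Subset m) →
    CyclicSchurPositive (suc m) (CD m J) proj₁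
theorem4p9 m J = Assembly.cyclicSchurPositive m J
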